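{- Suppose $n$ is a positive integer such that every angle $\alpha$ is $n$-sectable, i.e. for any angle $\alpha$ there exists a Euclidean (straightedge and compass) construction that starts with $\alpha$ and produces $\alpha/n$. Then $n$ has the form $2^k$ for some non-negative integer $k$.
   Context: Let $S\subseteq\mathbb{R}^2$ contain $(0,0)$ and $(1,0)$. A point is constructible over $S$ if it can be obtained from points of $S$ by a finite sequence of straightedge-and-compass steps: (1) given two distinct points already available, one may draw the line through them, or the circle centered at one of them and passing through the other; (2) given two lines, two circles, or a line and a circle already drawn, one may add their intersection points. $C(S)$ denotes the set of all points constructible over $S$. An angle is given by its radian measure $\alpha\in\mathbb{R}$ and is represented by the point $(\cos\alpha,\sin\alpha)$ of the unit circle. The angle $\alpha$ is $n$-sectable if $(\cos(\alpha/n),\sin(\alpha/n))\in C(\{(0,0),(1,0),(\cos\alpha,\sin\alpha)\})$. -}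

module Defs where

import Algebra.Definitions.RawSemiring as RawSemiringOps
open import Data.Integer as ℤ using (+_; -[1+_])
import Data.Integer.Properties as ℤ
open import Data.Nat as ℕ using (ℕ; zero; suc; _!)
import Data.Nat.Properties as ℕ
open import Data.Product using (∃; _×_; _,_; proj₁; proj₂)
open import Data.Rational
open import Data.Rational.Properties
open import Data.Rational.Solver using (module +-*-Solver)
open import Data.Sum using (inj₁; inj₂)
open import Level using (0ℓ)
open import Relation.Binary.PropositionalEquality
open import Relation.Nullary using (¬_)
open import Relation.Unary using (Pred; _∈_; _≐_; ｛_｝; _∪_)

open RawSemiringOps +-*-rawSemiring using (_^_)

IsCauchy : (ℕ → ℚ) → Set
IsCauchy u = ∀ ε → 0ℚ < ε → ∃ λ N → ∀ m n → N ℕ.≤ m → N ℕ.≤ n → ∣ u m - u n ∣ ≤ ε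

-- The reals are this type taken up to _≃ᵣ_.
record ℝ : Set where
  constructor mkℝ
  field
    seq    : ℕ → ℚ
    cauchy : IsCauchy seq

open ℝ public

infix 4 _≃ᵣ_

_≃ᵣ_ : ℝ → ℝ → Set
x ≃ᵣ y = ∀ ε → 0ℚ < ε → ∃ λ N → ∀ n → N ℕ.≤ n → ∣ seq x n - seq y n ∣ ≤ ε

private
  module S = +-*-Solver

≥0 : ∀ {p} → 0ℚ ≤ p → NonNegative p
≥0 = nonNegative

0≤*0≤ : ∀ {p q} → 0ℚ ≤ p → 0ℚ ≤ q → 0ℚ ≤ p * q
0≤*0≤ {p} {q} 0≤p 0≤q =
  nonNegative⁻¹ _ {{nonNeg*nonNeg⇒nonNeg p {{≥0 0≤p}} q {{≥0 0≤q}}}}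

*-mono-≤ : ∀ {p q r s} → 0ℚ ≤ r → 0ℚ ≤ q → p ≤ q → r ≤ s → p * r ≤ q * s
*-mono-≤ {p} {q} {r} {s} 0≤r 0≤q p≤q r≤s =
  ≤-trans (*-monoʳ-≤-nonNeg r {{≥0 0≤r}} p≤q) (*-monoˡ-≤-nonNeg q {{≥0 0≤q}} r≤s)

p≤p+q : ∀ {p q} → 0ℚ ≤ q → p ≤ p + q
p≤p+q {p} {q} 0≤q = subst (_≤ p + q) (+-identityʳ p) (+-monoʳ-≤ p 0≤q)

p≤q+p : ∀ {p q} → 0ℚ ≤ q → p ≤ q + p
p≤q+p {p} {q} 0≤q = subst (_≤ q + p) (+-identityˡ p) (+-monoˡ-≤ p 0≤q)

0≤+0≤ : ∀ {p q} → 0ℚ ≤ p → 0ℚ ≤ q → 0ℚ ≤ p + q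
0≤+0≤ 0≤p 0≤q = ≤-trans 0≤p (p≤p+q 0≤q)

0<*0< : ∀ {p q} → 0ℚ < p → 0ℚ < q → 0ℚ < p * q
0<*0< {p} {q} 0<p 0<q =
  positive⁻¹ _ {{pos*pos⇒pos p {{positive 0<p}} q {{positive 0<q}}}}

0<½ : 0ℚ < ½
0<½ = positive⁻¹ ½

0≤1 : 0ℚ ≤ 1ℚ
0≤1 = nonNegative⁻¹ 1ℚ

½+½ : ∀ p → ½ * p + ½ * p ≡ p
½+½ = S.solve 1 (λ p → S.con ½ S.:* p S.:+ S.con ½ S.:* p S.:= p) refl

fromℕ : ℕ → ℚ
fromℕ n = + n / 1

archimedes : ∀ p → ∃ λ n → p ≤ fromℕ n
archimedes p@(mkℚ (+ n) d c) = n , toℚᵘ-cancel-≤ (ℚᵘ.≤-trans le (ℚᵘ.≤-reflexive (ℚᵘ.≃-sym (toℚᵘ-fromℚᵘ (ℚᵘ.mkℚᵘ (+ n) 0)))))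
  where
  import Data.Rational.Unnormalised as ℚᵘ
  import Data.Rational.Unnormalised.Properties as ℚᵘ
  le : toℚᵘ p ℚᵘ.≤ ℚᵘ.mkℚᵘ (+ n) 0
  le = ℚᵘ.*≤* (ℤ.*-monoˡ-≤-nonNeg (+ n) (ℤ.+≤+ (ℕ.s≤s ℕ.z≤n)))
archimedes p@(mkℚ -[1+ n ] d c) = 0 , <⇒≤ (negative⁻¹ p)

fromℕ-suc : ∀ n → fromℕ (suc n) ≡ 1ℚ + fromℕ n
fromℕ-suc n = sym (toℚᵘ-injective (ℚᵘ.≃-trans (toℚᵘ-homo-+ 1ℚ (fromℕ n))
    (ℚᵘ.≃-trans (ℚᵘ.+-congʳ (toℚᵘ 1ℚ) (toℚᵘ-fromℚᵘ (ℚᵘ.mkℚᵘ (+ n) 0)))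
    (ℚᵘ.≃-trans (ℚᵘ.*≡* (cong (λ z → (+ 1 ℤ.+ z) ℤ.* + 1) (ℤ.*-identityʳ (+ n))))
    (ℚᵘ.≃-sym (toℚᵘ-fromℚᵘ (ℚᵘ.mkℚᵘ (+ suc n) 0)))))))
  where
  import Data.Rational.Unnormalised as ℚᵘ
  import Data.Rational.Unnormalised.Properties as ℚᵘ

fromℕ-mono : ∀ {m n} → m ℕ.≤ n → fromℕ m ≤ fromℕ n
fromℕ-mono {n = n} ℕ.z≤n = nonNegative⁻¹ _ {{normalize-nonNeg n 1}}
fromℕ-mono {suc m} {suc n} (ℕ.s≤s m≤n) =
  subst₂ _≤_ (sym (fromℕ-suc m)) (sym (fromℕ-suc n)) (+-monoʳ-≤ 1ℚ (fromℕ-mono m≤n))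

0≤fromℕ : ∀ n → 0ℚ ≤ fromℕ n
0≤fromℕ n = fromℕ-mono {0} {n} ℕ.z≤n

0<fromℕ-suc : ∀ n → 0ℚ < fromℕ (suc n)
0<fromℕ-suc n = positive⁻¹ _ {{normalize-pos (suc n) 1}}

-- Some δ > 0 satisfies A δ ≤ ε.
shrink : ∀ A → 0ℚ ≤ A → ∀ ε → 0ℚ < ε → ∃ λ δ → 0ℚ < δ × A * δ ≤ ε
shrink A 0≤A ε 0<ε = δ , 0<δ , le
  where
  0<B : 0ℚ < A + 1ℚ
  0<B = <-≤-trans (positive⁻¹ 1ℚ) (p≤q+p 0≤A)
  instance
    B>0 : Positive (A + 1ℚ)
    B>0 = positive 0<B
    B≢0 : NonZero (A + 1ℚ)
    B≢0 = pos⇒nonZero (A + 1ℚ)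
  δ = 1/ (A + 1ℚ) * ε
  0<δ : 0ℚ < δ
  0<δ = 0<*0< {1/ (A + 1ℚ)} {ε} (positive⁻¹ _ {{1/pos⇒pos (A + 1ℚ)}}) 0<ε
  le : A * δ ≤ ε
  le = subst (A * δ ≤_)
    (trans (sym (*-assoc (A + 1ℚ) _ ε))
      (trans (cong (_* ε) (*-inverseʳ (A + 1ℚ))) (*-identityˡ ε)))
    (*-monoʳ-≤-nonNeg δ {{≥0 (<⇒≤ 0<δ)}} {A} {A + 1ℚ} (p≤p+q 0≤1))

tri : ∀ p q r → ∣ p - r ∣ ≤ ∣ p - q ∣ + ∣ q - r ∣
tri p q r = subst (λ z → ∣ z ∣ ≤ ∣ p - q ∣ + ∣ q - r ∣)
  (S.solve 3 (λ p q r → (p S.:- q) S.:+ (q S.:- r) S.:= p S.:- r) refl p q r)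
  (∣p+q∣≤∣p∣+∣q∣ (p - q) (q - r))

∣p-q∣≡∣q-p∣ : ∀ p q → ∣ p - q ∣ ≡ ∣ q - p ∣
∣p-q∣≡∣q-p∣ p q = trans (sym (∣-p∣≡∣p∣ (p - q)))
  (cong ∣_∣ (S.solve 2 (λ p q → S.:- (p S.:- q) S.:= q S.:- p) refl p q))

bounded : (x : ℝ) → ∃ λ B → 0ℚ ≤ B × (∀ n → ∣ seq x n ∣ ≤ B)
bounded x = prefix N + 1ℚ , 0≤+0≤ (0≤prefix N) 0≤1 , bound
  where
  u = seq x
  prefix : ℕ → ℚ
  prefix zero    = ∣ u 0 ∣
  prefix (suc n) = prefix n + ∣ u (suc n) ∣
  0≤prefix : ∀ n → 0ℚ ≤ prefix n
  0≤prefix zero    = 0≤∣p∣ (u 0)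
  0≤prefix (suc n) = 0≤+0≤ (0≤prefix n) (0≤∣p∣ (u (suc n)))
  last : ∀ n → ∣ u n ∣ ≤ prefix n
  last zero    = ≤-refl
  last (suc n) = p≤q+p (0≤prefix n)
  within : ∀ {m n} → m ℕ.≤′ n → ∣ u m ∣ ≤ prefix n
  within {m} ℕ.≤′-refl     = last m
  within (ℕ.≤′-step {n} r) = ≤-trans (within r) (p≤p+q (0≤∣p∣ (u (suc n))))
  N = proj₁ (cauchy x 1ℚ (positive⁻¹ 1ℚ))
  bound : ∀ n → ∣ u n ∣ ≤ prefix N + 1ℚ
  bound n with ℕ.≤-total n N
  ... | inj₁ n≤N = ≤-trans (within (ℕ.≤⇒≤′ n≤N)) (p≤p+q 0≤1)
  ... | inj₂ N≤n = ≤-trans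
    (subst (λ z → ∣ z ∣ ≤ ∣ u N ∣ + ∣ u n - u N ∣)
      (S.solve 2 (λ a b → b S.:+ (a S.:- b) S.:= a) refl (u n) (u N))
      (∣p+q∣≤∣p∣+∣q∣ (u N) (u n - u N)))
    (+-mono-≤ (last N) (proj₂ (cauchy x 1ℚ (positive⁻¹ 1ℚ)) n N N≤n ℕ.≤-refl))

fromℚ : ℚ → ℝ
fromℚ q = mkℝ (λ _ → q) λ ε 0<ε → 0 , λ _ _ _ _ →
  subst (_≤ ε) (sym (cong ∣_∣ (+-inverseʳ q))) (<⇒≤ 0<ε)

infixl 6 _+ᵣ_ _-ᵣ_
infixl 7 _*ᵣ_ _/ᵣ_
infix  8 -ᵣ_

_+ᵣ_ : ℝ → ℝ → ℝ
x +ᵣ y = mkℝ (λ n → seq x n + seq y n) λ ε 0<ε →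
  let h = 0<*0< 0<½ 0<ε
      (M , f) = cauchy x (½ * ε) h
      (N , g) = cauchy y (½ * ε) h
  in M ℕ.⊔ N , λ m n p q →
    let a = seq x m ; b = seq y m ; c = seq x n ; d = seq y n in
    begin
      ∣ (a + b) - (c + d) ∣     ≡⟨ cong ∣_∣ (S.solve 4 (λ a b c d → (a S.:+ b) S.:- (c S.:+ d) S.:= (a S.:- c) S.:+ (b S.:- d)) refl a b c d) ⟩
      ∣ (a - c) + (b - d) ∣     ≤⟨ ∣p+q∣≤∣p∣+∣q∣ (a - c) (b - d) ⟩
      ∣ a - c ∣ + ∣ b - d ∣     ≤⟨ +-mono-≤ (f m n (ℕ.m⊔n≤o⇒m≤o M N p) (ℕ.m⊔n≤o⇒m≤o M N q))
                                            (g m n (ℕ.m⊔n≤o⇒n≤o M N p) (ℕ.m⊔n≤o⇒n≤o M N q)) ⟩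
      ½ * ε + ½ * ε             ≡⟨ ½+½ ε ⟩
      ε                         ∎
  where open ≤-Reasoning

-ᵣ_ : ℝ → ℝ
-ᵣ x = mkℝ (λ n → - seq x n) λ ε 0<ε →
  let (N , f) = cauchy x ε 0<ε
  in N , λ m n p q → subst (_≤ ε)
    (trans (∣p-q∣≡∣q-p∣ (seq x m) (seq x n))
      (cong ∣_∣ (S.solve 2 (λ a b → b S.:- a S.:= (S.:- a) S.:- (S.:- b)) refl (seq x m) (seq x n))))
    (f m n p q)

_-ᵣ_ : ℝ → ℝ → ℝ
x -ᵣ y = x +ᵣ -ᵣ y

_*ᵣ_ : ℝ → ℝ → ℝ
x *ᵣ y = mkℝ (λ n → seq x n * seq y n) λ ε 0<ε →
  let h = 0<*0< 0<½ 0<ε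
      (A , 0≤A , x≤A) = bounded x
      (B , 0≤B , y≤B) = bounded y
      (δ , 0<δ , Bδ≤) = shrink B 0≤B (½ * ε) h
      (η , 0<η , Aη≤) = shrink A 0≤A (½ * ε) h
      (M , f) = cauchy x δ 0<δ
      (N , g) = cauchy y η 0<η
  in M ℕ.⊔ N , λ m n p q →
    let a = seq x m ; b = seq y m ; c = seq x n ; d = seq y n in
    begin
      ∣ a * b - c * d ∣                     ≡⟨ cong ∣_∣ (S.solve 4 (λ a b c d → a S.:* b S.:- c S.:* d S.:= b S.:* (a S.:- c) S.:+ c S.:* (b S.:- d)) refl a b c d) ⟩
      ∣ b * (a - c) + c * (b - d) ∣         ≤⟨ ∣p+q∣≤∣p∣+∣q∣ (b * (a - c)) (c * (b - d)) ⟩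
      ∣ b * (a - c) ∣ + ∣ c * (b - d) ∣     ≡⟨ cong₂ _+_ (∣p*q∣≡∣p∣*∣q∣ b (a - c)) (∣p*q∣≡∣p∣*∣q∣ c (b - d)) ⟩
      ∣ b ∣ * ∣ a - c ∣ + ∣ c ∣ * ∣ b - d ∣ ≤⟨ +-mono-≤
          (*-mono-≤ (0≤∣p∣ (a - c)) 0≤B (y≤B m) (f m n (ℕ.m⊔n≤o⇒m≤o M N p) (ℕ.m⊔n≤o⇒m≤o M N q)))
          (*-mono-≤ (0≤∣p∣ (b - d)) 0≤A (x≤A n) (g m n (ℕ.m⊔n≤o⇒n≤o M N p) (ℕ.m⊔n≤o⇒n≤o M N q))) ⟩
      B * δ + A * η                         ≤⟨ +-mono-≤ Bδ≤ Aη≤ ⟩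
      ½ * ε + ½ * ε                         ≡⟨ ½+½ ε ⟩
      ε                                     ∎
  where open ≤-Reasoning

_/ᵣ_ : ℝ → (n : ℕ) → .{{_ : ℕ.NonZero n}} → ℝ
x /ᵣ n = x *ᵣ fromℚ (+ 1 / n)

expTerm : ℕ → ℚ → ℚ
expTerm k x = x ^ k * (+ 1 / k !) {{k ℕ.!≢0}}

partialSum : (ℕ → ℚ) → ℕ → ℚ → ℚ
partialSum c zero    x = 0ℚ
partialSum c (suc N) x = partialSum c N x + c N * expTerm N x

-- Convergence of the power series  Σₖ cₖ xᵏ / k!  for  ∣cₖ∣ ≤ 1.
module Series where

  fromℕ-+ : ∀ m n → fromℕ (m ℕ.+ n) ≡ fromℕ m + fromℕ n
  fromℕ-+ zero    n = sym (+-identityˡ (fromℕ n))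
  fromℕ-+ (suc m) n = begin
    fromℕ (suc (m ℕ.+ n))       ≡⟨ fromℕ-suc (m ℕ.+ n) ⟩
    1ℚ + fromℕ (m ℕ.+ n)        ≡⟨ cong (λ z → 1ℚ + z) (fromℕ-+ m n) ⟩
    1ℚ + (fromℕ m + fromℕ n)    ≡⟨ sym (+-assoc 1ℚ (fromℕ m) (fromℕ n)) ⟩
    1ℚ + fromℕ m + fromℕ n      ≡⟨ cong (_+ fromℕ n) (sym (fromℕ-suc m)) ⟩
    fromℕ (suc m) + fromℕ n     ∎
    where open ≡-Reasoning

  fromℕ-* : ∀ m n → fromℕ (m ℕ.* n) ≡ fromℕ m * fromℕ n
  fromℕ-* zero    n = sym (*-zeroˡ (fromℕ n))
  fromℕ-* (suc m) n = begin
    fromℕ (n ℕ.+ m ℕ.* n)       ≡⟨ fromℕ-+ n (m ℕ.* n) ⟩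
    fromℕ n + fromℕ (m ℕ.* n)   ≡⟨ cong (λ z → fromℕ n + z) (fromℕ-* m n) ⟩
    fromℕ n + fromℕ m * fromℕ n ≡⟨ S.solve 2 (λ a b → b S.:+ a S.:* b S.:= (S.con 1ℚ S.:+ a) S.:* b) refl (fromℕ m) (fromℕ n) ⟩
    (1ℚ + fromℕ m) * fromℕ n    ≡⟨ cong (_* fromℕ n) (sym (fromℕ-suc m)) ⟩
    fromℕ (suc m) * fromℕ n     ∎
    where open ≡-Reasoning

  fromℕ-inverse : ∀ d .{{_ : ℕ.NonZero d}} → fromℕ d * (+ 1 / d) ≡ 1ℚ
  fromℕ-inverse d@(suc d-1) = toℚᵘ-injective (ℚᵘ.≃-trans (toℚᵘ-homo-* (fromℕ d) (+ 1 / d))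
    (ℚᵘ.≃-trans (ℚᵘ.*-cong (toℚᵘ-fromℚᵘ (ℚᵘ.mkℚᵘ (+ d) 0)) (toℚᵘ-fromℚᵘ (ℚᵘ.mkℚᵘ (+ 1) d-1)))
      (ℚᵘ.*≡* (cong +_ (trans (cong (ℕ._* 1) (ℕ.*-identityʳ d)) (trans (ℕ.*-identityʳ d) (sym (trans (ℕ.*-identityˡ (1 ℕ.* d)) (ℕ.*-identityˡ d)))))))))
    where
    import Data.Rational.Unnormalised as ℚᵘ
    import Data.Rational.Unnormalised.Properties as ℚᵘ

  1/! : ℕ → ℚ
  1/! k = (+ 1 / k !) {{k ℕ.!≢0}}

  1/!-suc : ∀ k → fromℕ (suc k) * 1/! (suc k) ≡ 1/! k
  1/!-suc k = begin
    F * I'              ≡⟨ sym (*-identityʳ (F * I')) ⟩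
    F * I' * 1ℚ         ≡⟨ cong (F * I' *_) (sym (fromℕ-inverse (k !) {{k ℕ.!≢0}})) ⟩
    F * I' * (G * I)    ≡⟨ S.solve 4 (λ F I' G I → F S.:* I' S.:* (G S.:* I) S.:= F S.:* G S.:* I' S.:* I) refl F I' G I ⟩
    F * G * I' * I      ≡⟨ cong (λ z → z * I' * I) (sym (fromℕ-* (suc k) (k !))) ⟩
    fromℕ (suc k !) * I' * I  ≡⟨ cong (_* I) (fromℕ-inverse (suc k !) {{suc k ℕ.!≢0}}) ⟩
    1ℚ * I              ≡⟨ *-identityˡ I ⟩
    I                   ∎
    where
    open ≡-Reasoning
    F = fromℕ (suc k)
    G = fromℕ (k !)
    I = 1/! k
    I' = 1/! (suc k)

  expTerm-suc : ∀ k x → fromℕ (suc k) * expTerm (suc k) x ≡ x * expTerm k x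
  expTerm-suc k x = begin
    F * (x * x ^ k * I')    ≡⟨ S.solve 4 (λ F x y I → F S.:* (x S.:* y S.:* I) S.:= x S.:* (y S.:* (F S.:* I))) refl F x (x ^ k) I' ⟩
    x * (x ^ k * (F * I'))  ≡⟨ cong (λ z → x * (x ^ k * z)) (1/!-suc k) ⟩
    x * (x ^ k * 1/! k)     ∎
    where
    open ≡-Reasoning
    F = fromℕ (suc k)
    I' = 1/! (suc k)

  cancel-suc : ∀ k {p q} → fromℕ (suc k) * p ≤ fromℕ (suc k) * q → p ≤ q
  cancel-suc k = *-cancelˡ-≤-pos (fromℕ (suc k)) {{positive (0<fromℕ-suc k)}}

  -- On ∣x∣ ≤ B every partial sum is dominated by E, the one for exp B.
  module OnInterval (B : ℚ) (0≤B : 0ℚ ≤ B) where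

    e E : ℕ → ℚ
    e k = expTerm k B
    E zero    = 0ℚ
    E (suc N) = E N + e N

    F : ℕ → ℚ
    F k = fromℕ (suc k)

    0≤F : ∀ k → 0ℚ ≤ F k
    0≤F k = 0≤fromℕ (suc k)

    0≤e : ∀ k → 0ℚ ≤ e k
    0≤e zero    = nonNegative⁻¹ _
    0≤e (suc k) = cancel-suc k (subst₂ _≤_ (sym (*-zeroʳ (F k))) (sym (expTerm-suc k B))
      (0≤*0≤ 0≤B (0≤e k)))

    F-abs : ∀ k q → F k * ∣ q ∣ ≡ ∣ F k * q ∣
    F-abs k q = trans (cong (_* ∣ q ∣) (sym (0≤p⇒∣p∣≡p (0≤F k)))) (sym (∣p*q∣≡∣p∣*∣q∣ (F k) q))

    term≤ : ∀ k {x} → ∣ x ∣ ≤ B → ∣ expTerm k x ∣ ≤ e k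
    term≤ zero        x≤B = ≤-refl
    term≤ (suc k) {x} x≤B = cancel-suc k (begin
      F k * ∣ expTerm (suc k) x ∣   ≡⟨ F-abs k (expTerm (suc k) x) ⟩
      ∣ F k * expTerm (suc k) x ∣   ≡⟨ cong ∣_∣ (expTerm-suc k x) ⟩
      ∣ x * expTerm k x ∣           ≡⟨ ∣p*q∣≡∣p∣*∣q∣ x (expTerm k x) ⟩
      ∣ x ∣ * ∣ expTerm k x ∣       ≤⟨ *-mono-≤ (0≤∣p∣ (expTerm k x)) 0≤B x≤B (term≤ k x≤B) ⟩
      B * e k                       ≡⟨ sym (expTerm-suc k B) ⟩
      F k * e (suc k)               ∎)
      where open ≤-Reasoning

    term-lip : ∀ k {x y} → ∣ x ∣ ≤ B → ∣ y ∣ ≤ B →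
               ∣ expTerm (suc k) x - expTerm (suc k) y ∣ ≤ ∣ x - y ∣ * e k
    term-lip zero {x} {y} _ _ = ≤-reflexive (trans
      (cong ∣_∣ (S.solve 2 (λ x y → x S.:* S.con 1ℚ S.:* S.con 1ℚ S.:- y S.:* S.con 1ℚ S.:* S.con 1ℚ S.:= x S.:- y) refl x y))
      (sym (*-identityʳ ∣ x - y ∣)))
    term-lip (suc k) {x} {y} x≤B y≤B = cancel-suc (suc k) (begin
      F' * ∣ expTerm (suc (suc k)) x - expTerm (suc (suc k)) y ∣
        ≡⟨ F-abs (suc k) (expTerm (suc (suc k)) x - expTerm (suc (suc k)) y) ⟩
      ∣ F' * (expTerm (suc (suc k)) x - expTerm (suc (suc k)) y) ∣
        ≡⟨ cong ∣_∣ (S.solve 3 (λ f a b → f S.:* (a S.:- b) S.:= f S.:* a S.:- f S.:* b) refl F' (expTerm (suc (suc k)) x) (expTerm (suc (suc k)) y)) ⟩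
      ∣ F' * expTerm (suc (suc k)) x - F' * expTerm (suc (suc k)) y ∣
        ≡⟨ cong₂ (λ a b → ∣ a - b ∣) (expTerm-suc (suc k) x) (expTerm-suc (suc k) y) ⟩
      ∣ x * p - y * q ∣
        ≡⟨ cong ∣_∣ (S.solve 4 (λ x y p q → x S.:* p S.:- y S.:* q S.:= x S.:* (p S.:- q) S.:+ (x S.:- y) S.:* q) refl x y p q) ⟩
      ∣ x * (p - q) + (x - y) * q ∣
        ≤⟨ ∣p+q∣≤∣p∣+∣q∣ (x * (p - q)) ((x - y) * q) ⟩
      ∣ x * (p - q) ∣ + ∣ (x - y) * q ∣
        ≡⟨ cong₂ _+_ (∣p*q∣≡∣p∣*∣q∣ x (p - q)) (∣p*q∣≡∣p∣*∣q∣ (x - y) q) ⟩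
      ∣ x ∣ * ∣ p - q ∣ + d * ∣ q ∣
        ≤⟨ +-mono-≤ (*-mono-≤ (0≤∣p∣ (p - q)) 0≤B x≤B (term-lip k x≤B y≤B))
                    (*-monoˡ-≤-nonNeg d {{≥0 (0≤∣p∣ (x - y))}} (term≤ (suc k) y≤B)) ⟩
      B * (d * e k) + d * e (suc k)
        ≡⟨ S.solve 4 (λ b d u v → b S.:* (d S.:* u) S.:+ d S.:* v S.:= d S.:* (b S.:* u) S.:+ d S.:* v) refl B d (e k) (e (suc k)) ⟩
      d * (B * e k) + d * e (suc k)
        ≡⟨ cong (λ z → d * z + d * e (suc k)) (sym (expTerm-suc k B)) ⟩
      d * (F k * e (suc k)) + d * e (suc k)
        ≡⟨ S.solve 3 (λ d f v → d S.:* (f S.:* v) S.:+ d S.:* v S.:= (S.con 1ℚ S.:+ f) S.:* (d S.:* v)) refl d (F k) (e (suc k)) ⟩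
      (1ℚ + F k) * (d * e (suc k))
        ≡⟨ cong (_* (d * e (suc k))) (sym (fromℕ-suc (suc k))) ⟩
      F' * (d * e (suc k)) ∎)
      where
      open ≤-Reasoning
      F' = F (suc k)
      p = expTerm (suc k) x
      q = expTerm (suc k) y
      d = ∣ x - y ∣

    K : ℕ
    K = proj₁ (archimedes (B + B))

    halving : ∀ k → K ℕ.≤ k → e (suc k) + e (suc k) ≤ e k
    halving k K≤k = cancel-suc k (begin
      F k * (e (suc k) + e (suc k))        ≡⟨ *-distribˡ-+ (F k) (e (suc k)) (e (suc k)) ⟩
      F k * e (suc k) + F k * e (suc k)    ≡⟨ cong (λ z → z + z) (expTerm-suc k B) ⟩
      B * e k + B * e k                    ≡⟨ sym (*-distribʳ-+ (e k) B B) ⟩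
      (B + B) * e k                        ≤⟨ *-monoʳ-≤-nonNeg (e k) {{≥0 (0≤e k)}}
                                                (≤-trans (proj₂ (archimedes (B + B))) (fromℕ-mono (ℕ.m≤n⇒m≤1+n K≤k))) ⟩
      F k * e k                            ∎)
      where open ≤-Reasoning

    e-step : ∀ k → K ℕ.≤ k → e (suc k) ≤ e k
    e-step k K≤k = ≤-trans (p≤p+q (0≤e (suc k))) (halving k K≤k)

    e-mono : ∀ {m n} → K ℕ.≤ m → m ℕ.≤′ n → e n ≤ e m
    e-mono K≤m ℕ.≤′-refl       = ≤-refl
    e-mono K≤m (ℕ.≤′-step {n} r) = ≤-trans (e-step n (ℕ.≤-trans K≤m (ℕ.≤′⇒≤ r))) (e-mono K≤m r)

    E+2e : ℕ → ℚ
    E+2e n = E n + (e n + e n)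

    E+2e-mono : ∀ {m n} → K ℕ.≤ m → m ℕ.≤′ n → E+2e n ≤ E+2e m
    E+2e-mono K≤m ℕ.≤′-refl = ≤-refl
    E+2e-mono K≤m (ℕ.≤′-step {n} r) = ≤-trans
      (≤-trans (+-monoʳ-≤ (E (suc n)) (halving n (ℕ.≤-trans K≤m (ℕ.≤′⇒≤ r))))
        (≤-reflexive (+-assoc (E n) (e n) (e n))))
      (E+2e-mono K≤m r)

    E≤ : ∀ {m n} → K ℕ.≤ m → m ℕ.≤ n → E n ≤ E+2e m
    E≤ {m} {n} K≤m m≤n = ≤-trans (p≤p+q (0≤+0≤ (0≤e n) (0≤e n))) (E+2e-mono K≤m (ℕ.≤⇒≤′ m≤n))

    tail≤ : ∀ {m n} → K ℕ.≤ m → m ℕ.≤ n → E n - E m ≤ e m + e m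
    tail≤ {m} {n} K≤m m≤n = subst (E n - E m ≤_)
      (S.solve 2 (λ a b → a S.:+ b S.:- a S.:= b) refl (E m) (e m + e m))
      (+-monoˡ-≤ (- E m) (E≤ K≤m m≤n))

    e→0 : ∀ ε → 0ℚ < ε → ∃ λ N → K ℕ.≤ N × e N ≤ ε
    e→0 ε 0<ε = suc N , ℕ.m≤n⇒m≤1+n (ℕ.m≤m⊔n K L) , cancel-suc N (begin
      F N * e (suc N)            ≡⟨ expTerm-suc N B ⟩
      B * e N                    ≤⟨ *-monoˡ-≤-nonNeg B {{≥0 0≤B}} (e-mono ℕ.≤-refl (ℕ.≤⇒≤′ (ℕ.m≤m⊔n K L))) ⟩
      C                          ≡⟨ sym (trans (*-assoc C (1/ ε) ε) (trans (cong (C *_) (*-inverseˡ ε)) (*-identityʳ C))) ⟩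
      C * 1/ ε * ε               ≤⟨ *-monoʳ-≤-nonNeg ε {{≥0 (<⇒≤ 0<ε)}} (≤-trans (proj₂ (archimedes (C * 1/ ε)))
                                      (fromℕ-mono (ℕ.m≤n⇒m≤1+n (ℕ.m≤n⊔m K L)))) ⟩
      F N * ε                    ∎)
      where
      open ≤-Reasoning
      instance
        ε≢0 : NonZero ε
        ε≢0 = pos⇒nonZero ε {{positive 0<ε}}
      C = B * e K
      L = proj₁ (archimedes (C * 1/ ε))
      N = K ℕ.⊔ L

    module Sum (c : ℕ → ℚ) (c≤1 : ∀ k → ∣ c k ∣ ≤ 1ℚ) where

      s : ℕ → ℚ → ℚ
      s = partialSum c

      scaled≤ : ∀ k {p q} → ∣ p ∣ ≤ q → ∣ c k * p ∣ ≤ q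
      scaled≤ k {p} {q} p≤q = begin
        ∣ c k * p ∣       ≡⟨ ∣p*q∣≡∣p∣*∣q∣ (c k) p ⟩
        ∣ c k ∣ * ∣ p ∣   ≤⟨ *-mono-≤ (0≤∣p∣ p) 0≤1 (c≤1 k) p≤q ⟩
        1ℚ * q            ≡⟨ *-identityˡ q ⟩
        q                 ∎
        where open ≤-Reasoning

      s-tail : ∀ {m n x} → ∣ x ∣ ≤ B → m ℕ.≤′ n → ∣ s n x - s m x ∣ ≤ E n - E m
      s-tail {m} {n} {x} x≤B ℕ.≤′-refl =
        ≤-reflexive (trans (cong ∣_∣ (+-inverseʳ (s m x))) (sym (+-inverseʳ (E m))))
      s-tail {m} {_} {x} x≤B (ℕ.≤′-step {n} r) = begin
        ∣ s n x + t - s m x ∣       ≡⟨ cong ∣_∣ (S.solve 3 (λ a t b → a S.:+ t S.:- b S.:= (a S.:- b) S.:+ t) refl (s n x) t (s m x)) ⟩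
        ∣ s n x - s m x + t ∣       ≤⟨ ∣p+q∣≤∣p∣+∣q∣ (s n x - s m x) t ⟩
        ∣ s n x - s m x ∣ + ∣ t ∣   ≤⟨ +-mono-≤ (s-tail x≤B r) (scaled≤ n (term≤ n x≤B)) ⟩
        E n - E m + e n             ≡⟨ S.solve 3 (λ a b t → (a S.:- b) S.:+ t S.:= a S.:+ t S.:- b) refl (E n) (E m) (e n) ⟩
        E (suc n) - E m             ∎
        where
        open ≤-Reasoning
        t = c n * expTerm n x

      s-lip : ∀ n {x y} → ∣ x ∣ ≤ B → ∣ y ∣ ≤ B → ∣ s (suc n) x - s (suc n) y ∣ ≤ ∣ x - y ∣ * E n
      s-lip zero {x} {y} _ _ = ≤-reflexive (trans
        (cong ∣_∣ (+-inverseʳ (s 1 y))) (sym (*-zeroʳ ∣ x - y ∣)))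
      s-lip (suc n) {x} {y} x≤B y≤B = begin
        ∣ (s (suc n) x + c (suc n) * p) - (s (suc n) y + c (suc n) * q) ∣
          ≡⟨ cong ∣_∣ (S.solve 5 (λ a b c p q → (a S.:+ c S.:* p) S.:- (b S.:+ c S.:* q) S.:= (a S.:- b) S.:+ c S.:* (p S.:- q))
               refl (s (suc n) x) (s (suc n) y) (c (suc n)) p q) ⟩
        ∣ (s (suc n) x - s (suc n) y) + c (suc n) * (p - q) ∣
          ≤⟨ ∣p+q∣≤∣p∣+∣q∣ (s (suc n) x - s (suc n) y) (c (suc n) * (p - q)) ⟩
        ∣ s (suc n) x - s (suc n) y ∣ + ∣ c (suc n) * (p - q) ∣
          ≤⟨ +-mono-≤ (s-lip n x≤B y≤B) (scaled≤ (suc n) (term-lip n x≤B y≤B)) ⟩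
        ∣ x - y ∣ * E n + ∣ x - y ∣ * e n
          ≡⟨ sym (*-distribˡ-+ ∣ x - y ∣ (E n) (e n)) ⟩
        ∣ x - y ∣ * E (suc n) ∎
        where
        open ≤-Reasoning
        p = expTerm (suc n) x
        q = expTerm (suc n) y

      M : ℚ
      M = E+2e K

      0≤E : ∀ n → 0ℚ ≤ E n
      0≤E zero    = ≤-refl
      0≤E (suc n) = 0≤+0≤ (0≤E n) (0≤e n)

      0≤M : 0ℚ ≤ M
      0≤M = 0≤+0≤ (0≤E K) (0≤+0≤ (0≤e K) (0≤e K))

      E-mono : ∀ {m n} → m ℕ.≤′ n → E m ≤ E n
      E-mono ℕ.≤′-refl         = ≤-refl
      E-mono (ℕ.≤′-step {n} r) = ≤-trans (E-mono r) (p≤p+q (0≤e n))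

      E≤M : ∀ n → E n ≤ M
      E≤M n with ℕ.≤-total n K
      ... | inj₁ n≤K = ≤-trans (E-mono (ℕ.≤⇒≤′ n≤K)) (p≤p+q (0≤+0≤ (0≤e K) (0≤e K)))
      ... | inj₂ K≤n = E≤ ℕ.≤-refl K≤n

      s-lip-M : ∀ n {x y δ ε} → 0ℚ ≤ δ → M * δ ≤ ε → ∣ x ∣ ≤ B → ∣ y ∣ ≤ B →
                ∣ x - y ∣ ≤ δ → ∣ s n x - s n y ∣ ≤ ε
      s-lip-M zero    0≤δ Mδ≤ε _ _ _ = ≤-trans (0≤*0≤ 0≤M 0≤δ) Mδ≤ε
      s-lip-M (suc n) {x} {y} {δ} {ε} 0≤δ Mδ≤ε x≤B y≤B x-y≤δ = begin
        ∣ s (suc n) x - s (suc n) y ∣  ≤⟨ s-lip n x≤B y≤B ⟩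
        ∣ x - y ∣ * E n                ≤⟨ *-mono-≤ (0≤E n) 0≤δ x-y≤δ (E≤M n) ⟩
        δ * M                          ≡⟨ *-comm δ M ⟩
        M * δ                          ≤⟨ Mδ≤ε ⟩
        ε                              ∎
        where open ≤-Reasoning

      s-tail-2e : ∀ {m n x} → K ℕ.≤ m → m ℕ.≤ n → ∣ x ∣ ≤ B → ∣ s n x - s m x ∣ ≤ e m + e m
      s-tail-2e K≤m m≤n x≤B = ≤-trans (s-tail x≤B (ℕ.≤⇒≤′ m≤n)) (tail≤ K≤m m≤n)

      -- Comparison through the pivot index P.
      s-close : ∀ P {m n x y δ ε} → K ℕ.≤ P → P ℕ.≤ m → P ℕ.≤ n → e P ≤ ½ * (½ * (½ * ε)) →
                0ℚ ≤ δ → M * δ ≤ ½ * ε → ∣ x ∣ ≤ B → ∣ y ∣ ≤ B → ∣ x - y ∣ ≤ δ →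
                ∣ s m x - s n y ∣ ≤ ε
      s-close P {m} {n} {x} {y} {δ} {ε} K≤P P≤m P≤n eP≤ 0≤δ Mδ≤ x≤B y≤B x-y≤δ = begin
        ∣ s m x - s n y ∣
          ≤⟨ tri (s m x) (s P x) (s n y) ⟩
        ∣ s m x - s P x ∣ + ∣ s P x - s n y ∣
          ≤⟨ +-mono-≤ (s-tail-2e K≤P P≤m x≤B) (tri (s P x) (s P y) (s n y)) ⟩
        (e P + e P) + (∣ s P x - s P y ∣ + ∣ s P y - s n y ∣)
          ≤⟨ +-monoʳ-≤ (e P + e P) (+-mono-≤ (s-lip-M P 0≤δ Mδ≤ x≤B y≤B x-y≤δ)
               (≤-trans (≤-reflexive (∣p-q∣≡∣q-p∣ (s P y) (s n y))) (s-tail-2e K≤P P≤n y≤B))) ⟩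
        (e P + e P) + (½ * ε + (e P + e P))
          ≤⟨ +-mono-≤ 2eP≤ (+-monoʳ-≤ (½ * ε) 2eP≤) ⟩
        ½ * (½ * ε) + (½ * ε + ½ * (½ * ε))
          ≡⟨ S.solve 1 (λ ε → S.con ½ S.:* (S.con ½ S.:* ε) S.:+ (S.con ½ S.:* ε S.:+ S.con ½ S.:* (S.con ½ S.:* ε)) S.:= ε) refl ε ⟩
        ε ∎
        where
        open ≤-Reasoning
        2eP≤ : e P + e P ≤ ½ * (½ * ε)
        2eP≤ = ≤-trans (+-mono-≤ eP≤ eP≤) (≤-reflexive (½+½ (½ * (½ * ε))))

      diagonal : ∀ u → (∀ n → ∣ u n ∣ ≤ B) → IsCauchy u → IsCauchy (λ n → s n (u n))
      diagonal u u≤B u-cauchy ε 0<ε =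
        combine (e→0 (½ * (½ * (½ * ε))) (0<*0< 0<½ (0<*0< 0<½ 0<½ε))) (shrink M 0≤M (½ * ε) 0<½ε)
        where
        0<½ε : 0ℚ < ½ * ε
        0<½ε = 0<*0< 0<½ 0<ε
        combine : (∃ λ P → K ℕ.≤ P × e P ≤ ½ * (½ * (½ * ε))) → (∃ λ δ → 0ℚ < δ × M * δ ≤ ½ * ε) →
                  ∃ λ N → ∀ m n → N ℕ.≤ m → N ℕ.≤ n → ∣ s m (u m) - s n (u n) ∣ ≤ ε
        combine (P , K≤P , eP≤) (δ , 0<δ , Mδ≤) with u-cauchy δ 0<δ
        ... | Q , near = P ℕ.⊔ Q , λ m n p q →
          s-close P K≤P (ℕ.m⊔n≤o⇒m≤o P Q p) (ℕ.m⊔n≤o⇒m≤o P Q q) eP≤ (<⇒≤ 0<δ) Mδ≤ (u≤B m) (u≤B n)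
            (near m n (ℕ.m⊔n≤o⇒n≤o P Q p) (ℕ.m⊔n≤o⇒n≤o P Q q))

-- The n-th rational approximation is the n-th partial sum evaluated at the
-- n-th approximation of x; the partial sums converge uniformly on bounded sets.
powerSeries : (c : ℕ → ℚ) → (∀ k → ∣ c k ∣ ≤ 1ℚ) → ℝ → ℝ
powerSeries c c≤1 x = mkℝ (λ n → partialSum c n (seq x n))
  (let (B , 0≤B , x≤B) = bounded x
   in Series.OnInterval.Sum.diagonal B 0≤B c c≤1 (seq x) x≤B (cauchy x))

-- cosCoeff k / k! and sinCoeff k / k! are the Maclaurin coefficients of
-- cosine and sine.
cosCoeff : ℕ → ℚ
cosCoeff 0             = 1ℚ
cosCoeff 1             = 0ℚ
cosCoeff (suc (suc k)) = - cosCoeff k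

sinCoeff : ℕ → ℚ
sinCoeff 0             = 0ℚ
sinCoeff 1             = 1ℚ
sinCoeff (suc (suc k)) = - sinCoeff k

∣cosCoeff∣≤1 : ∀ k → ∣ cosCoeff k ∣ ≤ 1ℚ
∣cosCoeff∣≤1 0             = ≤-refl
∣cosCoeff∣≤1 1             = 0≤1
∣cosCoeff∣≤1 (suc (suc k)) = ≤-trans (≤-reflexive (∣-p∣≡∣p∣ (cosCoeff k))) (∣cosCoeff∣≤1 k)

∣sinCoeff∣≤1 : ∀ k → ∣ sinCoeff k ∣ ≤ 1ℚ
∣sinCoeff∣≤1 0             = 0≤1
∣sinCoeff∣≤1 1             = ≤-refl
∣sinCoeff∣≤1 (suc (suc k)) = ≤-trans (≤-reflexive (∣-p∣≡∣p∣ (sinCoeff k))) (∣sinCoeff∣≤1 k)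

cos sin : ℝ → ℝ
cos = powerSeries cosCoeff ∣cosCoeff∣≤1
sin = powerSeries sinCoeff ∣sinCoeff∣≤1

Point : Set
Point = ℝ × ℝ

infix 4 _≃ₚ_

_≃ₚ_ : Point → Point → Set
(x , y) ≃ₚ (x′ , y′) = x ≃ᵣ x′ × y ≃ᵣ y′

dist² : Point → Point → ℝ
dist² (x , y) (x′ , y′) = (x -ᵣ x′) *ᵣ (x -ᵣ x′) +ᵣ (y -ᵣ y′) *ᵣ (y -ᵣ y′)

-- circle P Q has centre P and passes through Q.
data Figure : Set where
  line circle : Point → Point → Figure

-- The equation of a line describes a line only when its two points differ,
-- which Drawn requires.
⟦_⟧ : Figure → Pred Point 0ℓ
⟦ line (p₁ , p₂) (q₁ , q₂) ⟧ (x , y) =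
  (q₁ -ᵣ p₁) *ᵣ (y -ᵣ p₂) ≃ᵣ (q₂ -ᵣ p₂) *ᵣ (x -ᵣ p₁)
⟦ circle P Q ⟧ X = dist² P X ≃ᵣ dist² P Q

module _ (S : Pred Point 0ℓ) where

  data Constructible : Pred Point 0ℓ
  data Drawn : Pred Figure 0ℓ

  data Constructible where
    -- ℝ is a setoid, so membership in S is read up to _≃ₚ_.
    given     : ∀ {P X} → P ∈ S → X ≃ₚ P → Constructible X
    -- F and G must differ as point sets: a line met with itself would
    -- make all of its points constructible.
    intersect : ∀ {F G X} → Drawn F → Drawn G → ¬ (⟦ F ⟧ ≐ ⟦ G ⟧) →
                X ∈ ⟦ F ⟧ → X ∈ ⟦ G ⟧ → Constructible X

  data Drawn where
    line   : ∀ {P Q} → Constructible P → Constructible Q → ¬ (P ≃ₚ Q) → Drawn (line P Q)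
    circle : ∀ {P Q} → Constructible P → Constructible Q → ¬ (P ≃ₚ Q) → Drawn (circle P Q)

anglePoint : ℝ → Point
anglePoint α = cos α , sin α

Sectable : (n : ℕ) → .{{_ : ℕ.NonZero n}} → ℝ → Set
Sectable n α = anglePoint (α /ᵣ n) ∈ Constructible (｛ O ｝ ∪ ｛ I ｝ ∪ ｛ anglePoint α ｝)
  where
  O I : Point
  O = fromℚ 0ℚ , fromℚ 0ℚ
  I = fromℚ 1ℚ , fromℚ 0ℚ

-- Take an angle α with e^{iα} = w = (24 + 7i)/25. If α is n-sectable, then w has
-- an n-th root in F[i] for a real field F obtained from ℚ by adjoining square
-- roots. The norm of F(s)[i] over F[i] turns an n-th root of w^(2^j) into one of
-- w^(2^(j+1)), so going down the tower ℚ(i) contains an n-th root of some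
-- w^(2^j). As w has valuation 2 at the Gaussian prime 2 + i, n divides 2^(j+1).
--
-- Equality of Cauchy reals is not decidable but ¬¬-stable, so the tower is built
-- under double negation; this suffices because being a power of 2 is decidable.

module Submission where

open import Algebra.Bundles using (CommutativeRing)
import Algebra.Properties.CommutativeSemiring.Exp as Exp
import Algebra.Solver.Ring as RingSolver
open import Algebra.Solver.Ring.AlmostCommutativeRing
  using (_-Raw-AlmostCommutative⟶_; Induced-equivalence; fromCommutativeRing)
open import Data.Integer as ℤ using (ℤ; +_; -[1+_])
import Data.Integer.Divisibility.Signed as ℤᵈ
import Data.Integer.Properties as ℤ
open import Data.Maybe using (just; nothing)
open import Data.Nat as ℕ using (ℕ; zero; suc)
import Data.Nat.Divisibility as ℕᵈ
open import Data.Nat.Induction using (<-wellFounded)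
open import Data.Nat.Primality using (Prime; prime?; euclidsLemma)
import Data.Nat.Properties as ℕ
open import Data.Nat.Solver using () renaming (module +-*-Solver to ℕ-Solver)
open import Data.Product using (∃; ∃₂; _×_; _,_; proj₁; proj₂)
open import Data.Rational using (0ℚ; 1ℚ)
open import Data.Sum using (_⊎_; inj₁; inj₂; [_,_]′)
open import Defs
open import Induction.WellFounded using (Acc; acc)
open import Level using (0ℓ)
open import Relation.Binary.Definitions using (WeaklyDecidable; tri<; tri≈; tri>)
open import Relation.Binary.PropositionalEquality as ≡ using (_≡_)
open import Relation.Nullary using (¬_; yes; no; contradiction)
open import Relation.Nullary.Decidable using (from-yes; from-no; ¬¬-excluded-middle)
open import Relation.Unary using (Pred; _∈_; _⊆_; _≐_; ｛_｝; _∪_)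

-- Gaussian numbers

-- The angle has to be supplied as an actual Cauchy real, so `α` is built as the fixed point of a
-- contraction that computes arcsin (7/25). The point (4 + 3i)/5 has valuation -1 at 2 + i, but its
-- sine 3/5 lies outside [-½ , ½], the interval on which crude tail bounds suffice and can be
-- checked by evaluation. The extra factor 2 in the valuation of (24 + 7i)/25 costs nothing when the
-- claim is about powers of 2.
--
-- Having no `n`-th root of `w` need not survive a quadratic extension, because the norm replaces
-- `w` by its square. Having none of `w^(2^j)` for all `j` at once does survive, and this is what
-- `Admissible` records. The starting points have rational coordinates, so the tower begins at ℚ.
--
-- `F[i]` is treated only as a ring of pairs over the real field `F`: conjugation in `s` acts on
-- both coordinates, and the divisions made in the tower are divisions in `F`.

IntegerHom : CommutativeRing 0ℓ 0ℓ → Set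
IntegerHom R =
  CommutativeRing.rawRing ℤ.+-*-commutativeRing -Raw-AlmostCommutative⟶ fromCommutativeRing R

-- The solver compares coefficients, and equality of reals cannot be decided; integer coefficients
-- can be compared.
module IntegerSolver (R : CommutativeRing 0ℓ 0ℓ) (ι : IntegerHom R) where

  coeff≟ : WeaklyDecidable (Induced-equivalence ι)
  coeff≟ m n with m ℤ.≟ n
  ... | yes ≡.refl = just (CommutativeRing.refl R)
  ... | no  _      = nothing

  open RingSolver (CommutativeRing.rawRing ℤ.+-*-commutativeRing) (fromCommutativeRing R) ι coeff≟ public

-- R[i], a pair (x , y) standing for x + y i.
module Gaussian (R : CommutativeRing 0ℓ 0ℓ) (ι : IntegerHom R) where

  open CommutativeRing R
  open import Algebra.Properties.Ring ring using (-0#≈0#)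
  open IntegerSolver R ι using (solve; _:+_; _:*_; _:-_; :-_; _:=_)
  module ι = _-Raw-AlmostCommutative⟶_ ι

  infix  4 _≈ᵍ_
  infixl 6 _+ᵍ_
  infixl 7 _*ᵍ_

  _≈ᵍ_ : Carrier × Carrier → Carrier × Carrier → Set
  (a , b) ≈ᵍ (c , d) = a ≈ c × b ≈ d

  _+ᵍ_ _*ᵍ_ : Carrier × Carrier → Carrier × Carrier → Carrier × Carrier
  (a , b) +ᵍ (c , d) = a + c , b + d
  (a , b) *ᵍ (c , d) = a * c - b * d , a * d + b * c

  -ᵍ_ : Carrier × Carrier → Carrier × Carrier
  -ᵍ (a , b) = - a , - b

  gaussianRing : CommutativeRing 0ℓ 0ℓ
  gaussianRing = record
    { Carrier = Carrier × Carrier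
    ; _≈_ = _≈ᵍ_
    ; _+_ = _+ᵍ_
    ; _*_ = _*ᵍ_
    ; -_  = -ᵍ_
    ; 0#  = 0# , 0#
    ; 1#  = 1# , 0#
    ; isCommutativeRing = record
      { isRing = record
        { +-isAbelianGroup = record
          { isGroup = record
            { isMonoid = record
              { isSemigroup = record
                { isMagma = record
                  { isEquivalence = record
                    { refl  = refl , refl
                    ; sym   = λ (p , q) → sym p , sym q
                    ; trans = λ (p , q) (r , s) → trans p r , trans q s
                    }
                  ; ∙-cong = λ (p , q) (r , s) → +-cong p r , +-cong q s
                  }
                ; assoc = λ (a , b) (c , d) (e , f) → +-assoc a c e , +-assoc b d f
                }
              ; identity = (λ (a , b) → +-identityˡ a , +-identityˡ b)
                         , (λ (a , b) → +-identityʳ a , +-identityʳ b)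
              }
            ; inverse = (λ (a , b) → -‿inverseˡ a , -‿inverseˡ b)
                      , (λ (a , b) → -‿inverseʳ a , -‿inverseʳ b)
            ; ⁻¹-cong = λ (p , q) → -‿cong p , -‿cong q
            }
          ; comm = λ (a , b) (c , d) → +-comm a c , +-comm b d
          }
        ; *-cong = λ (p , q) (r , s) →
              +-cong (*-cong p r) (-‿cong (*-cong q s)) , +-cong (*-cong p s) (*-cong q r)
        ; *-assoc = λ (a , b) (c , d) (e , f) →
              solve 6 (λ a b c d e f →
                (a :* c :- b :* d) :* e :- (a :* d :+ b :* c) :* f :=
                a :* (c :* e :- d :* f) :- b :* (c :* f :+ d :* e)) refl a b c d e f
            , solve 6 (λ a b c d e f →
                (a :* c :- b :* d) :* f :+ (a :* d :+ b :* c) :* e :=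
                a :* (c :* f :+ d :* e) :+ b :* (c :* e :- d :* f)) refl a b c d e f
        ; *-identity = (λ (a , b) → 1a a b , 1b a b)
                     , (λ (a , b) → trans (comm₁ a b 1# 0#) (1a a b) , trans (comm₂ a b 1# 0#) (1b a b))
        ; distrib = (λ (a , b) (c , d) (e , f) →
              solve 6 (λ a b c d e f →
                a :* (c :+ e) :- b :* (d :+ f) := (a :* c :- b :* d) :+ (a :* e :- b :* f)) refl a b c d e f
            , solve 6 (λ a b c d e f →
                a :* (d :+ f) :+ b :* (c :+ e) := (a :* d :+ b :* c) :+ (a :* f :+ b :* e)) refl a b c d e f)
          , (λ (a , b) (c , d) (e , f) →
              solve 6 (λ a b c d e f →
                (c :+ e) :* a :- (d :+ f) :* b := (c :* a :- d :* b) :+ (e :* a :- f :* b)) refl a b c d e f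
            , solve 6 (λ a b c d e f →
                (c :+ e) :* b :+ (d :+ f) :* a := (c :* b :+ d :* a) :+ (e :* b :+ f :* a)) refl a b c d e f)
        }
      ; *-comm = λ (a , b) (c , d) → comm₁ a b c d , comm₂ a b c d
      }
    }
    where
    comm₁ : ∀ a b c d → a * c - b * d ≈ c * a - d * b
    comm₁ = solve 4 (λ a b c d → a :* c :- b :* d := c :* a :- d :* b) refl
    comm₂ : ∀ a b c d → a * d + b * c ≈ c * b + d * a
    comm₂ = solve 4 (λ a b c d → a :* d :+ b :* c := c :* b :+ d :* a) refl
    1a : ∀ a b → 1# * a - 0# * b ≈ a
    1a a b = trans (+-cong (*-identityˡ a) (-‿cong (zeroˡ b))) (trans (+-congˡ -0#≈0#) (+-identityʳ a))
    1b : ∀ a b → 1# * b + 0# * a ≈ b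
    1b a b = trans (+-cong (*-identityˡ b) (zeroˡ a)) (+-identityʳ b)

  integers : IntegerHom gaussianRing
  integers = record
    { ⟦_⟧    = λ n → ι.⟦ n ⟧ , 0#
    ; +-homo = λ m n → ι.+-homo m n , sym (+-identityˡ 0#)
    ; *-homo = λ m n →
          trans (ι.*-homo m n) (sym (trans (+-congˡ (-‿cong (zeroˡ 0#))) (trans (+-congˡ -0#≈0#) (+-identityʳ _))))
        , sym (trans (+-cong (zeroʳ _) (zeroˡ _)) (+-identityˡ 0#))
    ; -‿homo = λ n → ι.-‿homo n , sym -0#≈0#
    ; 0-homo = ι.0-homo , refl
    ; 1-homo = ι.1-homo , refl
    }

ℤ-identity : IntegerHom ℤ.+-*-commutativeRing
ℤ-identity = record
  { ⟦_⟧    = λ n → n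
  ; +-homo = λ _ _ → ≡.refl
  ; *-homo = λ _ _ → ≡.refl
  ; -‿homo = λ _ → ≡.refl
  ; 0-homo = ≡.refl
  ; 1-homo = ≡.refl
  }

-- The valuation of Gaussian integers at 2 + i

module GaussianIntegers where

  open Gaussian ℤ.+-*-commutativeRing ℤ-identity public using (gaussianRing; _≈ᵍ_; _*ᵍ_)
  open CommutativeRing gaussianRing using (Carrier; 0#; 1#; setoid; commutativeSemiring;
    sym; trans; *-cong; *-congˡ; *-congʳ; *-assoc; *-identityˡ; zeroˡ; zeroʳ)
  open Exp commutativeSemiring public using (_^_; ^-homo-*; ^-congʳ)
  open import Relation.Binary.Reasoning.Setoid setoid
  open import Data.Integer.Solver using (module +-*-Solver)
  open +-*-Solver using (solve; con; _:+_; _:*_; _:-_; :-_; _:=_)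

  π : Carrier
  π = + 2 , + 1

  -- Reduction modulo π, with i ↦ -2.
  φ : Carrier → ℤ
  φ (a , b) = a ℤ.- + 2 ℤ.* b

  5-prime : Prime 5
  5-prime = from-yes (prime? 5)

  -- ℤ[i]/(π) is the field with five elements, so this is divisibility by `π`; `5∣π*` and
  -- `divideByπ` are the two directions.
  5∣ : Carrier → Set
  5∣ g = + 5 ℤᵈ.∣ φ g

  φ-cong : ∀ {g h} → g ≈ᵍ h → 5∣ g → 5∣ h
  φ-cong (≡.refl , ≡.refl) d = d

  -- Sending `i` to -2 sends `i²` to 4 instead of -1, so `φ` is multiplicative only up to the
  -- multiple of 5 written out here.
  φ-* : ∀ g h → φ (g *ᵍ h) ℤ.+ + 5 ℤ.* (proj₂ g ℤ.* proj₂ h) ≡ φ g ℤ.* φ h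
  φ-* (a , b) (c , d) = solve 4 (λ a b c d →
    (a :* c :- b :* d) :- con (+ 2) :* (a :* d :+ b :* c) :+ con (+ 5) :* (b :* d) :=
    (a :- con (+ 2) :* b) :* (c :- con (+ 2) :* d)) ≡.refl a b c d

  5∣π* : ∀ g → 5∣ (π *ᵍ g)
  5∣π* (a , b) = ℤᵈ.divides (ℤ.- b) (solve 2 (λ a b →
    (con (+ 2) :* a :- con (+ 1) :* b) :- con (+ 2) :* (con (+ 2) :* b :+ con (+ 1) :* a) :=
    (:- b) :* con (+ 5)) ≡.refl a b)

  -- `π` is prime because 5 is: Euclid's lemma is applied to the residues.
  5∣-* : ∀ g h → ¬ 5∣ g → ¬ 5∣ h → ¬ 5∣ (g *ᵍ h)
  5∣-* g h 5∤g 5∤h 5∣gh = [ (λ d → 5∤g (ℤᵈ.∣ᵤ⇒∣ d)) , (λ d → 5∤h (ℤᵈ.∣ᵤ⇒∣ d)) ]′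
    (euclidsLemma ℤ.∣ φ g ∣ ℤ.∣ φ h ∣ 5-prime
      (≡.subst (5 ℕᵈ.∣_) (ℤ.abs-* (φ g) (φ h)) (ℤᵈ.∣⇒∣ᵤ {+ 5} {φ g ℤ.* φ h}
        (≡.subst (+ 5 ℤᵈ.∣_) (φ-* g h)
          (ℤᵈ.∣m∣n⇒∣m+n 5∣gh (ℤᵈ.divides bd (ℤ.*-comm (+ 5) bd)))))))
    where bd = proj₂ g ℤ.* proj₂ h

  divideByπ : ∀ g → 5∣ g → ∃ λ h → g ≈ᵍ π *ᵍ h
  -- The witness is `g (2 - i) / 5` after substituting `a = 2 b + 5 k`.
  divideByπ (a , b) (ℤᵈ.divides k eq) = (b ℤ.+ + 2 ℤ.* k , ℤ.- k)
    , ≡.trans (≡.trans (solve 2 (λ a b → a := (a :- con (+ 2) :* b) :+ con (+ 2) :* b) ≡.refl a b)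
        (≡.cong (ℤ._+ + 2 ℤ.* b) eq))
      (solve 2 (λ b k → k :* con (+ 5) :+ con (+ 2) :* b :=
        con (+ 2) :* (b :+ con (+ 2) :* k) :- con (+ 1) :* (:- k)) ≡.refl b k)
    , solve 2 (λ b k → b := con (+ 2) :* (:- k) :+ con (+ 1) :* (b :+ con (+ 2) :* k)) ≡.refl b k

  norm : Carrier → ℕ
  norm (a , b) = ℤ.∣ a ∣ ℕ.* ℤ.∣ a ∣ ℕ.+ ℤ.∣ b ∣ ℕ.* ℤ.∣ b ∣

  +norm : ∀ g → + norm g ≡ proj₁ g ℤ.* proj₁ g ℤ.+ proj₂ g ℤ.* proj₂ g
  +norm (a , b) = ≡.cong₂ ℤ._+_ (sq a) (sq b)
    where
    sq : ∀ a → + (ℤ.∣ a ∣ ℕ.* ℤ.∣ a ∣) ≡ a ℤ.* a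
    sq (+ n)    = ℤ.pos-* n n
    sq -[1+ n ] = ≡.refl

  norm-π* : ∀ g → norm (π *ᵍ g) ≡ 5 ℕ.* norm g
  norm-π* g@(a , b) = ℤ.+-injective (≡.trans (+norm (π *ᵍ g)) (≡.trans
    (solve 2 (λ a b → let x = con (+ 2) :* a :- con (+ 1) :* b ; y = con (+ 2) :* b :+ con (+ 1) :* a in
      x :* x :+ y :* y := con (+ 5) :* (a :* a :+ b :* b)) ≡.refl a b)
    (≡.trans (≡.cong (+ 5 ℤ.*_) (≡.sym (+norm g))) (≡.sym (ℤ.pos-* 5 (norm g))))))

  norm≡0 : ∀ g → norm g ≡ 0 → g ≈ᵍ 0#
  norm≡0 (a , b) eq = zero-square a (ℕ.m+n≡0⇒m≡0 _ eq)
                    , zero-square b (ℕ.m+n≡0⇒n≡0 (ℤ.∣ a ∣ ℕ.* ℤ.∣ a ∣) eq)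
    where
    zero-square : ∀ a → ℤ.∣ a ∣ ℕ.* ℤ.∣ a ∣ ≡ 0 → a ≡ + 0
    zero-square a eq = [ ℤ.∣i∣≡0⇒i≡0 , ℤ.∣i∣≡0⇒i≡0 ]′ (ℕ.m*n≡0⇒m≡0∨n≡0 ℤ.∣ a ∣ eq)

  norm-cong : ∀ {g h} → g ≈ᵍ h → norm g ≡ norm h
  norm-cong (≡.refl , ≡.refl) = ≡.refl

  -- Multiplying by the conjugate 2 - i turns `π` into 5, which cancels in each coordinate.
  π-cancel : ∀ g h → π *ᵍ g ≈ᵍ π *ᵍ h → g ≈ᵍ h
  π-cancel (a , b) (c , d) (p , q) =
      ℤ.*-cancelˡ-≡ (+ 5) a c (≡.trans (re a b) (≡.trans (≡.cong₂ (λ u v → + 2 ℤ.* u ℤ.+ v) p q) (≡.sym (re c d))))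
    , ℤ.*-cancelˡ-≡ (+ 5) b d (≡.trans (im a b) (≡.trans (≡.cong₂ (λ u v → + 2 ℤ.* v ℤ.- u) p q) (≡.sym (im c d))))
    where
    re : ∀ a b → + 5 ℤ.* a ≡ + 2 ℤ.* proj₁ (π *ᵍ (a , b)) ℤ.+ proj₂ (π *ᵍ (a , b))
    re = solve 2 (λ a b → con (+ 5) :* a :=
      con (+ 2) :* (con (+ 2) :* a :- con (+ 1) :* b) :+ (con (+ 2) :* b :+ con (+ 1) :* a)) ≡.refl
    im : ∀ a b → + 5 ℤ.* b ≡ + 2 ℤ.* proj₂ (π *ᵍ (a , b)) ℤ.- proj₁ (π *ᵍ (a , b))
    im = solve 2 (λ a b → con (+ 5) :* b :=
      con (+ 2) :* (con (+ 2) :* b :+ con (+ 1) :* a) :- (con (+ 2) :* a :- con (+ 1) :* b)) ≡.refl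

  π^-cancel : ∀ k g h → π ^ k *ᵍ g ≈ᵍ π ^ k *ᵍ h → g ≈ᵍ h
  π^-cancel zero    g h eq = trans (sym (*-identityˡ g)) (trans eq (*-identityˡ h))
  π^-cancel (suc k) g h eq = π^-cancel k g h (π-cancel (π ^ k *ᵍ g) (π ^ k *ᵍ h)
    (trans (sym (*-assoc π (π ^ k) g)) (trans eq (*-assoc π (π ^ k) h))))

  record Valuation (g : Carrier) (a : ℕ) : Set where
    constructor valued
    field
      cofactor   : Carrier
      factorises : g ≈ᵍ π ^ a *ᵍ cofactor
      coprime    : ¬ 5∣ cofactor

  -- Each factor `π` split off divides the norm by 5, so the descent stops.
  valuation : ∀ g → ¬ g ≈ᵍ 0# → ∃ (Valuation g)
  valuation g = go g (<-wellFounded (norm g))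
    where
    go : ∀ g → Acc ℕ._<_ (norm g) → ¬ g ≈ᵍ 0# → ∃ (Valuation g)
    go g (acc rec) g≉0 with + 5 ℤᵈ.∣? φ g
    ... | no  5∤g = 0 , valued g (sym (*-identityˡ g)) 5∤g
    ... | yes 5∣g with divideByπ g 5∣g
    ...   | h , g≈πh with go h (rec smaller) h≉0
      where
      h≉0 : ¬ h ≈ᵍ 0#
      h≉0 h≈0 = g≉0 (trans g≈πh (trans (*-congˡ {π} h≈0) (zeroʳ π)))
      smaller : norm h ℕ.< norm g
      smaller with norm h in eq
      ... | zero  = contradiction (norm≡0 h eq) h≉0
      ... | suc n = ≡.subst (suc n ℕ.<_) (≡.sym (≡.trans (norm-cong g≈πh) (≡.trans (norm-π* h) (≡.cong (5 ℕ.*_) eq))))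
                      (ℕ.m<m+n (suc n) (ℕ.s≤s ℕ.z≤n))
    ...     | a , valued k h≈ 5∤k = suc a ,
      valued k (trans g≈πh (trans (*-congˡ {π} h≈) (sym (*-assoc π (π ^ a) k)))) 5∤k

  valuation-* : ∀ {g h a b} → Valuation g a → Valuation h b → Valuation (g *ᵍ h) (a ℕ.+ b)
  valuation-* {g} {h} {a} {b} (valued k g≈ 5∤k) (valued l h≈ 5∤l) = valued (k *ᵍ l) eq (5∣-* k l 5∤k 5∤l)
    where
    open import Algebra.Properties.CommutativeSemigroup
      (CommutativeRing.*-commutativeSemigroup gaussianRing) using (interchange)
    eq : g *ᵍ h ≈ᵍ π ^ (a ℕ.+ b) *ᵍ (k *ᵍ l)
    eq = begin
      g *ᵍ h                              ≈⟨ *-cong {g} {π ^ a *ᵍ k} {h} {π ^ b *ᵍ l} g≈ h≈ ⟩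
      (π ^ a *ᵍ k) *ᵍ (π ^ b *ᵍ l)        ≈⟨ interchange (π ^ a) k (π ^ b) l ⟩
      (π ^ a *ᵍ π ^ b) *ᵍ (k *ᵍ l)        ≈⟨ *-congʳ {k *ᵍ l} (sym (^-homo-* π a b)) ⟩
      π ^ (a ℕ.+ b) *ᵍ (k *ᵍ l)           ∎

  valuation-^ : ∀ {g a} → Valuation g a → ∀ n → Valuation (g ^ n) (n ℕ.* a)
  valuation-^ v zero        = valued 1# (≡.refl , ≡.refl) λ d → from-no (5 ℕᵈ.∣? 1) (ℤᵈ.∣⇒∣ᵤ d)
  valuation-^ v (suc n) = valuation-* v (valuation-^ v n)

  -- Once `π ^ a` is cancelled, at least one factor `π` is left on the right.
  π-divides : ∀ a b k l → π ^ a *ᵍ k ≈ᵍ π ^ b *ᵍ l → a ℕ.< b → 5∣ k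
  π-divides a b k l eq a<b with ℕ.m≤n⇒∃[o]m+o≡n a<b
  ... | d , ≡.refl = φ-cong {π *ᵍ (π ^ d *ᵍ l)} {k} (sym k≈) (5∣π* (π ^ d *ᵍ l))
    where
    k≈ : k ≈ᵍ π *ᵍ (π ^ d *ᵍ l)
    k≈ = π^-cancel a k (π *ᵍ (π ^ d *ᵍ l)) (begin
      π ^ a *ᵍ k                        ≈⟨ eq ⟩
      π ^ (suc (a ℕ.+ d)) *ᵍ l          ≈⟨ *-congʳ {l} (^-congʳ π (≡.sym (ℕ.+-suc a d))) ⟩
      π ^ (a ℕ.+ suc d) *ᵍ l            ≈⟨ *-congʳ {l} (^-homo-* π a (suc d)) ⟩
      (π ^ a *ᵍ π ^ suc d) *ᵍ l         ≈⟨ *-assoc (π ^ a) (π ^ suc d) l ⟩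
      π ^ a *ᵍ ((π *ᵍ π ^ d) *ᵍ l)      ≈⟨ *-congˡ {π ^ a} (*-assoc π (π ^ d) l) ⟩
      π ^ a *ᵍ (π *ᵍ (π ^ d *ᵍ l))      ∎)

  valuation-unique : ∀ {g h a b} → g ≈ᵍ h → Valuation g a → Valuation h b → a ≡ b
  valuation-unique {g} {h} {a} {b} g≈h (valued k g≈ 5∤k) (valued l h≈ 5∤l) with ℕ.<-cmp a b
  ... | tri< a<b _ _ = contradiction (π-divides a b k l (trans (sym g≈) (trans g≈h h≈)) a<b) 5∤k
  ... | tri≈ _ a≡b _ = a≡b
  ... | tri> _ _ b<a = contradiction (π-divides b a l k (trans (sym h≈) (trans (sym g≈h) g≈)) b<a) 5∤l

  valuation-nonzero : ∀ {g a} → Valuation g a → ¬ g ≈ᵍ 0#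
  valuation-nonzero {g} {a} (valued h g≈ 5∤h) g≈0 = 5∤h (φ-cong {0#} {h} (sym h≈0) (ℤᵈ.divides (+ 0) ≡.refl))
    where
    h≈0 : h ≈ᵍ 0#
    h≈0 = π^-cancel a h 0# (trans (sym g≈) (trans g≈0 (sym (zeroʳ (π ^ a)))))

  -- 25 = (2 + i)² (2 - i)², and (2 - i)² = 3 - 4i has residue 11.
  valuation-25 : Valuation (+ 25 , + 0) 2
  valuation-25 = valued (+ 3 , ℤ.- + 4) (≡.refl , ≡.refl) λ d → from-no (5 ℕᵈ.∣? 11) (ℤᵈ.∣⇒∣ᵤ d)

  -- 24 + 7i = -i (2 + i)⁴. The numerator of `w` consists of `π` alone up to a unit, the denominator
  -- only half so; this leaves 4 - 2 = 2 for `w`.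
  valuation-24+7i : Valuation (+ 24 , + 7) 4
  valuation-24+7i = valued (+ 0 , ℤ.- + 1) (≡.refl , ≡.refl) λ d → from-no (5 ℕᵈ.∣? 2) (ℤᵈ.∣⇒∣ᵤ d)

  -- The hypothesis is `(g / c) ^ suc n = w ^ J` with denominators cleared. With `a` and `b` the
  -- valuations of `g` and `c`, it gives `J * 2 + suc n * a = suc n * b + J * 4`.
  root-exponent : ∀ n J g c → ¬ c ≈ᵍ 0# →
    (+ 25 , + 0) ^ J *ᵍ g ^ suc n ≈ᵍ c ^ suc n *ᵍ (+ 24 , + 7) ^ J → suc n ℕᵈ.∣ J ℕ.* 2
  root-exponent n J g c c≉0 eq = compare (valuation c c≉0)
    where
    compare : ∃ (Valuation c) → suc n ℕᵈ.∣ J ℕ.* 2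
    compare (b , vc) = cancel (valuation g g≉0)
      where
      right : Valuation (c ^ suc n *ᵍ (+ 24 , + 7) ^ J) (suc n ℕ.* b ℕ.+ J ℕ.* 4)
      right = valuation-* (valuation-^ vc (suc n)) (valuation-^ valuation-24+7i J)
      g≉0 : ¬ g ≈ᵍ 0#
      g≉0 g≈0 = valuation-nonzero right (trans (sym eq) (trans
        (*-congˡ {(+ 25 , + 0) ^ J} (trans (*-congʳ {g ^ n} {g} {0#} g≈0) (zeroˡ (g ^ n))))
        (zeroʳ ((+ 25 , + 0) ^ J))))
      cancel : ∃ (Valuation g) → suc n ℕᵈ.∣ J ℕ.* 2
      cancel (a , vg) = ℕᵈ.∣m+n∣m⇒∣n (≡.subst (suc n ℕᵈ.∣_) exponents (ℕᵈ.m∣m*n a)) (ℕᵈ.m∣m*n b)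
        where
        left : Valuation ((+ 25 , + 0) ^ J *ᵍ g ^ suc n) (J ℕ.* 2 ℕ.+ suc n ℕ.* a)
        left = valuation-* (valuation-^ valuation-25 J) (valuation-^ vg (suc n))
        exponents : suc n ℕ.* a ≡ suc n ℕ.* b ℕ.+ J ℕ.* 2
        exponents = ℕ.+-cancelˡ-≡ (J ℕ.* 2) (suc n ℕ.* a) (suc n ℕ.* b ℕ.+ J ℕ.* 2)
          (≡.trans (valuation-unique eq left right) (ℕ-Solver.solve 2 (λ x j →
            x ℕ-Solver.:+ j ℕ-Solver.:* ℕ-Solver.con 4 ℕ-Solver.:=
            j ℕ-Solver.:* ℕ-Solver.con 2 ℕ-Solver.:+ (x ℕ-Solver.:+ j ℕ-Solver.:* ℕ-Solver.con 2)) ≡.refl (suc n ℕ.* b) J))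

-- The prime 2 divides the quotient or `n`; halving whichever it divides lowers the exponent.
divisor-of-2^ : ∀ k {n} → n ℕᵈ.∣ 2 ℕ.^ k → ∃ λ i → n ≡ 2 ℕ.^ i
divisor-of-2^ zero        n∣1 = 0 , ℕᵈ.∣1⇒≡1 n∣1
divisor-of-2^ (suc k) {n} (ℕᵈ.divides q eq) =
  [ even-quotient , even ]′ (euclidsLemma q n 2-prime (ℕᵈ.divides (2 ℕ.^ k) (≡.trans (≡.sym eq) (ℕ.*-comm 2 (2 ℕ.^ k)))))
  where
  2-prime : Prime 2
  2-prime = from-yes (prime? 2)
  even-quotient : 2 ℕᵈ.∣ q → ∃ λ i → n ≡ 2 ℕ.^ i
  even-quotient (ℕᵈ.divides r ≡.refl) = divisor-of-2^ k (ℕᵈ.divides r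
    (ℕ.*-cancelˡ-≡ _ _ 2 (≡.trans eq (≡.trans (≡.cong (ℕ._* n) (ℕ.*-comm r 2)) (ℕ.*-assoc 2 r n)))))
  even : 2 ℕᵈ.∣ n → ∃ λ i → n ≡ 2 ℕ.^ i
  even (ℕᵈ.divides m ≡.refl) with divisor-of-2^ k (ℕᵈ.divides q
    (ℕ.*-cancelˡ-≡ (2 ℕ.^ k) (q ℕ.* m) 2 (≡.trans eq (≡.trans (≡.sym (ℕ.*-assoc q m 2)) (ℕ.*-comm (q ℕ.* m) 2)))))
  ... | i , m≡ = suc i , ≡.trans (ℕ.*-comm m 2) (≡.cong (2 ℕ.*_) m≡)

-- Fields without n-th roots of w^(2^j)

-- The field axioms that Cauchy reals satisfy without deciding equality: a nonzero element has an
-- inverse only under double negation, and `stable` makes such inverses usable in proofs of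
-- equations. `formally-real` serves to show that distinct points have nonzero squared distance.
record StableField : Set₁ where
  field
    commutativeRing : CommutativeRing 0ℓ 0ℓ
    integers        : IntegerHom commutativeRing
  open CommutativeRing commutativeRing public
  open _-Raw-AlmostCommutative⟶_ integers public renaming (⟦_⟧ to ι)
  field
    stable           : ∀ {x y} → ¬ ¬ (x ≈ y) → x ≈ y
    invertible       : ∀ {x} → ¬ (x ≈ 0#) → ¬ ¬ ∃ λ y → x * y ≈ 1#
    characteristic-0 : ∀ {n} → ι n ≈ 0# → n ≡ + 0
    formally-real    : ∀ {x y} → x * x + y * y ≈ 0# → x ≈ 0#

module QuadraticPowers (L : CommutativeRing 0ℓ 0ℓ) (ι : IntegerHom L)
                       (A B D : CommutativeRing.Carrier L) where

  open CommutativeRing L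
  open Exp commutativeSemiring using (_^_)
  open IntegerSolver L ι using (solve; _:+_; _:*_; _:=_)

  -- The recursion involves `D` but no square root of it, so the same coefficients serve for `S` and
  -- `- S`. This is what makes conjugation available.
  rational irrational : ℕ → Carrier
  rational   zero    = 1#
  rational   (suc n) = A * rational n + D * (B * irrational n)
  irrational zero    = 0#
  irrational (suc n) = A * irrational n + B * rational n

  power : ∀ S → S * S ≈ D → ∀ n → (A + B * S) ^ n ≈ rational n + irrational n * S
  power S S²≈D zero    = sym (trans (+-congˡ (zeroˡ S)) (+-identityʳ 1#))
  power S S²≈D (suc n) = trans (*-congˡ (power S S²≈D n)) (trans
    (solve 5 (λ A B S P Q →
      (A :+ B :* S) :* (P :+ Q :* S) := (A :* P :+ (S :* S) :* (B :* Q)) :+ (A :* Q :+ B :* P) :* S)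
      refl A B S (rational n) (irrational n))
    (+-congʳ (+-congˡ (*-congʳ S²≈D))))

-- Subfields and quadratic extensions

module Subfields (K : StableField) where

  open StableField K
  open import Algebra.Properties.Ring ring using (-0#≈0#; -‿distribʳ-*; -‿involutive)
  open import Algebra.Properties.Group +-group using (x∙y⁻¹≈ε⇒x≈y)
  open import Relation.Binary.Reasoning.Setoid setoid
  open IntegerSolver commutativeRing integers public using (solve; con; _:+_; _:*_; _:-_; :-_; _:=_)

  1≉0 : ¬ (1# ≈ 0#)
  1≉0 1≈0 with characteristic-0 {+ 1} (trans 1-homo 1≈0)
  ... | ()

  -- The goal is an equation and therefore stable, so an inverse known only under double negation
  -- may be used.
  cancel : ∀ {x y z} → ¬ (x ≈ 0#) → x * y ≈ x * z → y ≈ z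
  cancel {x} {y} {z} x≉0 xy≈xz = stable λ y≉z → invertible x≉0 λ (x⁻¹ , xx⁻¹≈1) → y≉z (begin
    y               ≈⟨ unit y x⁻¹ xx⁻¹≈1 ⟩
    x⁻¹ * (x * y)   ≈⟨ *-congˡ xy≈xz ⟩
    x⁻¹ * (x * z)   ≈⟨ sym (unit z x⁻¹ xx⁻¹≈1) ⟩
    z               ∎)
    where
    unit : ∀ y x⁻¹ → x * x⁻¹ ≈ 1# → y ≈ x⁻¹ * (x * y)
    unit y x⁻¹ eq = begin
      y               ≈⟨ sym (*-identityˡ y) ⟩
      1# * y          ≈⟨ *-congʳ (sym eq) ⟩
      x * x⁻¹ * y     ≈⟨ solve 3 (λ x i y → x :* i :* y := i :* (x :* y)) refl x x⁻¹ y ⟩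
      x⁻¹ * (x * y)   ∎

  zero-product : ∀ {x y} → ¬ (x ≈ 0#) → x * y ≈ 0# → y ≈ 0#
  zero-product {x} x≉0 xy≈0 = cancel x≉0 (trans xy≈0 (sym (zeroʳ x)))

  -- `¬¬-closed` plays for membership the part that `stable` plays for equations: `divide` relies on
  -- it. Inverses are described by `x * y ≈ 1#` because there is no inverse operation.
  record IsSubfield (F : Pred Carrier 0ℓ) : Set where
    field
      resp        : ∀ {x y} → x ≈ y → F x → F y
      ¬¬-closed   : ∀ {x} → ¬ ¬ F x → F x
      ι-closed    : ∀ n → F (ι n)
      +-closed    : ∀ {x y} → F x → F y → F (x + y)
      *-closed    : ∀ {x y} → F x → F y → F (x * y)
      -‿closed    : ∀ {x} → F x → F (- x)
      ⁻¹-closed   : ∀ {x y} → x * y ≈ 1# → F x → F y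

    0-closed : F 0#
    0-closed = resp 0-homo (ι-closed (+ 0))

    1-closed : F 1#
    1-closed = resp 1-homo (ι-closed (+ 1))

    -ᶜ-closed : ∀ {x y} → F x → F y → F (x - y)
    -ᶜ-closed Fx Fy = +-closed Fx (-‿closed Fy)

    divide : ∀ {x y} → ¬ (x ≈ 0#) → F x → F (x * y) → F y
    divide {x} {y} x≉0 Fx Fxy = ¬¬-closed λ ¬Fy → invertible x≉0 λ (x⁻¹ , xx⁻¹≈1) →
      ¬Fy (resp (trans (solve 3 (λ x i y → i :* (x :* y) := (x :* i) :* y) refl x x⁻¹ y)
                       (trans (*-congʳ xx⁻¹≈1) (*-identityˡ y)))
                (*-closed (⁻¹-closed xx⁻¹≈1 Fx) Fxy))

  -- The double negation makes the extension `¬¬-closed` by construction.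
  Adjoin : Pred Carrier 0ℓ → Carrier → Pred Carrier 0ℓ
  Adjoin F s x = ¬ ¬ ∃₂ λ a b → F a × F b × x ≈ a + b * s

  module Extension {F : Pred Carrier 0ℓ} (F-isSubfield : IsSubfield F)
                   {s : Carrier} (Fs² : F (s * s)) (¬Fs : ¬ F s) where

    open IsSubfield F-isSubfield

    -- If `b` were nonzero, `s = (c - a) / b` would lie in `F`.
    independent : ∀ {a b c} → F a → F b → F c → a + b * s ≈ c → b ≈ 0#
    independent {a} {b} {c} Fa Fb Fc eq = stable λ b≉0 → ¬Fs (divide b≉0 Fb (resp bs≈ (-ᶜ-closed Fc Fa)))
      where
      bs≈ : c - a ≈ b * s
      bs≈ = trans (+-congʳ (sym eq)) (solve 3 (λ a b s → (a :+ b :* s) :- a := b :* s) refl a b s)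

    inclusion : F ⊆ Adjoin F s
    inclusion {x} Fx ¬∃ = ¬∃ (x , 0# , Fx , 0-closed , sym (trans (+-congˡ (zeroˡ s)) (+-identityʳ x)))

    generator : Adjoin F s s
    generator ¬∃ = ¬∃ (0# , 1# , 0-closed , 1-closed , sym (trans (+-identityˡ (1# * s)) (*-identityˡ s)))

    -- If the norm vanished, its factor `a - b s` would; `independent` then gives `b ≈ 0#`, and
    -- `a ≈ 0#` follows.
    norm≉0 : ∀ {a b} → F a → F b → ¬ (a + b * s ≈ 0#) → ¬ (a * a - s * s * (b * b) ≈ 0#)
    norm≉0 {a} {b} Fa Fb a+bs≉0 n≈0 = a+bs≉0 (begin
      a + b * s       ≈⟨ +-cong (cong-a b≈0) (*-congʳ b≈0) ⟩
      0# + 0# * s     ≈⟨ trans (+-identityˡ _) (zeroˡ s) ⟩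
      0#              ∎)
      where
      a-bs≈0 : a + (- b) * s ≈ 0#
      a-bs≈0 = zero-product a+bs≉0 (trans
        (solve 3 (λ a b s → (a :+ b :* s) :* (a :+ (:- b) :* s) := a :* a :- s :* s :* (b :* b)) refl a b s) n≈0)
      b≈0 : b ≈ 0#
      b≈0 = trans (sym (-‿involutive b)) (trans (-‿cong (independent Fa (-‿closed Fb) 0-closed a-bs≈0)) -0#≈0#)
      cong-a : b ≈ 0# → a ≈ 0#
      cong-a b≈0 = begin
        a                         ≈⟨ solve 3 (λ a b s → a := (a :+ (:- b) :* s) :+ b :* s) refl a b s ⟩
        (a + (- b) * s) + b * s   ≈⟨ +-cong a-bs≈0 (trans (*-congʳ b≈0) (zeroˡ s)) ⟩
        0# + 0#                   ≈⟨ +-identityˡ 0# ⟩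
        0#                        ∎

    isSubfield : IsSubfield (Adjoin F s)
    isSubfield = record
      { resp = λ x≈y ¬¬x ¬y → ¬¬x λ (a , b , Fa , Fb , eq) → ¬y (a , b , Fa , Fb , trans (sym x≈y) eq)
      ; ¬¬-closed = λ ¬¬x ¬∃ → ¬¬x λ x → x ¬∃
      ; ι-closed = λ n → inclusion (ι-closed n)
      ; +-closed = λ ¬¬x ¬¬y ¬∃ → ¬¬x λ (a , b , Fa , Fb , x≈) → ¬¬y λ (c , d , Fc , Fd , y≈) →
          ¬∃ (a + c , b + d , +-closed Fa Fc , +-closed Fb Fd , trans (+-cong x≈ y≈)
            (solve 5 (λ a b c d s → (a :+ b :* s) :+ (c :+ d :* s) := (a :+ c) :+ (b :+ d) :* s) refl a b c d s))
      ; *-closed = λ ¬¬x ¬¬y ¬∃ → ¬¬x λ (a , b , Fa , Fb , x≈) → ¬¬y λ (c , d , Fc , Fd , y≈) →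
          ¬∃ ( a * c + b * d * (s * s) , a * d + b * c
             , +-closed (*-closed Fa Fc) (*-closed (*-closed Fb Fd) Fs²)
             , +-closed (*-closed Fa Fd) (*-closed Fb Fc)
             , trans (*-cong x≈ y≈) (solve 5 (λ a b c d s → (a :+ b :* s) :* (c :+ d :* s) :=
                 (a :* c :+ b :* d :* (s :* s)) :+ (a :* d :+ b :* c) :* s) refl a b c d s))
      ; -‿closed = λ ¬¬x ¬∃ → ¬¬x λ (a , b , Fa , Fb , x≈) →
          ¬∃ (- a , - b , -‿closed Fa , -‿closed Fb , trans (-‿cong x≈)
            (solve 3 (λ a b s → :- (a :+ b :* s) := (:- a) :+ (:- b) :* s) refl a b s))
      ; ⁻¹-closed = inverse
      }
      where
      -- `y` is the conjugate `a - b s` times the inverse `m` of the norm.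
      inverse : ∀ {x y} → x * y ≈ 1# → Adjoin F s x → Adjoin F s y
      inverse {x} {y} xy≈1 ¬¬x ¬∃ = ¬¬x λ (a , b , Fa , Fb , x≈) → conjugate a b Fa Fb x≈
        where
        conjugate : ∀ a b → F a → F b → x ≈ a + b * s → _
        conjugate a b Fa Fb x≈ = invertible (norm≉0 Fa Fb a+bs≉0) λ (m , nm≈1) →
          let Fm = ⁻¹-closed nm≈1 (-ᶜ-closed (*-closed Fa Fa) (*-closed Fs² (*-closed Fb Fb)))
          in ¬∃ (a * m , (- b) * m , *-closed Fa Fm , *-closed (-‿closed Fb) Fm , (begin
            y                                              ≈⟨ sym (*-identityʳ y) ⟩
            y * 1#                                         ≈⟨ *-congˡ (sym nm≈1) ⟩
            y * ((a * a - s * s * (b * b)) * m)            ≈⟨ solve 5 (λ a b s m y →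
              y :* ((a :* a :- s :* s :* (b :* b)) :* m) :=
              ((a :+ b :* s) :* y) :* (a :* m :+ (:- b) :* m :* s)) refl a b s m y ⟩
            ((a + b * s) * y) * (a * m + (- b) * m * s)    ≈⟨ *-congʳ (trans (*-congʳ (sym x≈)) xy≈1) ⟩
            1# * (a * m + (- b) * m * s)                   ≈⟨ *-identityˡ _ ⟩
            a * m + (- b) * m * s                          ∎))
          where
          a+bs≉0 : ¬ (a + b * s ≈ 0#)
          a+bs≉0 eq = 1≉0 (trans (sym xy≈1) (trans (*-congʳ (trans x≈ eq)) (zeroˡ y)))

  open Gaussian commutativeRing integers public
    using (_≈ᵍ_; _*ᵍ_; _+ᵍ_; -ᵍ_) renaming (gaussianRing to K[i]; integers to integers[i])
  private module K[i] = CommutativeRing K[i]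
  open Exp K[i].commutativeSemiring public using (_^_; ^-congˡ; ^-distrib-*; ^-homo-*)

  -- Meant for the cosine and sine of `x` and of `-x`, where `c * c′ - s * s′` is the cosine of 0.
  sum-of-squares≈1 : ∀ {c s c′ s′} → c′ ≈ c → s′ ≈ - s → c * c′ - s * s′ ≈ 1# → c * c + s * s ≈ 1#
  sum-of-squares≈1 {c} {s} {c′} {s′} c′≈c s′≈-s eq = begin
    c * c + s * s        ≈⟨ solve 2 (λ c s → c :* c :+ s :* s := c :* c :- s :* (:- s)) refl c s ⟩
    c * c - s * (- s)    ≈⟨ +-cong (*-congˡ (sym c′≈c)) (-‿cong (*-congˡ (sym s′≈-s))) ⟩
    c * c′ - s * s′      ≈⟨ eq ⟩
    1#                   ∎

  -- `(c + p) * (c - p)` is a difference of two quantities equal to 1. This determines a cosine from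
  -- its sine once the opposite sign is excluded.
  leg-unique : ∀ {c s p q} → c * c + s * s ≈ 1# → s ≈ q → p * p + q * q ≈ 1# → ¬ (c + p ≈ 0#) → c ≈ p
  leg-unique {c} {s} {p} {q} c²+s²≈1 s≈q p²+q²≈1 c+p≉0 = x∙y⁻¹≈ε⇒x≈y c p (zero-product c+p≉0 (begin
    (c + p) * (c - p)                        ≈⟨ solve 3 (λ c p q → (c :+ p) :* (c :- p) :=
      (c :* c :+ q :* q) :- (p :* p :+ q :* q)) refl c p q ⟩
    (c * c + q * q) - (p * p + q * q)        ≈⟨ +-congʳ (+-congˡ (*-cong (sym s≈q) (sym s≈q))) ⟩
    (c * c + s * s) - (p * p + q * q)        ≈⟨ +-cong c²+s²≈1 (-‿cong p²+q²≈1) ⟩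
    1# - 1#                                  ≈⟨ -‿inverseʳ 1# ⟩
    0#                                       ∎))

  powers : ∀ (z : Carrier × Carrier) (p : ℕ → Carrier × Carrier) →
    p 0 ≈ᵍ K[i].1# → (∀ k → p (suc k) ≈ᵍ z *ᵍ p k) → ∀ k → z ^ k ≈ᵍ p k
  powers z p p₀ step zero    = K[i].sym p₀
  powers z p p₀ step (suc k) = K[i].trans (K[i].*-congˡ {z} (powers z p p₀ step k)) (K[i].sym (step k))

  -- Membership in F[i].
  infix 4 _∈²_
  _∈²_ : Carrier × Carrier → Pred Carrier 0ℓ → Set
  (x , y) ∈² F = F x × F y

  module _ {F : Pred Carrier 0ℓ} (F-isSubfield : IsSubfield F) where

    open IsSubfield F-isSubfield

    +ᵍ-closed : ∀ {z w} → z ∈² F → w ∈² F → z +ᵍ w ∈² F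
    +ᵍ-closed (Fa , Fb) (Fc , Fd) = +-closed Fa Fc , +-closed Fb Fd

    *ᵍ-closed : ∀ {z w} → z ∈² F → w ∈² F → z *ᵍ w ∈² F
    *ᵍ-closed (Fa , Fb) (Fc , Fd) =
        -ᶜ-closed (*-closed Fa Fc) (*-closed Fb Fd)
      , +-closed (*-closed Fa Fd) (*-closed Fb Fc)

    -ᵍ-closed : ∀ {z} → z ∈² F → -ᵍ z ∈² F
    -ᵍ-closed (Fa , Fb) = -‿closed Fa , -‿closed Fb

    ^-closed : ∀ {z} → z ∈² F → ∀ n → z ^ n ∈² F
    ^-closed Fz zero    = 1-closed , 0-closed
    ^-closed {z} Fz (suc n) = *ᵍ-closed {z} {z ^ n} Fz (^-closed Fz n)

  -- Taking norms down a quadratic extension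

  module Radicals (n : ℕ) (w : Carrier × Carrier) where

    record Admissible (F : Pred Carrier 0ℓ) : Set where
      field
        isSubfield : IsSubfield F
        contains-w : w ∈² F
        no-root    : ∀ z → z ∈² F → ∀ j → ¬ (z ^ n ≈ᵍ w ^ (2 ℕ.^ j))

    module _ {F : Pred Carrier 0ℓ} (F-admissible : Admissible F)
             {s : Carrier} (Fs² : F (s * s)) (¬Fs : ¬ F s) where

      open Admissible F-admissible
      open IsSubfield isSubfield
      open Extension isSubfield Fs² ¬Fs renaming (isSubfield to Adjoin-isSubfield)

      -- If z = A + B s has zⁿ = W, then so has its conjugate A - B s, and
      -- their product, which lies in F[i], is an n-th root of W².
      module Norm (A B : Carrier × Carrier) (A∈F : A ∈² F) (B∈F : B ∈² F) where

        S D : Carrier × Carrier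
        S = s , 0#
        D = s * s , 0#

        open QuadraticPowers K[i] integers[i] A B D
        open IntegerSolver K[i] integers[i] using () renaming
          (solve to solveᵍ; _:+_ to _:+ᵍ_; _:*_ to _:*ᵍ_; :-_ to :-ᵍ_; _:-_ to _:-ᵍ_; _:=_ to _:=ᵍ_)

        D∈F : D ∈² F
        D∈F = Fs² , 0-closed

        norm : Carrier × Carrier
        norm = A *ᵍ A +ᵍ -ᵍ (D *ᵍ (B *ᵍ B))

        norm∈F : norm ∈² F
        norm∈F = +ᵍ-closed isSubfield { A *ᵍ A} (*ᵍ-closed isSubfield {A} A∈F A∈F)
          (-ᵍ-closed isSubfield { D *ᵍ (B *ᵍ B)} (*ᵍ-closed isSubfield {D} {B *ᵍ B} D∈F (*ᵍ-closed isSubfield {B} B∈F B∈F)))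

        parts∈F : ∀ k → rational k ∈² F × irrational k ∈² F
        parts∈F zero = (1-closed , 0-closed) , (0-closed , 0-closed)
        parts∈F (suc k) with parts∈F k
        ... | P∈F , Q∈F =
            +ᵍ-closed isSubfield {A *ᵍ P} (*ᵍ-closed isSubfield {A} {P} A∈F P∈F)
              (*ᵍ-closed isSubfield {D} {B *ᵍ Q} D∈F (*ᵍ-closed isSubfield {B} {Q} B∈F Q∈F))
          , +ᵍ-closed isSubfield {A *ᵍ Q} (*ᵍ-closed isSubfield {A} {Q} A∈F Q∈F) (*ᵍ-closed isSubfield {B} {P} B∈F P∈F)
          where
          P Q : Carrier × Carrier
          P = rational k
          Q = irrational k

        S²≈D : S *ᵍ S ≈ᵍ D
        S²≈D = trans (+-congˡ (trans (-‿cong (zeroˡ 0#)) -0#≈0#)) (+-identityʳ _)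
             , trans (+-cong (zeroʳ s) (zeroˡ s)) (+-identityˡ 0#)

        module _ (W : Carrier × Carrier) (W∈F : W ∈² F) (root : (A +ᵍ B *ᵍ S) ^ n ≈ᵍ W) where

          expanded : rational n +ᵍ irrational n *ᵍ S ≈ᵍ W
          expanded = K[i].trans (K[i].sym (power S S²≈D n)) root

          -- `S` has imaginary part 0, so the two coordinates of `expanded` are separate equations
          -- over `F`, and `independent` applies to each.
          irrational≈0 : irrational n ≈ᵍ K[i].0#
          irrational≈0 with parts∈F n
          ... | (P₁ , P₂) , (Q₁ , Q₂) =
              independent P₁ Q₁ (proj₁ W∈F) (trans (+-congˡ (sym
                (trans (+-congˡ (trans (-‿cong (zeroʳ _)) -0#≈0#)) (+-identityʳ _)))) (proj₁ expanded))
            , independent P₂ Q₂ (proj₂ W∈F) (trans (+-congˡ (sym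
                (trans (+-congʳ (zeroʳ _)) (+-identityˡ _)))) (proj₂ expanded))

          -- `S` and `-ᵍ S` share the coefficients of their powers, and the only one that multiplies
          -- the root is zero.
          conjugate-root : (A +ᵍ B *ᵍ (-ᵍ S)) ^ n ≈ᵍ W
          conjugate-root = K[i].trans (power (-ᵍ S)
              (K[i].trans (solveᵍ 1 (λ S → (:-ᵍ S) :*ᵍ (:-ᵍ S) :=ᵍ S :*ᵍ S) K[i].refl S) S²≈D) n)
            (K[i].trans (K[i].+-congˡ {rational n} (vanish (-ᵍ S)))
              (K[i].trans (K[i].sym (K[i].+-congˡ {rational n} (vanish S))) expanded))
            where
            vanish : ∀ T → irrational n *ᵍ T ≈ᵍ K[i].0#
            vanish T = K[i].trans (K[i].*-congʳ {T} irrational≈0) (K[i].zeroˡ T)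

          norm-root : norm ^ n ≈ᵍ W *ᵍ W
          norm-root = K[i].trans (^-congˡ n norm≈) (K[i].trans
            (^-distrib-* (A +ᵍ B *ᵍ S) (A +ᵍ B *ᵍ (-ᵍ S)) n)
            (K[i].*-cong {(A +ᵍ B *ᵍ S) ^ n} {W} {(A +ᵍ B *ᵍ (-ᵍ S)) ^ n} {W} root conjugate-root))
            where
            norm≈ : norm ≈ᵍ (A +ᵍ B *ᵍ S) *ᵍ (A +ᵍ B *ᵍ (-ᵍ S))
            norm≈ = K[i].trans (K[i].+-congˡ {A *ᵍ A} (K[i].-‿cong (K[i].*-congʳ {B *ᵍ B} (K[i].sym S²≈D))))
              (solveᵍ 3 (λ A B S → A :*ᵍ A :-ᵍ (S :*ᵍ S) :*ᵍ (B :*ᵍ B) :=ᵍ (A :+ᵍ B :*ᵍ S) :*ᵍ (A :+ᵍ B :*ᵍ (:-ᵍ S)))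
                K[i].refl A B S)

      Adjoin-admissible : Admissible (Adjoin F s)
      Adjoin-admissible = record
        { isSubfield = Adjoin-isSubfield
        ; contains-w = inclusion (proj₁ contains-w) , inclusion (proj₂ contains-w)
        ; no-root = λ (x , y) (¬¬x , ¬¬y) j root →
            ¬¬x λ (a , b , Fa , Fb , x≈) → ¬¬y λ (c , d , Fc , Fd , y≈) →
            -- `(a + b s) + (c + d s) i` is regrouped as `(a + c i) + (b + d i) s`.
            let A = a , c
                B = b , d
                open Norm A B (Fa , Fc) (Fb , Fd)
                z≈ : (x , y) ≈ᵍ A +ᵍ B *ᵍ S
                z≈ = trans x≈ (+-congˡ (sym (trans (+-congˡ (trans (-‿cong (zeroʳ d)) -0#≈0#)) (+-identityʳ _))))
                   , trans y≈ (+-congˡ (sym (trans (+-congʳ (zeroʳ b)) (+-identityˡ _))))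
                W = w ^ (2 ℕ.^ j)
            in no-root norm norm∈F (suc j) (K[i].trans
                 (norm-root W (^-closed isSubfield {w} contains-w (2 ℕ.^ j)) (K[i].trans (^-congˡ n (K[i].sym z≈)) root))
                 (K[i].trans (K[i].*-congˡ {W} (K[i].sym (K[i].*-identityʳ W))) (K[i].sym (doubled j))))
        }
        where
        -- `2 ^ suc j` unfolds to `2 ^ j + (2 ^ j + 0)`, hence the trailing unit.
        doubled : ∀ j → w ^ (2 ℕ.^ suc j) ≈ᵍ w ^ (2 ℕ.^ j) *ᵍ (w ^ (2 ℕ.^ j) *ᵍ K[i].1#)
        doubled j = K[i].trans (^-homo-* w (2 ℕ.^ j) (2 ℕ.^ j ℕ.+ 0))
          (K[i].*-congˡ {w ^ (2 ℕ.^ j)} (^-homo-* w (2 ℕ.^ j) 0))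

    no-nth-root : ∀ {F z u} → Admissible F → z ∈² F → z ^ n ≈ᵍ u → ¬ (u ≈ᵍ w)
    no-nth-root {z = z} F-admissible z∈F zⁿ≈u u≈w = Admissible.no-root F-admissible z z∈F 0
      (K[i].trans zⁿ≈u (K[i].trans u≈w (K[i].sym (K[i].*-identityʳ w))))

    -- Whether `s` already lies in `F` is not decidable; the double negation in the conclusion
    -- permits the case distinction.
    extend : ∀ {F s} → Admissible F → F (s * s) →
             ¬ ¬ ∃ λ G → F ⊆ G × Admissible G × G s
    extend {F} {s} F-admissible Fs² ¬∃ = ¬¬-excluded-middle {A = F s} λ
      { (yes Fs) → ¬∃ (F , (λ Fx → Fx) , F-admissible , Fs)
      ; (no ¬Fs) → let open Extension (Admissible.isSubfield F-admissible) {s} Fs² ¬Fs in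
          ¬∃ (Adjoin F s , inclusion , Adjoin-admissible F-admissible Fs² ¬Fs , generator)
      }

  -- The prime field ℚ inside `K`, the bottom of the tower, with `x = p / q` written without
  -- division.
  Ratio : Pred Carrier 0ℓ
  Ratio x = ¬ ¬ ∃₂ λ p q → ¬ q ≡ + 0 × ι q * x ≈ ι p

  nonzero-* : ∀ {p q} → ¬ p ≡ + 0 → ¬ q ≡ + 0 → ¬ p ℤ.* q ≡ + 0
  nonzero-* {p} p≢0 q≢0 pq≡0 = [ p≢0 , q≢0 ]′ (ℤ.i*j≡0⇒i≡0∨j≡0 p pq≡0)

  Ratio-isSubfield : IsSubfield Ratio
  Ratio-isSubfield = record
    { resp = λ x≈y ¬¬x ¬∃ → ¬¬x λ (p , q , q≢0 , eq) → ¬∃ (p , q , q≢0 , trans (*-congˡ (sym x≈y)) eq)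
    ; ¬¬-closed = λ ¬¬x ¬∃ → ¬¬x λ x → x ¬∃
    ; ι-closed = λ n ¬∃ → ¬∃ (n , + 1 , (λ ()) , trans (*-congʳ 1-homo) (*-identityˡ (ι n)))
    ; +-closed = λ {x} {y} ¬¬x ¬¬y ¬∃ → ¬¬x λ (p , q , q≢0 , x≈) → ¬¬y λ (p′ , q′ , q′≢0 , y≈) →
        ¬∃ (p ℤ.* q′ ℤ.+ p′ ℤ.* q , q ℤ.* q′ , nonzero-* q≢0 q′≢0 , (begin
          ι (q ℤ.* q′) * (x + y)                ≈⟨ *-congʳ (*-homo q q′) ⟩
          ι q * ι q′ * (x + y)                  ≈⟨ solve 4 (λ q q′ x y →
            q :* q′ :* (x :+ y) := q :* x :* q′ :+ q′ :* y :* q) refl (ι q) (ι q′) x y ⟩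
          ι q * x * ι q′ + ι q′ * y * ι q       ≈⟨ +-cong (*-congʳ x≈) (*-congʳ y≈) ⟩
          ι p * ι q′ + ι p′ * ι q               ≈⟨ sym (trans (+-homo _ _) (+-cong (*-homo p q′) (*-homo p′ q))) ⟩
          ι (p ℤ.* q′ ℤ.+ p′ ℤ.* q)             ∎))
    ; *-closed = λ {x} {y} ¬¬x ¬¬y ¬∃ → ¬¬x λ (p , q , q≢0 , x≈) → ¬¬y λ (p′ , q′ , q′≢0 , y≈) →
        ¬∃ (p ℤ.* p′ , q ℤ.* q′ , nonzero-* q≢0 q′≢0 , (begin
          ι (q ℤ.* q′) * (x * y)                ≈⟨ *-congʳ (*-homo q q′) ⟩
          ι q * ι q′ * (x * y)                  ≈⟨ solve 4 (λ q q′ x y →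
            q :* q′ :* (x :* y) := q :* x :* (q′ :* y)) refl (ι q) (ι q′) x y ⟩
          ι q * x * (ι q′ * y)                  ≈⟨ *-cong x≈ y≈ ⟩
          ι p * ι p′                            ≈⟨ sym (*-homo p p′) ⟩
          ι (p ℤ.* p′)                          ∎))
    ; -‿closed = λ {x} ¬¬x ¬∃ → ¬¬x λ (p , q , q≢0 , x≈) →
        ¬∃ (ℤ.- p , q , q≢0 , trans (sym (-‿distribʳ-* (ι q) x)) (trans (-‿cong x≈) (sym (-‿homo p))))
    ; ⁻¹-closed = λ {x} {y} xy≈1 ¬¬x ¬∃ → ¬¬x λ (p , q , q≢0 , x≈) →
        let py≈q : ι p * y ≈ ι q
            py≈q = trans (*-congʳ (sym x≈)) (trans (*-assoc (ι q) x y) (trans (*-congˡ xy≈1) (*-identityʳ (ι q))))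
            p≢0 : ¬ p ≡ + 0
            p≢0 p≡0 = q≢0 (characteristic-0 (trans (sym py≈q)
              (trans (*-congʳ (trans (reflexive (≡.cong ι p≡0)) 0-homo)) (zeroˡ y))))
        in ¬∃ (q , p , p≢0 , py≈q)
    }

  module ℤ[i] = GaussianIntegers

  embed : ℤ × ℤ → Carrier × Carrier
  embed (a , b) = ι a , ι b

  embed-* : ∀ g h → embed (g ℤ[i].*ᵍ h) ≈ᵍ embed g *ᵍ embed h
  embed-* (a , b) (c , d) =
      trans (+-homo _ _) (+-cong (*-homo a c) (trans (-‿homo _) (-‿cong (*-homo b d))))
    , trans (+-homo _ _) (+-cong (*-homo a d) (*-homo b c))

  embed-^ : ∀ g n → embed (g ℤ[i].^ n) ≈ᵍ embed g ^ n
  embed-^ g zero    = 1-homo , 0-homo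
  embed-^ g (suc n) = K[i].trans (embed-* g (g ℤ[i].^ n)) (K[i].*-congˡ {embed g} (embed-^ g n))

  embed-injective : ∀ {g h} → embed g ≈ᵍ embed h → g ℤ[i].≈ᵍ h
  embed-injective (p , q) = ι-injective p , ι-injective q
    where
    ι-injective : ∀ {a b} → ι a ≈ ι b → a ≡ b
    ι-injective {a} {b} eq = ℤ.i-j≡0⇒i≡j a b (characteristic-0
      (trans (+-homo a (ℤ.- b)) (trans (+-congˡ (-‿homo b)) (trans (+-congʳ eq) (-‿inverseʳ (ι b))))))

  embed-scaled : ∀ {c s p q} n a b → c ≈ p → s ≈ q → ι n * p ≈ ι a → ι n * q ≈ ι b →
    embed (n , + 0) *ᵍ (c , s) ≈ᵍ embed (a , b)
  embed-scaled {c} {s} n a b c≈p s≈q np≈a nq≈b =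
      trans (solve 3 (λ n c s → n :* c :- con (+ 0) :* s := n :* c) refl (ι n) c s) (trans (*-congˡ c≈p) np≈a)
    , trans (solve 3 (λ n c s → n :* s :+ con (+ 0) :* c := n :* s) refl (ι n) c s) (trans (*-congˡ s≈q) nq≈b)

  module _ (w : Carrier × Carrier) (25w≈24+7i : embed (+ 25 , + 0) *ᵍ w ≈ᵍ embed (+ 24 , + 7)) where

    open Radicals

    -- A root in ℚ(i), put over the common denominator `q q′`, yields `n ∣ 2 ^ j * 2` by
    -- `root-exponent`, and a divisor of a power of 2 is itself one.
    Ratio-admissible : ∀ n → .{{_ : ℕ.NonZero n}} → ¬ (∃ λ k → n ≡ 2 ℕ.^ k) → Admissible n w Ratio
    Ratio-admissible zero        n-not-2^ = contradiction ≡.refl (ℕ.≢-nonZero⁻¹ 0)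
    Ratio-admissible n@(suc n-1) n-not-2^ = record
      { isSubfield = Ratio-isSubfield
      ; contains-w =
            (λ ¬∃ → ¬∃ (+ 24 , + 25 , (λ ()) , trans
              (solve 3 (λ a b c → a :* b := a :* b :- con (+ 0) :* c) refl (ι (+ 25)) (proj₁ w) (proj₂ w))
              (proj₁ 25w≈24+7i)))
          , (λ ¬∃ → ¬∃ (+ 7 , + 25 , (λ ()) , trans
              (solve 3 (λ a b c → a :* c := a :* c :+ con (+ 0) :* b) refl (ι (+ 25)) (proj₁ w) (proj₂ w))
              (proj₂ 25w≈24+7i)))
      ; no-root = λ (x , y) (¬¬x , ¬¬y) j root →
          ¬¬x λ (p , q , q≢0 , x≈) → ¬¬y λ (p′ , q′ , q′≢0 , y≈) →
          let divides = ℤ[i].root-exponent n-1 (2 ℕ.^ j) (p ℤ.* q′ , p′ ℤ.* q) (q ℤ.* q′ , + 0)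
                (λ c≈0 → nonzero-* q≢0 q′≢0 (proj₁ c≈0))
                (cleared (x , y) (p ℤ.* q′ , p′ ℤ.* q) (q ℤ.* q′ , + 0) (2 ℕ.^ j) root
                  (denominators x≈ y≈))
          in n-not-2^ (divisor-of-2^ (suc j) (≡.subst (n ℕᵈ.∣_) (ℕ.*-comm (2 ℕ.^ j) 2) divides))
      }
      where
      denominators : ∀ {x y p q p′ q′} → ι q * x ≈ ι p → ι q′ * y ≈ ι p′ →
        embed (p ℤ.* q′ , p′ ℤ.* q) ≈ᵍ embed (q ℤ.* q′ , + 0) *ᵍ (x , y)
      denominators {x} {y} {p} {q} {p′} {q′} x≈ y≈ =
          (begin
            ι (p ℤ.* q′)                        ≈⟨ trans (*-homo p q′) (*-congʳ (sym x≈)) ⟩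
            ι q * x * ι q′                      ≈⟨ solve 4 (λ q q′ x y → q :* x :* q′ :=
              q :* q′ :* x :- con (+ 0) :* y) refl (ι q) (ι q′) x y ⟩
            ι q * ι q′ * x - ι (+ 0) * y        ≈⟨ +-congʳ (*-congʳ (sym (*-homo q q′))) ⟩
            ι (q ℤ.* q′) * x - ι (+ 0) * y      ∎)
        , (begin
            ι (p′ ℤ.* q)                        ≈⟨ trans (*-homo p′ q) (*-congʳ (sym y≈)) ⟩
            ι q′ * y * ι q                      ≈⟨ solve 4 (λ q q′ x y → q′ :* y :* q :=
              q :* q′ :* y :+ con (+ 0) :* x) refl (ι q) (ι q′) x y ⟩
            ι q * ι q′ * y + ι (+ 0) * x        ≈⟨ +-congʳ (*-congʳ (sym (*-homo q q′))) ⟩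
            ι (q ℤ.* q′) * y + ι (+ 0) * x      ∎)
      -- Multiplying `z ^ n ≈ᵍ w ^ J` by the `J`-th power of 25 and by `c ^ n` removes all
      -- denominators; injectivity of `embed` then brings the equation down to ℤ[i].
      cleared : ∀ z g c J → z ^ n ≈ᵍ w ^ J → embed g ≈ᵍ embed c *ᵍ z →
        (+ 25 , + 0) ℤ[i].^ J ℤ[i].*ᵍ g ℤ[i].^ n ℤ[i].≈ᵍ c ℤ[i].^ n ℤ[i].*ᵍ (+ 24 , + 7) ℤ[i].^ J
      cleared z g c J root g≈cz = embed-injective (K[i].trans (embed-* (N ℤ[i].^ J) (g ℤ[i].^ n))
        (K[i].trans (K[i].*-cong (embed-^ N J) (embed-^ g (n)))
        (K[i].trans main (K[i].sym
        (K[i].trans (embed-* (c ℤ[i].^ n) (M ℤ[i].^ J))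
          (K[i].*-cong (embed-^ c (n)) (embed-^ M J)))))))
        where
        N M : ℤ × ℤ
        N = + 25 , + 0
        M = + 24 , + 7
        open import Algebra.Properties.CommutativeSemigroup K[i].*-commutativeSemigroup using (x∙yz≈y∙xz)
        main : embed N ^ J *ᵍ embed g ^ n ≈ᵍ embed c ^ n *ᵍ embed M ^ J
        main =
          K[i].trans (K[i].*-congˡ {embed N ^ J} (K[i].trans (^-congˡ (n) g≈cz) (^-distrib-* (embed c) z (n))))
          (K[i].trans (x∙yz≈y∙xz (embed N ^ J) (embed c ^ n) (z ^ n))
          (K[i].*-congˡ {embed c ^ n} (K[i].trans (K[i].*-congˡ {embed N ^ J} root)
          (K[i].trans (K[i].sym (^-distrib-* (embed N) w J)) (^-congˡ J 25w≈24+7i)))))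

-- Intersections of lines and circles

module Plane (K : StableField) where

  open StableField K
  open Subfields K
  open import Algebra.Properties.Group +-group using (x∙y⁻¹≈ε⇒x≈y; x≈y⇒x∙y⁻¹≈ε)
  open import Algebra.Properties.Ring ring using (-0#≈0#)
  open import Relation.Binary.Reasoning.Setoid setoid

  KPoint : Set
  KPoint = Carrier × Carrier

  squaredDistance : KPoint → KPoint → Carrier
  squaredDistance (x , y) (x′ , y′) = (x - x′) * (x - x′) + (y - y′) * (y - y′)

  -- At the real field these unfold to the point sets of `line` and `circle`, so the results below
  -- apply to figures directly.
  Line Circle : KPoint → KPoint → Pred KPoint 0ℓ
  Line (p₁ , p₂) (q₁ , q₂) (x , y) = (q₁ - p₁) * (y - p₂) ≈ (q₂ - p₂) * (x - p₁)
  Circle P Q X = squaredDistance P X ≈ squaredDistance P Q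

  distinct⇒norm≉0 : ∀ {P Q : KPoint} → ¬ (P ≈ᵍ Q) →
    ¬ ((proj₁ P - proj₁ Q) * (proj₁ P - proj₁ Q) + (proj₂ P - proj₂ Q) * (proj₂ P - proj₂ Q) ≈ 0#)
  distinct⇒norm≉0 P≉Q n≈0 = P≉Q
    ( x∙y⁻¹≈ε⇒x≈y _ _ (formally-real n≈0)
    , x∙y⁻¹≈ε⇒x≈y _ _ (formally-real (trans (+-comm _ _) n≈0)))

  2≉0 : ¬ (ι (+ 2) ≈ 0#)
  2≉0 2≈0 with characteristic-0 2≈0
  ... | ()

  -- `generate` speaks of every subfield containing the root, so it fits both outcomes of `extend`:
  -- keeping `F` or adjoining the root.
  record QuadraticOver (F : Pred Carrier 0ℓ) (X : KPoint) : Set₁ where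
    field
      root     : Carrier
      root²∈F  : F (root * root)
      generate : ∀ {G} → IsSubfield G → F ⊆ G → G root → X ∈² G

  -- `(p₂ - q₂ , q₁ - p₁)` is the normal vector of the line, giving the `a` and `b` of its equation
  -- `a x + b y = c`.
  normal≉0 : ∀ {P Q : KPoint} → ¬ (P ≈ᵍ Q) →
    ¬ ((proj₂ P - proj₂ Q) * (proj₂ P - proj₂ Q) + (proj₁ Q - proj₁ P) * (proj₁ Q - proj₁ P) ≈ 0#)
  normal≉0 {p₁ , p₂} {q₁ , q₂} P≉Q n≈0 = distinct⇒norm≉0 P≉Q (trans
    (solve 4 (λ p₁ p₂ q₁ q₂ →
      (p₁ :- q₁) :* (p₁ :- q₁) :+ (p₂ :- q₂) :* (p₂ :- q₂) :=
      (p₂ :- q₂) :* (p₂ :- q₂) :+ (q₁ :- p₁) :* (q₁ :- p₁)) refl p₁ p₂ q₁ q₂) n≈0)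

  -- The vector from `X` to `Y` is orthogonal to the normal `(a , b)`. A vanishing determinant makes
  -- `(a′ , b′)` proportional to it, hence orthogonal to the same vector. The identity in `main`
  -- says this without division, at the price of the nonzero factor `a * a + b * b`.
  parallel : ∀ {P Q P′ Q′ X : KPoint} → ¬ (P ≈ᵍ Q) → X ∈ Line P Q → X ∈ Line P′ Q′ →
    (proj₂ P - proj₂ Q) * (proj₁ Q′ - proj₁ P′) - (proj₁ Q - proj₁ P) * (proj₂ P′ - proj₂ Q′) ≈ 0# →
    Line P Q ⊆ Line P′ Q′
  parallel {P@(p₁ , p₂)} {Q@(q₁ , q₂)} {P′@(p₁′ , p₂′)} {Q′@(q₁′ , q₂′)} {X@(x , y)} P≉Q X∈ X∈′ det≈0 {Y@(x′ , y′)} Y∈ =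
    x∙y⁻¹≈ε⇒x≈y _ _ (begin
      (q₁′ - p₁′) * (y′ - p₂′) - (q₂′ - p₂′) * (x′ - p₁′)
        ≈⟨ difference P′ Q′ X Y ⟩
      (a′ * (x′ - x) + b′ * (y′ - y)) + ((q₁′ - p₁′) * (y - p₂′) - (q₂′ - p₂′) * (x - p₁′))
        ≈⟨ +-cong (zero-product (normal≉0 P≉Q) main) (x≈y⇒x∙y⁻¹≈ε X∈′) ⟩
      0# + 0#
        ≈⟨ +-identityˡ 0# ⟩
      0# ∎)
    where
    a b a′ b′ : Carrier
    a = p₂ - q₂
    b = q₁ - p₁
    a′ = p₂′ - q₂′
    b′ = q₁′ - p₁′
    difference : ∀ (P Q X Y : KPoint) →
      (proj₁ Q - proj₁ P) * (proj₂ Y - proj₂ P) - (proj₂ Q - proj₂ P) * (proj₁ Y - proj₁ P) ≈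
      ((proj₂ P - proj₂ Q) * (proj₁ Y - proj₁ X) + (proj₁ Q - proj₁ P) * (proj₂ Y - proj₂ X)) +
      ((proj₁ Q - proj₁ P) * (proj₂ X - proj₂ P) - (proj₂ Q - proj₂ P) * (proj₁ X - proj₁ P))
    difference (p₁ , p₂) (q₁ , q₂) (x , y) (x′ , y′) = solve 8 (λ p₁ p₂ q₁ q₂ x y x′ y′ →
      (q₁ :- p₁) :* (y′ :- p₂) :- (q₂ :- p₂) :* (x′ :- p₁) :=
      ((p₂ :- q₂) :* (x′ :- x) :+ (q₁ :- p₁) :* (y′ :- y)) :+
      ((q₁ :- p₁) :* (y :- p₂) :- (q₂ :- p₂) :* (x :- p₁))) refl p₁ p₂ q₁ q₂ x y x′ y′
    along : a * (x′ - x) + b * (y′ - y) ≈ 0#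
    along = begin
      a * (x′ - x) + b * (y′ - y)
        ≈⟨ sym (trans (+-congˡ (x≈y⇒x∙y⁻¹≈ε X∈)) (+-identityʳ _)) ⟩
      (a * (x′ - x) + b * (y′ - y)) + ((q₁ - p₁) * (y - p₂) - (q₂ - p₂) * (x - p₁))
        ≈⟨ sym (difference P Q X Y) ⟩
      (q₁ - p₁) * (y′ - p₂) - (q₂ - p₂) * (x′ - p₁)
        ≈⟨ x≈y⇒x∙y⁻¹≈ε Y∈ ⟩
      0# ∎
    main : (a * a + b * b) * (a′ * (x′ - x) + b′ * (y′ - y)) ≈ 0#
    main = begin
      (a * a + b * b) * (a′ * (x′ - x) + b′ * (y′ - y))
        ≈⟨ solve 6 (λ a b a′ b′ A B → (a :* a :+ b :* b) :* (a′ :* A :+ b′ :* B) :=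
             (a :* A :+ b :* B) :* (a :* a′ :+ b :* b′) :+ (a :* b′ :- b :* a′) :* (a :* B :- b :* A))
             refl a b a′ b′ (x′ - x) (y′ - y) ⟩
      (a * (x′ - x) + b * (y′ - y)) * (a * a′ + b * b′) + (a * b′ - b * a′) * (a * (y′ - y) - b * (x′ - x))
        ≈⟨ +-cong (trans (*-congʳ along) (zeroˡ _)) (trans (*-congʳ det≈0) (zeroˡ _)) ⟩
      0# + 0#
        ≈⟨ +-identityˡ 0# ⟩
      0# ∎

  -- The common point `X` forces the radii to agree.
  concentric : ∀ {P Q P′ Q′ X : KPoint} → P ≈ᵍ P′ → X ∈ Circle P Q → X ∈ Circle P′ Q′ → Circle P Q ⊆ Circle P′ Q′
  concentric {P} {Q} {P′} {Q′} {X} P≈P′ X∈ X∈′ {Y} Y∈ = begin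
    squaredDistance P′ Y    ≈⟨ sym (moved Y) ⟩
    squaredDistance P Y     ≈⟨ Y∈ ⟩
    squaredDistance P Q     ≈⟨ sym X∈ ⟩
    squaredDistance P X     ≈⟨ moved X ⟩
    squaredDistance P′ X    ≈⟨ X∈′ ⟩
    squaredDistance P′ Q′   ∎
    where
    moved : ∀ Z → squaredDistance P Z ≈ squaredDistance P′ Z
    moved Z = +-cong (*-cong (+-congʳ (proj₁ P≈P′)) (+-congʳ (proj₁ P≈P′)))
                     (*-cong (+-congʳ (proj₂ P≈P′)) (+-congʳ (proj₂ P≈P′)))

  module _ {F : Pred Carrier 0ℓ} (F-isSubfield : IsSubfield F) where

    open IsSubfield F-isSubfield

    -- Cramer's rule.
    solve-linear : ∀ {a b a′ b′ x y} → F a → F b → F a′ → F b′ → ¬ (a * b′ - b * a′ ≈ 0#) →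
      F (a * x + b * y) → F (a′ * x + b′ * y) → F x × F y
    solve-linear {a} {b} {a′} {b′} {x} {y} Fa Fb Fa′ Fb′ det≉0 Fc Fc′ =
        divide det≉0 Fdet (resp (solve 6 (λ a b a′ b′ x y →
          (a :* x :+ b :* y) :* b′ :- (a′ :* x :+ b′ :* y) :* b := (a :* b′ :- b :* a′) :* x) refl a b a′ b′ x y)
          (-ᶜ-closed (*-closed Fc Fb′) (*-closed Fc′ Fb)))
      , divide det≉0 Fdet (resp (solve 6 (λ a b a′ b′ x y →
          (a′ :* x :+ b′ :* y) :* a :- (a :* x :+ b :* y) :* a′ := (a :* b′ :- b :* a′) :* y) refl a b a′ b′ x y)
          (-ᶜ-closed (*-closed Fc′ Fa) (*-closed Fc Fa′)))
      where
      Fdet : F (a * b′ - b * a′)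
      Fdet = -ᶜ-closed (*-closed Fa Fb′) (*-closed Fb Fa′)

    rational-point : ∀ {X} → X ∈² F → QuadraticOver F X
    rational-point (Fx , Fy) = record
      { root = 0# ; root²∈F = *-closed 0-closed 0-closed ; generate = λ _ F⊆G _ → F⊆G Fx , F⊆G Fy }

    -- With t = a y - b x, a line a x + b y = c turns the circle into
    -- t² + k t + l = 0, where k = v a - u b; the root adjoined is 2 t + k.
    solve-quadratic : ∀ {a b u v x y} → F a → F b → F u → F v → ¬ (a * a + b * b ≈ 0#) →
      F (a * x + b * y) → F (x * x + y * y + (u * x + v * y)) → QuadraticOver F (x , y)
    solve-quadratic {a} {b} {u} {v} {x} {y} Fa Fb Fu Fv n≉0 Fc Fe = record
      { root     = s
      ; root²∈F  = resp (solve 6 (λ a b u v x y →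
          let c = a :* x :+ b :* y ; e = x :* x :+ y :* y :+ (u :* x :+ v :* y)
              k = v :* a :- u :* b ; n = a :* a :+ b :* b
              s = con (+ 2) :* (a :* y :- b :* x) :+ k
          in k :* k :- con (+ 4) :* (c :* c :+ (u :* a :+ v :* b) :* c :- n :* e) := s :* s)
          refl a b u v x y)
          (-ᶜ-closed (*-closed Fk Fk) (*-closed (ι-closed (+ 4)) (-ᶜ-closed
            (+-closed (*-closed Fc Fc) (*-closed (+-closed (*-closed Fu Fa) (*-closed Fv Fb)) Fc))
            (*-closed Fn Fe))))
      ; generate = λ G-isSubfield F⊆G Gs → let module G = IsSubfield G-isSubfield in
            G.divide n≉0 (F⊆G Fn) (G.divide 2≉0 (G.ι-closed (+ 2)) (G.resp (solve 6 (λ a b u v x y →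
              let c = a :* x :+ b :* y ; k = v :* a :- u :* b ; n = a :* a :+ b :* b
                  s = con (+ 2) :* (a :* y :- b :* x) :+ k
              in con (+ 2) :* (a :* c) :- b :* (s :- k) := con (+ 2) :* (n :* x)) refl a b u v x y)
              (G.-ᶜ-closed (G.*-closed (G.ι-closed (+ 2)) (F⊆G (*-closed Fa Fc)))
                (G.*-closed (F⊆G Fb) (G.-ᶜ-closed Gs (F⊆G Fk))))))
          , G.divide n≉0 (F⊆G Fn) (G.divide 2≉0 (G.ι-closed (+ 2)) (G.resp (solve 6 (λ a b u v x y →
              let c = a :* x :+ b :* y ; k = v :* a :- u :* b ; n = a :* a :+ b :* b
                  s = con (+ 2) :* (a :* y :- b :* x) :+ k
              in con (+ 2) :* (b :* c) :+ a :* (s :- k) := con (+ 2) :* (n :* y)) refl a b u v x y)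
              (G.+-closed (G.*-closed (G.ι-closed (+ 2)) (F⊆G (*-closed Fb Fc)))
                (G.*-closed (F⊆G Fa) (G.-ᶜ-closed Gs (F⊆G Fk))))))
      }
      where
      k s : Carrier
      k = v * a - u * b
      s = ι (+ 2) * (a * y - b * x) + k
      Fk : F k
      Fk = -ᶜ-closed (*-closed Fv Fa) (*-closed Fu Fb)
      Fn : F (a * a + b * b)
      Fn = +-closed (*-closed Fa Fa) (*-closed Fb Fb)

    squaredDistance-closed : ∀ {P Q} → P ∈² F → Q ∈² F → F (squaredDistance P Q)
    squaredDistance-closed (F₁ , F₂) (F₃ , F₄) =
      +-closed (*-closed (-ᶜ-closed F₁ F₃) (-ᶜ-closed F₁ F₃)) (*-closed (-ᶜ-closed F₂ F₄) (-ᶜ-closed F₂ F₄))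

    line-equation : ∀ {P Q X} → P ∈² F → Q ∈² F → X ∈ Line P Q →
      F ((proj₂ P - proj₂ Q) * proj₁ X + (proj₁ Q - proj₁ P) * proj₂ X)
    line-equation {p₁ , p₂} {q₁ , q₂} {x , y} (Fp₁ , Fp₂) (Fq₁ , Fq₂) X∈ = resp (begin
      (p₂ - q₂) * p₁ + (q₁ - p₁) * p₂
        ≈⟨ sym (trans (+-congʳ (x≈y⇒x∙y⁻¹≈ε X∈)) (+-identityˡ _)) ⟩
      ((q₁ - p₁) * (y - p₂) - (q₂ - p₂) * (x - p₁)) + ((p₂ - q₂) * p₁ + (q₁ - p₁) * p₂)
        ≈⟨ solve 6 (λ p₁ p₂ q₁ q₂ x y →
             ((q₁ :- p₁) :* (y :- p₂) :- (q₂ :- p₂) :* (x :- p₁)) :+ ((p₂ :- q₂) :* p₁ :+ (q₁ :- p₁) :* p₂) :=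
             (p₂ :- q₂) :* x :+ (q₁ :- p₁) :* y) refl p₁ p₂ q₁ q₂ x y ⟩
      (p₂ - q₂) * x + (q₁ - p₁) * y ∎)
      (+-closed (*-closed (-ᶜ-closed Fp₂ Fq₂) Fp₁) (*-closed (-ᶜ-closed Fq₁ Fp₁) Fp₂))

    circle-equation : ∀ {P Q X} → P ∈² F → Q ∈² F → X ∈ Circle P Q →
      F (proj₁ X * proj₁ X + proj₂ X * proj₂ X + (- (ι (+ 2) * proj₁ P) * proj₁ X + - (ι (+ 2) * proj₂ P) * proj₂ X))
    circle-equation {p₁ , p₂} {Q} {x , y} P∈F@(Fp₁ , Fp₂) Q∈F X∈ = resp
      (trans (+-congʳ (sym X∈)) (solve 4 (λ p₁ p₂ x y →
        ((p₁ :- x) :* (p₁ :- x) :+ (p₂ :- y) :* (p₂ :- y)) :- (p₁ :* p₁ :+ p₂ :* p₂) :=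
        x :* x :+ y :* y :+ (:- (con (+ 2) :* p₁) :* x :+ :- (con (+ 2) :* p₂) :* y)) refl p₁ p₂ x y))
      (-ᶜ-closed (squaredDistance-closed P∈F Q∈F) (+-closed (*-closed Fp₁ Fp₁) (*-closed Fp₂ Fp₂)))

    line∩circle : ∀ {P Q P′ Q′ X} → P ∈² F → Q ∈² F → P′ ∈² F → Q′ ∈² F → ¬ (P ≈ᵍ Q) →
      X ∈ Line P Q → X ∈ Circle P′ Q′ → QuadraticOver F X
    line∩circle P∈F@(Fp₁ , Fp₂) Q∈F@(Fq₁ , Fq₂) P′∈F@(Fp′₁ , Fp′₂) Q′∈F P≉Q X∈line X∈circle =
      solve-quadratic (-ᶜ-closed Fp₂ Fq₂) (-ᶜ-closed Fq₁ Fp₁)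
        (-‿closed (*-closed (ι-closed (+ 2)) Fp′₁)) (-‿closed (*-closed (ι-closed (+ 2)) Fp′₂))
        (normal≉0 P≉Q) (line-equation P∈F Q∈F X∈line) (circle-equation P′∈F Q′∈F X∈circle)

    -- Both lines pass through `X`, so a vanishing determinant would make them coincide, against
    -- `differ`.
    line∩line : ∀ {P Q P′ Q′ X} → P ∈² F → Q ∈² F → P′ ∈² F → Q′ ∈² F → ¬ (P ≈ᵍ Q) → ¬ (P′ ≈ᵍ Q′) →
      ¬ (Line P Q ≐ Line P′ Q′) → X ∈ Line P Q → X ∈ Line P′ Q′ → QuadraticOver F X
    line∩line {P@(p₁ , p₂)} {Q@(q₁ , q₂)} {P′@(p₁′ , p₂′)} {Q′@(q₁′ , q₂′)} {X@(x , y)}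
      P∈F@(Fp₁ , Fp₂) Q∈F@(Fq₁ , Fq₂) P′∈F@(Fp′₁ , Fp′₂) Q′∈F@(Fq′₁ , Fq′₂) P≉Q P′≉Q′ differ X∈ X∈′ =
      rational-point (solve-linear (-ᶜ-closed Fp₂ Fq₂) (-ᶜ-closed Fq₁ Fp₁) (-ᶜ-closed Fp′₂ Fq′₂) (-ᶜ-closed Fq′₁ Fp′₁)
        det≉0 (line-equation P∈F Q∈F X∈) (line-equation P′∈F Q′∈F X∈′))
      where
      det≉0 : ¬ ((p₂ - q₂) * (q₁′ - p₁′) - (q₁ - p₁) * (p₂′ - q₂′) ≈ 0#)
      det≉0 det≈0 = differ
        ( parallel P≉Q X∈ X∈′ det≈0
        , parallel P′≉Q′ X∈′ X∈ (trans (solve 4 (λ a b c d → c :* b :- d :* a := :- (a :* d :- b :* c)) refl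
            (p₂ - q₂) (q₁ - p₁) (p₂′ - q₂′) (q₁′ - p₁′)) (trans (-‿cong det≈0) -0#≈0#)))

    -- Subtracting the circle equations leaves the radical axis, which is then met with the first
    -- circle. It is a genuine line because concentric circles through `X` would coincide.
    circle∩circle : ∀ {P Q P′ Q′ X} → P ∈² F → Q ∈² F → P′ ∈² F → Q′ ∈² F →
      ¬ (Circle P Q ≐ Circle P′ Q′) → X ∈ Circle P Q → X ∈ Circle P′ Q′ → QuadraticOver F X
    circle∩circle {P@(p₁ , p₂)} {Q} {P′@(p₁′ , p₂′)} {Q′} {X@(x , y)}
      P∈F@(Fp₁ , Fp₂) Q∈F P′∈F@(Fp′₁ , Fp′₂) Q′∈F differ X∈ X∈′ =
      solve-quadratic (*-closed (ι-closed (+ 2)) (-ᶜ-closed Fp₁ Fp′₁)) (*-closed (ι-closed (+ 2)) (-ᶜ-closed Fp₂ Fp′₂))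
        (-‿closed (*-closed (ι-closed (+ 2)) Fp₁)) (-‿closed (*-closed (ι-closed (+ 2)) Fp₂))
        (λ n≈0 → distinct⇒norm≉0 centres-differ (zero-product 2≉0 (zero-product 2≉0 (trans
          (solve 4 (λ p₁ p₂ p₁′ p₂′ →
            con (+ 2) :* (con (+ 2) :* ((p₁ :- p₁′) :* (p₁ :- p₁′) :+ (p₂ :- p₂′) :* (p₂ :- p₂′))) :=
            (con (+ 2) :* (p₁ :- p₁′)) :* (con (+ 2) :* (p₁ :- p₁′)) :+
            (con (+ 2) :* (p₂ :- p₂′)) :* (con (+ 2) :* (p₂ :- p₂′))) refl p₁ p₂ p₁′ p₂′) n≈0))))
        (resp (solve 6 (λ p₁ p₂ p₁′ p₂′ x y →
            let e = λ p₁ p₂ → x :* x :+ y :* y :+ (:- (con (+ 2) :* p₁) :* x :+ :- (con (+ 2) :* p₂) :* y) in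
            e p₁′ p₂′ :- e p₁ p₂ := (con (+ 2) :* (p₁ :- p₁′)) :* x :+ (con (+ 2) :* (p₂ :- p₂′)) :* y)
            refl p₁ p₂ p₁′ p₂′ x y)
          (-ᶜ-closed (circle-equation P′∈F Q′∈F X∈′) e))
        e
      where
      e : F (x * x + y * y + (- (ι (+ 2) * p₁) * x + - (ι (+ 2) * p₂) * y))
      e = circle-equation P∈F Q∈F X∈
      centres-differ : ¬ (P ≈ᵍ P′)
      centres-differ P≈P′ = differ (concentric P≈P′ X∈ X∈′ , concentric (sym (proj₁ P≈P′) , sym (proj₂ P≈P′)) X∈′ X∈)

-- The field ℝ, and cosine and sine on it

module Analysis where

  open import Data.Rational
  open import Data.Rational.Properties
  open import Data.Rational.Solver using (module +-*-Solver)
  import Data.Rational.Unnormalised as ℚᵘ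
  import Data.Rational.Unnormalised.Properties as ℚᵘ
  open ≡ using (refl; sym; trans; cong; cong₂; subst; subst₂; module ≡-Reasoning)
  open +-*-Solver using (solve; con; _:+_; _:*_; _:-_; :-_; _:=_)

  -- The Cauchy reals as a field with stable equality

  module Reals where

    ≡⇒≃ᵣ : ∀ {x y} → (∀ n → seq x n ≡ seq y n) → x ≃ᵣ y
    ≡⇒≃ᵣ {x} {y} x≡y ε 0<ε = 0 , λ n _ → begin
      ∣ seq x n - seq y n ∣   ≡⟨ cong (λ z → ∣ z - seq y n ∣) (x≡y n) ⟩
      ∣ seq y n - seq y n ∣   ≡⟨ cong ∣_∣ (+-inverseʳ (seq y n)) ⟩
      0ℚ                      ≤⟨ <⇒≤ 0<ε ⟩
      ε                       ∎
      where open ≤-Reasoning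

    ≃ᵣ-refl : ∀ {x} → x ≃ᵣ x
    ≃ᵣ-refl {x} = ≡⇒≃ᵣ {x} {x} λ _ → refl

    ≃ᵣ-sym : ∀ {x y} → x ≃ᵣ y → y ≃ᵣ x
    ≃ᵣ-sym {x} {y} x≃y ε 0<ε with x≃y ε 0<ε
    ... | N , near = N , λ n N≤n → ≤-trans (≤-reflexive (∣p-q∣≡∣q-p∣ (seq y n) (seq x n))) (near n N≤n)

    ≤½+½ : ∀ {p q r ε} → p ≤ q + r → q ≤ ½ * ε → r ≤ ½ * ε → p ≤ ε
    ≤½+½ {ε = ε} p≤q+r q≤ r≤ = ≤-trans p≤q+r (≤-trans (+-mono-≤ q≤ r≤) (≤-reflexive (½+½ ε)))

    ≃ᵣ-trans : ∀ {x y z} → x ≃ᵣ y → y ≃ᵣ z → x ≃ᵣ z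
    ≃ᵣ-trans {x} {y} {z} x≃y y≃z ε 0<ε with x≃y (½ * ε) (0<*0< 0<½ 0<ε) | y≃z (½ * ε) (0<*0< 0<½ 0<ε)
    ... | M , f | N , g = M ℕ.⊔ N , λ n p →
      ≤½+½ (tri (seq x n) (seq y n) (seq z n)) (f n (ℕ.m⊔n≤o⇒m≤o M N p)) (g n (ℕ.m⊔n≤o⇒n≤o M N p))

    +-cong-≃ᵣ : ∀ {x y u v} → x ≃ᵣ y → u ≃ᵣ v → x +ᵣ u ≃ᵣ y +ᵣ v
    +-cong-≃ᵣ {x} {y} {u} {v} x≃y u≃v ε 0<ε with x≃y (½ * ε) (0<*0< 0<½ 0<ε) | u≃v (½ * ε) (0<*0< 0<½ 0<ε)
    ... | M , f | N , g = M ℕ.⊔ N , λ n p → let a = seq x n ; b = seq y n ; c = seq u n ; d = seq v n in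
      ≤½+½ (≤-trans (≤-reflexive (cong ∣_∣ (solve 4 (λ a b c d →
              (a :+ c) :- (b :+ d) := (a :- b) :+ (c :- d)) refl a b c d)))
            (∣p+q∣≤∣p∣+∣q∣ (a - b) (c - d)))
        (f n (ℕ.m⊔n≤o⇒m≤o M N p)) (g n (ℕ.m⊔n≤o⇒n≤o M N p))

    -‿cong-≃ : ∀ {x y} → x ≃ᵣ y → -ᵣ x ≃ᵣ -ᵣ y
    -‿cong-≃ {x} {y} x≃y ε 0<ε with x≃y ε 0<ε
    ... | N , near = N , λ n N≤n → ≤-trans (≤-reflexive (trans
      (cong ∣_∣ (solve 2 (λ a b → (:- a) :- (:- b) := b :- a) refl (seq x n) (seq y n)))
      (∣p-q∣≡∣q-p∣ (seq y n) (seq x n)))) (near n N≤n)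

    *-cong-≃ᵣ : ∀ {x y u v} → x ≃ᵣ y → u ≃ᵣ v → x *ᵣ u ≃ᵣ y *ᵣ v
    *-cong-≃ᵣ {x} {y} {u} {v} x≃y u≃v ε 0<ε =
      let (A , 0≤A , y≤A) = bounded y
          (B , 0≤B , u≤B) = bounded u
          (δ , 0<δ , Bδ≤) = shrink B 0≤B (½ * ε) (0<*0< 0<½ 0<ε)
          (η , 0<η , Aη≤) = shrink A 0≤A (½ * ε) (0<*0< 0<½ 0<ε)
          (M , f) = x≃y δ 0<δ
          (N , g) = u≃v η 0<η
      in M ℕ.⊔ N , λ n p → let a = seq x n ; b = seq y n ; c = seq u n ; d = seq v n in
      ≤½+½ (begin
        ∣ a * c - b * d ∣                       ≡⟨ cong ∣_∣ (solve 4 (λ a b c d →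
          a :* c :- b :* d := c :* (a :- b) :+ b :* (c :- d)) refl a b c d) ⟩
        ∣ c * (a - b) + b * (c - d) ∣           ≤⟨ ∣p+q∣≤∣p∣+∣q∣ (c * (a - b)) (b * (c - d)) ⟩
        ∣ c * (a - b) ∣ + ∣ b * (c - d) ∣       ≡⟨ cong₂ _+_ (∣p*q∣≡∣p∣*∣q∣ c (a - b)) (∣p*q∣≡∣p∣*∣q∣ b (c - d)) ⟩
        ∣ c ∣ * ∣ a - b ∣ + ∣ b ∣ * ∣ c - d ∣   ∎)
        (≤-trans (*-mono-≤ (0≤∣p∣ (a - b)) 0≤B (u≤B n) (f n (ℕ.m⊔n≤o⇒m≤o M N p))) Bδ≤)
        (≤-trans (*-mono-≤ (0≤∣p∣ (c - d)) 0≤A (y≤A n) (g n (ℕ.m⊔n≤o⇒n≤o M N p))) Aη≤)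
      where open ≤-Reasoning

    commutativeRing : CommutativeRing 0ℓ 0ℓ
    commutativeRing = record
      { Carrier = ℝ
      ; _≈_ = _≃ᵣ_
      ; _+_ = _+ᵣ_
      ; _*_ = _*ᵣ_
      ; -_  = -ᵣ_
      ; 0#  = fromℚ 0ℚ
      ; 1#  = fromℚ 1ℚ
      ; isCommutativeRing = record
        { isRing = record
          { +-isAbelianGroup = record
            { isGroup = record
              { isMonoid = record
                { isSemigroup = record
                  { isMagma = record
                    { isEquivalence = record
                      { refl  = λ {x} → ≃ᵣ-refl {x}
                      ; sym   = λ {x} {y} → ≃ᵣ-sym {x} {y}
                      ; trans = λ {x} {y} {z} → ≃ᵣ-trans {x} {y} {z}
                      }
                    ; ∙-cong = λ {x} {y} {u} {v} → +-cong-≃ᵣ {x} {y} {u} {v}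
                    }
                  ; assoc = λ x y z → ≡⇒≃ᵣ {(x +ᵣ y) +ᵣ z} {x +ᵣ (y +ᵣ z)} λ n → +-assoc (seq x n) (seq y n) (seq z n)
                  }
                ; identity = (λ x → ≡⇒≃ᵣ {fromℚ 0ℚ +ᵣ x} {x} λ n → +-identityˡ (seq x n))
                           , (λ x → ≡⇒≃ᵣ {x +ᵣ fromℚ 0ℚ} {x} λ n → +-identityʳ (seq x n))
                }
              ; inverse = (λ x → ≡⇒≃ᵣ { -ᵣ x +ᵣ x} {fromℚ 0ℚ} λ n → +-inverseˡ (seq x n))
                        , (λ x → ≡⇒≃ᵣ {x +ᵣ -ᵣ x} {fromℚ 0ℚ} λ n → +-inverseʳ (seq x n))
              ; ⁻¹-cong = λ {x} {y} → -‿cong-≃ {x} {y}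
              }
            ; comm = λ x y → ≡⇒≃ᵣ {x +ᵣ y} {y +ᵣ x} λ n → +-comm (seq x n) (seq y n)
            }
          ; *-cong = λ {x} {y} {u} {v} → *-cong-≃ᵣ {x} {y} {u} {v}
          ; *-assoc = λ x y z → ≡⇒≃ᵣ {(x *ᵣ y) *ᵣ z} {x *ᵣ (y *ᵣ z)} λ n → *-assoc (seq x n) (seq y n) (seq z n)
          ; *-identity = (λ x → ≡⇒≃ᵣ {fromℚ 1ℚ *ᵣ x} {x} λ n → *-identityˡ (seq x n))
                       , (λ x → ≡⇒≃ᵣ {x *ᵣ fromℚ 1ℚ} {x} λ n → *-identityʳ (seq x n))
          ; distrib =
              (λ x y z → ≡⇒≃ᵣ {x *ᵣ (y +ᵣ z)} {x *ᵣ y +ᵣ x *ᵣ z} λ n → *-distribˡ-+ (seq x n) (seq y n) (seq z n))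
            , (λ x y z → ≡⇒≃ᵣ {(y +ᵣ z) *ᵣ x} {y *ᵣ x +ᵣ z *ᵣ x} λ n → *-distribʳ-+ (seq x n) (seq y n) (seq z n))
          }
        ; *-comm = λ x y → ≡⇒≃ᵣ {x *ᵣ y} {y *ᵣ x} λ n → *-comm (seq x n) (seq y n)
        }
      }

    fromℤ : ℤ → ℚ
    fromℤ n = n / 1

    private
      toℚᵘ-fromℤ : ∀ n → toℚᵘ (fromℤ n) ℚᵘ.≃ ℚᵘ.mkℚᵘ n 0
      toℚᵘ-fromℤ n = toℚᵘ-fromℚᵘ (ℚᵘ.mkℚᵘ n 0)

    fromℤ-+ : ∀ m n → fromℤ (m ℤ.+ n) ≡ fromℤ m + fromℤ n
    fromℤ-+ m n = toℚᵘ-injective (ℚᵘ.≃-trans (toℚᵘ-fromℤ (m ℤ.+ n)) (ℚᵘ.≃-sym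
      (ℚᵘ.≃-trans (toℚᵘ-homo-+ (fromℤ m) (fromℤ n))
      (ℚᵘ.≃-trans (ℚᵘ.+-cong (toℚᵘ-fromℤ m) (toℚᵘ-fromℤ n))
      (ℚᵘ.*≡* (cong (ℤ._* + 1) (cong₂ ℤ._+_ (ℤ.*-identityʳ m) (ℤ.*-identityʳ n))))))))

    fromℤ-* : ∀ m n → fromℤ (m ℤ.* n) ≡ fromℤ m * fromℤ n
    fromℤ-* m n = toℚᵘ-injective (ℚᵘ.≃-trans (toℚᵘ-fromℤ (m ℤ.* n)) (ℚᵘ.≃-sym
      (ℚᵘ.≃-trans (toℚᵘ-homo-* (fromℤ m) (fromℤ n)) (ℚᵘ.*-cong (toℚᵘ-fromℤ m) (toℚᵘ-fromℤ n)))))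

    fromℤ-neg : ∀ n → fromℤ (ℤ.- n) ≡ - fromℤ n
    fromℤ-neg n = toℚᵘ-injective (ℚᵘ.≃-trans (toℚᵘ-fromℤ (ℤ.- n)) (ℚᵘ.≃-sym
      (ℚᵘ.≃-trans (toℚᵘ-homo‿- (fromℤ n)) (ℚᵘ.-‿cong (toℚᵘ-fromℤ n)))))

    fromℤ-injective : ∀ {n} → fromℤ n ≡ 0ℚ → n ≡ + 0
    fromℤ-injective {n} eq with ℚᵘ.≃-trans (ℚᵘ.≃-sym (toℚᵘ-fromℤ n)) (ℚᵘ.≃-reflexive (cong toℚᵘ eq))
    ... | ℚᵘ.*≡* n*1≡0 = trans (sym (ℤ.*-identityʳ n)) n*1≡0

    integers : IntegerHom commutativeRing
    integers = record
      { ⟦_⟧    = λ n → fromℚ (fromℤ n)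
      ; +-homo = λ m n → ≡⇒≃ᵣ {fromℚ (fromℤ (m ℤ.+ n))} {fromℚ (fromℤ m) +ᵣ fromℚ (fromℤ n)} λ _ → fromℤ-+ m n
      ; *-homo = λ m n → ≡⇒≃ᵣ {fromℚ (fromℤ (m ℤ.* n))} {fromℚ (fromℤ m) *ᵣ fromℚ (fromℤ n)} λ _ → fromℤ-* m n
      ; -‿homo = λ n → ≡⇒≃ᵣ {fromℚ (fromℤ (ℤ.- n))} { -ᵣ fromℚ (fromℤ n)} λ _ → fromℤ-neg n
      ; 0-homo = ≃ᵣ-refl {fromℚ 0ℚ}
      ; 1-homo = ≃ᵣ-refl {fromℚ 1ℚ}
      }

    ½*ε<ε : ∀ {ε} → 0ℚ < ε → ½ * ε < ε
    ½*ε<ε {ε} 0<ε = subst₂ _<_ (+-identityʳ (½ * ε)) (½+½ ε) (+-monoʳ-< (½ * ε) (0<*0< 0<½ 0<ε))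

    ≃ᵣ⇒≡ : ∀ {p q} → fromℚ p ≃ᵣ fromℚ q → p ≡ q
    ≃ᵣ⇒≡ {p} {q} p≃q with ∣ p - q ∣ ≤? 0ℚ
    ... | yes ≤0 = trans (solve 2 (λ p q → p := (p :- q) :+ q) refl p q)
      (trans (cong (_+ q) (∣p∣≡0⇒p≡0 (p - q) (≤-antisym ≤0 (0≤∣p∣ (p - q))))) (+-identityˡ q))
    ... | no ≰0 with p≃q (½ * ∣ p - q ∣) (0<*0< 0<½ (≰⇒> ≰0))
    ...   | N , near = contradiction (<-≤-trans (½*ε<ε (≰⇒> ≰0)) (near N ℕ.≤-refl)) (<-irrefl refl)

    -- Apartness from 0, the positive form of being nonzero, from which an inverse can be computed.
    Separated : ℝ → Set
    Separated x = ∃₂ λ ε N → 0ℚ < ε × (∀ n → N ℕ.≤ n → ε ≤ ∣ seq x n ∣)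

    ∣p∣≤∣p-q∣+∣q∣ : ∀ p q → ∣ p ∣ ≤ ∣ p - q ∣ + ∣ q ∣
    ∣p∣≤∣p-q∣+∣q∣ p q = subst (λ z → ∣ z ∣ ≤ ∣ p - q ∣ + ∣ q ∣)
      (solve 2 (λ p q → (p :- q) :+ q := p) refl p q) (∣p+q∣≤∣p∣+∣q∣ (p - q) q)

    -- The alternatives overlap, so a single comparison of rationals decides: the entry at an index
    -- past which the sequence moves by at most `¼ ε` is tested against `½ ε`.
    small-or-separated : ∀ x ε → 0ℚ < ε → (∃ λ N → ∀ n → N ℕ.≤ n → ∣ seq x n ∣ ≤ ε) ⊎ Separated x
    small-or-separated x ε 0<ε with cauchy x (½ * (½ * ε)) (0<*0< 0<½ (0<*0< 0<½ 0<ε))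
    ... | N , near with ∣ seq x N ∣ ≤? ½ * ε
    ... | yes ≤½ε = inj₁ (N , λ n N≤n → ≤½+½ (∣p∣≤∣p-q∣+∣q∣ (seq x n) (seq x N))
            (≤-trans (near n N N≤n ℕ.≤-refl) ¼≤½) ≤½ε)
      where
      ¼≤½ : ½ * (½ * ε) ≤ ½ * ε
      ¼≤½ = ≤-trans (p≤p+q (<⇒≤ (0<*0< 0<½ (0<*0< 0<½ 0<ε)))) (≤-reflexive (½+½ (½ * ε)))
    ... | no ≰½ε = inj₂ (¼ε , N , 0<*0< 0<½ (0<*0< 0<½ 0<ε) , λ n N≤n → ≮⇒≥ λ xₙ<¼ε →
            ≰½ε (≤½+½ (∣p∣≤∣p-q∣+∣q∣ (seq x N) (seq x n)) (near N n ℕ.≤-refl N≤n) (<⇒≤ xₙ<¼ε)))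
      where
      ¼ε = ½ * (½ * ε)

    separated⇒≄ : ∀ {x y} → Separated (x -ᵣ y) → ¬ (x ≃ᵣ y)
    separated⇒≄ {x} {y} (ε , N , 0<ε , apart) x≃y with x≃y (½ * ε) (0<*0< 0<½ 0<ε)
    ... | M , near = contradiction
      (<-≤-trans (½*ε<ε 0<ε) (≤-trans (apart (N ℕ.⊔ M) (ℕ.m≤m⊔n N M)) (near (N ℕ.⊔ M) (ℕ.m≤n⊔m N M))))
      (<-irrefl refl)

    -- For every `ε` the separated alternative is refuted, and the other one supplies the index.
    ≃ᵣ-stable : ∀ {x y} → ¬ ¬ (x ≃ᵣ y) → x ≃ᵣ y
    ≃ᵣ-stable {x} {y} ¬¬x≃y ε 0<ε =
      [ (λ small → small) , (λ sep → contradiction (separated⇒≄ {x} {y} sep) ¬¬x≃y) ]′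
      (small-or-separated (x -ᵣ y) ε 0<ε)

    ≄⇒separated : ∀ {x} → ¬ (x ≃ᵣ fromℚ 0ℚ) → ¬ ¬ Separated x
    ≄⇒separated {x} x≄0 ¬sep = x≄0 (λ ε 0<ε → [ shifted ε , (λ sep → contradiction sep ¬sep) ]′ (small-or-separated x ε 0<ε))
      where
      shifted : ∀ ε → (∃ λ N → ∀ n → N ℕ.≤ n → ∣ seq x n ∣ ≤ ε) → ∃ λ N → ∀ n → N ℕ.≤ n → ∣ seq x n - 0ℚ ∣ ≤ ε
      shifted ε (N , small) = N , λ n N≤n → subst (λ z → ∣ z ∣ ≤ ε) (sym (+-identityʳ (seq x n))) (small n N≤n)

    -- inv 0 = 0.
    inv : ℚ → ℚ
    inv p with p ≟ 0ℚ
    ... | yes _  = 0ℚ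
    ... | no p≢0 = (1/ p) {{≢-nonZero p≢0}}

    inv-inverse : ∀ {p ε} → 0ℚ < ε → ε ≤ ∣ p ∣ → p * inv p ≡ 1ℚ
    inv-inverse {p} 0<ε ε≤∣p∣ with p ≟ 0ℚ
    ... | yes refl = contradiction (<-≤-trans 0<ε ε≤∣p∣) (<-irrefl refl)
    ... | no  p≢0  = *-inverseʳ p {{≢-nonZero p≢0}}

    inv-bound : ∀ {p ε} → 0ℚ < ε → ε ≤ ∣ p ∣ → ∣ inv p ∣ ≤ inv ε
    inv-bound {p} {ε} 0<ε ε≤∣p∣ = *-cancelˡ-≤-pos ε {{positive 0<ε}} (begin
      ε * ∣ inv p ∣         ≤⟨ *-monoʳ-≤-nonNeg ∣ inv p ∣ {{≥0 (0≤∣p∣ (inv p))}} ε≤∣p∣ ⟩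
      ∣ p ∣ * ∣ inv p ∣     ≡⟨ sym (∣p*q∣≡∣p∣*∣q∣ p (inv p)) ⟩
      ∣ p * inv p ∣         ≡⟨ cong ∣_∣ (inv-inverse 0<ε ε≤∣p∣) ⟩
      1ℚ                    ≡⟨ sym (inv-inverse {ε} 0<ε (≤-reflexive (sym (0≤p⇒∣p∣≡p (<⇒≤ 0<ε))))) ⟩
      ε * inv ε             ∎)
      where open ≤-Reasoning

    -- From index `N` on, `1/a - 1/b = (1/a) (1/b) (b - a)` with both inverses at most `1/ε` in
    -- absolute value, so the inverted sequence is Cauchy. The default value of `inv` can occur only
    -- before `N`.
    inverse : ∀ x → Separated x → ∃ λ y → x *ᵣ y ≃ᵣ fromℚ 1ℚ
    inverse x (ε , N , 0<ε , apart) = y , λ δ 0<δ → N , λ n N≤n → begin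
        ∣ seq x n * inv (seq x n) - 1ℚ ∣   ≡⟨ cong (λ z → ∣ z - 1ℚ ∣) (inv-inverse 0<ε (apart n N≤n)) ⟩
        0ℚ                                 ≤⟨ <⇒≤ 0<δ ⟩
        δ                                  ∎
      where
      open ≤-Reasoning
      E = inv ε
      0≤E : 0ℚ ≤ E
      0≤E = ≤-trans (0≤∣p∣ (inv (seq x N))) (inv-bound 0<ε (apart N ℕ.≤-refl))
      inv-cauchy : IsCauchy (λ n → inv (seq x n))
      inv-cauchy δ 0<δ =
        let (η , 0<η , EEη≤δ) = shrink (E * E) (0≤*0≤ 0≤E 0≤E) δ 0<δ
            (M , near) = cauchy x η 0<η
        in N ℕ.⊔ M , λ m n p q → let
            a = seq x m ; b = seq x n
            ε≤a = apart m (ℕ.m⊔n≤o⇒m≤o N M p) ; ε≤b = apart n (ℕ.m⊔n≤o⇒m≤o N M q) in begin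
          ∣ inv a - inv b ∣                       ≡⟨ cong ∣_∣ (difference a b (inv-inverse 0<ε ε≤a) (inv-inverse 0<ε ε≤b)) ⟩
          ∣ inv a * inv b * (b - a) ∣             ≡⟨ trans (∣p*q∣≡∣p∣*∣q∣ (inv a * inv b) (b - a))
                                                       (cong (_* ∣ b - a ∣) (∣p*q∣≡∣p∣*∣q∣ (inv a) (inv b))) ⟩
          ∣ inv a ∣ * ∣ inv b ∣ * ∣ b - a ∣       ≤⟨ *-mono-≤ (0≤∣p∣ (b - a)) (0≤*0≤ 0≤E 0≤E)
            (*-mono-≤ (0≤∣p∣ (inv b)) 0≤E (inv-bound 0<ε ε≤a) (inv-bound 0<ε ε≤b))
            (near n m (ℕ.m⊔n≤o⇒n≤o N M q) (ℕ.m⊔n≤o⇒n≤o N M p)) ⟩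
          E * E * η                               ≤⟨ EEη≤δ ⟩
          δ                                       ∎
        where
        difference : ∀ a b → a * inv a ≡ 1ℚ → b * inv b ≡ 1ℚ → inv a - inv b ≡ inv a * inv b * (b - a)
        difference a b aA≡1 bB≡1 = sym (trans
          (solve 4 (λ a b A B → A :* B :* (b :- a) := A :* (b :* B) :- B :* (a :* A))
            refl a b (inv a) (inv b))
          (cong₂ _-_ (trans (cong (inv a *_) bB≡1) (*-identityʳ (inv a)))
                     (trans (cong (inv b *_) aA≡1) (*-identityʳ (inv b)))))
      y : ℝ
      y = mkℝ (λ n → inv (seq x n)) inv-cauchy

    p*p≡∣p∣*∣p∣ : ∀ p → p * p ≡ ∣ p ∣ * ∣ p ∣
    p*p≡∣p∣*∣p∣ p with ∣p∣≡p∨∣p∣≡-p p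
    ... | inj₁ eq = sym (cong₂ _*_ eq eq)
    ... | inj₂ eq = sym (trans (cong₂ _*_ eq eq) (solve 1 (λ p → (:- p) :* (:- p) := p :* p) refl p))

    0≤p*p : ∀ p → 0ℚ ≤ p * p
    0≤p*p p = subst (0ℚ ≤_) (sym (p*p≡∣p∣*∣p∣ p)) (0≤*0≤ (0≤∣p∣ p) (0≤∣p∣ p))

    p*p≤ε*ε⇒∣p∣≤ε : ∀ {p ε} → 0ℚ < ε → p * p ≤ ε * ε → ∣ p ∣ ≤ ε
    p*p≤ε*ε⇒∣p∣≤ε {p} {ε} 0<ε pp≤εε = ≮⇒≥ λ ε<∣p∣ → <-irrefl refl (begin-strict
      ε * ε             <⟨ *-monoʳ-<-pos ε {{positive 0<ε}} ε<∣p∣ ⟩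
      ε * ∣ p ∣         ≤⟨ *-monoʳ-≤-nonNeg ∣ p ∣ {{≥0 (0≤∣p∣ p)}} (<⇒≤ ε<∣p∣) ⟩
      ∣ p ∣ * ∣ p ∣     ≡⟨ sym (p*p≡∣p∣*∣p∣ p) ⟩
      p * p             ≤⟨ pp≤εε ⟩
      ε * ε             ∎)
      where open ≤-Reasoning

    sum-of-squares : ∀ {x y} → x *ᵣ x +ᵣ y *ᵣ y ≃ᵣ fromℚ 0ℚ → x ≃ᵣ fromℚ 0ℚ
    sum-of-squares {x} {y} eq ε 0<ε with eq (ε * ε) (0<*0< 0<ε 0<ε)
    ... | N , near = N , λ n N≤n → let a = seq x n ; b = seq y n in
      subst (λ z → ∣ z ∣ ≤ ε) (sym (+-identityʳ a)) (p*p≤ε*ε⇒∣p∣≤ε {a} 0<ε (begin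
        a * a                        ≤⟨ p≤p+q (0≤p*p b) ⟩
        a * a + b * b                ≡⟨ sym (0≤p⇒∣p∣≡p (0≤+0≤ (0≤p*p a) (0≤p*p b))) ⟩
        ∣ a * a + b * b ∣            ≡⟨ cong ∣_∣ (sym (+-identityʳ (a * a + b * b))) ⟩
        ∣ a * a + b * b - 0ℚ ∣       ≤⟨ near n N≤n ⟩
        ε * ε                        ∎))
      where open ≤-Reasoning

    realField : StableField
    realField = record
      { commutativeRing  = commutativeRing
      ; integers         = integers
      ; stable           = λ {x} {y} → ≃ᵣ-stable {x} {y}
      ; invertible       = λ {x} x≄0 ¬∃ → ≄⇒separated {x} x≄0 λ sep → ¬∃ (inverse x sep)
      ; characteristic-0 = λ n≃0 → fromℤ-injective (≃ᵣ⇒≡ n≃0)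
      ; formally-real    = λ {x} {y} → sum-of-squares {x} {y}
      }

  -- Finite double sums and the Cauchy product

  module DoubleSums where

    sum : (ℕ → ℚ) → ℕ → ℚ
    sum f zero    = 0ℚ
    sum f (suc n) = sum f n + f n

    -- diagonal g n = Σ_{i+j=n} g i j
    diagonal : (ℕ → ℕ → ℚ) → ℕ → ℚ
    diagonal g zero    = g 0 0
    diagonal g (suc n) = g 0 (suc n) + diagonal (λ i → g (suc i)) n

    -- triangle n g = Σ_{i+j<n} g i j
    triangle : ℕ → (ℕ → ℕ → ℚ) → ℚ
    triangle zero    g = 0ℚ
    triangle (suc n) g = sum (g 0) (suc n) + triangle n (λ i → g (suc i))

    rectangle : ℕ → ℕ → (ℕ → ℕ → ℚ) → ℚ
    rectangle zero    n g = 0ℚ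
    rectangle (suc m) n g = sum (g 0) n + rectangle m n (λ i → g (suc i))

    sum-cong : ∀ {f g : ℕ → ℚ} → (∀ i → f i ≡ g i) → ∀ n → sum f n ≡ sum g n
    sum-cong f≡g zero    = refl
    sum-cong f≡g (suc n) = cong₂ _+_ (sum-cong f≡g n) (f≡g n)

    sum-shift : ∀ f n → sum f (suc n) ≡ f 0 + sum (λ i → f (suc i)) n
    sum-shift f zero    = +-comm 0ℚ (f 0)
    sum-shift f (suc n) = trans (cong (_+ f (suc n)) (sum-shift f n)) (+-assoc (f 0) _ (f (suc n)))

    diagonal-cong : ∀ {g h : ℕ → ℕ → ℚ} → (∀ i j → g i j ≡ h i j) → ∀ n → diagonal g n ≡ diagonal h n
    diagonal-cong g≡h zero    = g≡h 0 0
    diagonal-cong g≡h (suc n) = cong₂ _+_ (g≡h 0 (suc n)) (diagonal-cong (λ i → g≡h (suc i)) n)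

    diagonal-+ : ∀ g h n → diagonal (λ i j → g i j + h i j) n ≡ diagonal g n + diagonal h n
    diagonal-+ g h zero    = refl
    diagonal-+ g h (suc n) = trans
        (cong (λ z → g 0 (suc n) + h 0 (suc n) + z) (diagonal-+ (λ i → g (suc i)) (λ i → h (suc i)) n))
      (solve 4 (λ a b c d → (a :+ b) :+ (c :+ d) := (a :+ c) :+ (b :+ d)) refl
        (g 0 (suc n)) (h 0 (suc n)) (diagonal (λ i → g (suc i)) n) (diagonal (λ i → h (suc i)) n))

    -- Along the diagonal `i + j` is constantly `n`.
    diagonal-weight : ∀ (h : ℕ → ℚ) g n → diagonal (λ i j → h (i ℕ.+ j) * g i j) n ≡ h n * diagonal g n
    diagonal-weight h g zero    = refl
    diagonal-weight h g (suc n) = trans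
      (cong (λ z → h (suc n) * g 0 (suc n) + z) (diagonal-weight (λ k → h (suc k)) (λ i → g (suc i)) n))
      (sym (*-distribˡ-+ (h (suc n)) (g 0 (suc n)) _))

    diagonal-last : ∀ g n → diagonal g (suc n) ≡ diagonal (λ i j → g i (suc j)) n + g (suc n) 0
    diagonal-last g zero    = refl
    diagonal-last g (suc n) = trans (cong (λ z → g 0 (suc (suc n)) + z) (diagonal-last (λ i → g (suc i)) n))
      (sym (+-assoc (g 0 (suc (suc n))) _ _))

    -- `triangle` is defined row by row; this reads it by antidiagonals, the form to which
    -- `binomial` applies.
    triangle-suc : ∀ g n → triangle (suc n) g ≡ triangle n g + diagonal g n
    triangle-suc g zero    = solve 1 (λ a → (con 0ℚ :+ a) :+ con 0ℚ := con 0ℚ :+ a) refl (g 0 0)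
    triangle-suc g (suc n) = trans (cong (λ z → sum (g 0) (suc (suc n)) + z) (triangle-suc (λ i → g (suc i)) n))
      (solve 4 (λ a b c d → (a :+ b) :+ (c :+ d) := (a :+ c) :+ (b :+ d)) refl
        (sum (g 0) (suc n)) (g 0 (suc n)) (triangle n (λ i → g (suc i))) (diagonal (λ i → g (suc i)) n))

    rectangle-cong : ∀ {g h : ℕ → ℕ → ℚ} → (∀ i j → g i j ≡ h i j) → ∀ m n → rectangle m n g ≡ rectangle m n h
    rectangle-cong g≡h zero    n = refl
    rectangle-cong g≡h (suc m) n = cong₂ _+_ (sum-cong (g≡h 0) n) (rectangle-cong (λ i → g≡h (suc i)) m n)

    -- Both addition formulas have this shape, with `σ` equal to -1 for cosine and to 1 for sine.
    rectangle-product : ∀ (p q r s : ℕ → ℚ) σ m n →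
      rectangle m n (λ i j → p i * q j + σ * (r i * s j)) ≡ sum p m * sum q n + σ * (sum r m * sum s n)
    rectangle-product p q r s σ zero n = solve 3 (λ σ a b →
      con 0ℚ := con 0ℚ :* a :+ σ :* (con 0ℚ :* b)) refl σ (sum q n) (sum s n)
    rectangle-product p q r s σ (suc m) n = trans
      (cong₂ _+_ (row n) (rectangle-product (λ i → p (suc i)) q (λ i → r (suc i)) s σ m n)) (trans
      (solve 7 (λ p₀ r₀ σ P Q R S →
        (p₀ :* Q :+ σ :* (r₀ :* S)) :+ (P :* Q :+ σ :* (R :* S)) :=
        (p₀ :+ P) :* Q :+ σ :* ((r₀ :+ R) :* S)) refl
        (p 0) (r 0) σ (sum (λ i → p (suc i)) m) (sum q n) (sum (λ i → r (suc i)) m) (sum s n))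
      (sym (cong₂ (λ P R → P * sum q n + σ * (R * sum s n)) (sum-shift p m) (sum-shift r m))))
      where
      row : ∀ n → sum (λ j → p 0 * q j + σ * (r 0 * s j)) n ≡ p 0 * sum q n + σ * (r 0 * sum s n)
      row zero    = solve 3 (λ a b σ → con 0ℚ := a :* con 0ℚ :+ σ :* (b :* con 0ℚ)) refl (p 0) (r 0) σ
      row (suc n) = trans (cong (_+ (p 0 * q n + σ * (r 0 * s n))) (row n))
        (solve 7 (λ p₀ r₀ σ Q S q s →
          (p₀ :* Q :+ σ :* (r₀ :* S)) :+ (p₀ :* q :+ σ :* (r₀ :* s)) :=
          p₀ :* (Q :+ q) :+ σ :* (r₀ :* (S :+ s))) refl (p 0) (r 0) σ (sum q n) (sum s n) (q n) (s n))

    module Majorised {g G : ℕ → ℕ → ℚ} (g≤G : ∀ i j → ∣ g i j ∣ ≤ G i j) where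

      sum-tail : ∀ i {m n} → m ℕ.≤′ n → ∣ sum (g i) n - sum (g i) m ∣ ≤ sum (G i) n - sum (G i) m
      sum-tail i {m} ℕ.≤′-refl = ≤-reflexive (trans (cong ∣_∣ (+-inverseʳ (sum (g i) m))) (sym (+-inverseʳ (sum (G i) m))))
      sum-tail i {m} (ℕ.≤′-step {n} m≤n) = begin
        ∣ sum (g i) n + g i n - sum (g i) m ∣          ≡⟨ cong ∣_∣ (swap (sum (g i) n) (g i n) (sum (g i) m)) ⟩
        ∣ (sum (g i) n - sum (g i) m) + g i n ∣        ≤⟨ ∣p+q∣≤∣p∣+∣q∣ (sum (g i) n - sum (g i) m) (g i n) ⟩
        ∣ sum (g i) n - sum (g i) m ∣ + ∣ g i n ∣      ≤⟨ +-mono-≤ (sum-tail i m≤n) (g≤G i n) ⟩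
        (sum (G i) n - sum (G i) m) + G i n            ≡⟨ sym (swap (sum (G i) n) (G i n) (sum (G i) m)) ⟩
        sum (G i) n + G i n - sum (G i) m              ∎
        where
        open ≤-Reasoning
        swap : ∀ a t b → a + t - b ≡ (a - b) + t
        swap = solve 3 (λ a t b → a :+ t :- b := (a :- b) :+ t) refl

    -- As `m ≤ n`, the triangle lies inside the rectangle, and the difference is a sum over the
    -- remaining pairs, where `G` dominates `g` term by term.
    rectangle-triangle : ∀ {g G} → (∀ i j → ∣ g i j ∣ ≤ G i j) → ∀ {m n} → m ℕ.≤ n →
      ∣ rectangle m n g - triangle m g ∣ ≤ rectangle m n G - triangle m G
    rectangle-triangle g≤G {zero}          m≤n = ≤-refl
    rectangle-triangle {g} {G} g≤G {suc m} {n} m<n = begin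
      ∣ (a + r) - (b + t) ∣               ≡⟨ cong ∣_∣ (regroup a r b t) ⟩
      ∣ (a - b) + (r - t) ∣               ≤⟨ ∣p+q∣≤∣p∣+∣q∣ (a - b) (r - t) ⟩
      ∣ a - b ∣ + ∣ r - t ∣               ≤⟨ +-mono-≤ (Majorised.sum-tail g≤G 0 (ℕ.≤⇒≤′ m<n))
                                               (rectangle-triangle (λ i → g≤G (suc i)) (ℕ.<⇒≤ m<n)) ⟩
      (A - B) + (R - T)                   ≡⟨ sym (regroup A R B T) ⟩
      (A + R) - (B + T)                   ∎
      where
      open ≤-Reasoning
      a b r t A B R T : ℚ
      a = sum (g 0) n
      b = sum (g 0) (suc m)
      r = rectangle m n (λ i → g (suc i))
      t = triangle m (λ i → g (suc i))
      A = sum (G 0) n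
      B = sum (G 0) (suc m)
      R = rectangle m n (λ i → G (suc i))
      T = triangle m (λ i → G (suc i))
      regroup : ∀ a r b t → (a + r) - (b + t) ≡ (a - b) + (r - t)
      regroup = solve 4 (λ a r b t → (a :+ r) :- (b :+ t) := (a :- b) :+ (r :- t)) refl

    sum-mono : ∀ {f} → (∀ i → 0ℚ ≤ f i) → ∀ {m n} → m ℕ.≤′ n → sum f m ≤ sum f n
    sum-mono 0≤f ℕ.≤′-refl           = ≤-refl
    sum-mono 0≤f (ℕ.≤′-step {n} m≤n) = ≤-trans (sum-mono 0≤f m≤n) (p≤p+q (0≤f n))

    -- `i < m` and `j < n` give `i + j < m + n`, and the additional terms are nonnegative.
    rectangle≤triangle : ∀ {G} → (∀ i j → 0ℚ ≤ G i j) → ∀ m n → rectangle m n G ≤ triangle (m ℕ.+ n) G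
    rectangle≤triangle 0≤G zero zero = ≤-refl
    rectangle≤triangle {G} 0≤G zero (suc n) = ≤-trans (rectangle≤triangle (λ i → 0≤G (suc i)) zero n)
      (p≤q+p (sum-mono (0≤G 0) (ℕ.≤⇒≤′ (ℕ.z≤n {suc n}))))
    rectangle≤triangle 0≤G (suc m) n =
      +-mono-≤ (sum-mono (0≤G 0) (ℕ.≤⇒≤′ (ℕ.m≤n⇒m≤1+n (ℕ.m≤n+m n m)))) (rectangle≤triangle (λ i → 0≤G (suc i)) m n)

  -- Addition formulas for power series

  module Addition where

    open DoubleSums
    open Series

    fromℕ-cancel : ∀ n {p q} → fromℕ (suc n) * p ≡ fromℕ (suc n) * q → p ≡ q
    fromℕ-cancel n eq = ≤-antisym (cancel-suc n (≤-reflexive eq)) (cancel-suc n (≤-reflexive (sym eq)))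

    expTerms : ℚ → ℚ → ℕ → ℕ → ℚ
    expTerms x y i j = expTerm i x * expTerm j y

    -- The binomial theorem divided by `n !`. Multiplying by `suc n = i + j` splits each term in
    -- two; in each half `expTerm-suc` lowers one index, which leaves `x + y` times the previous
    -- diagonal.
    binomial : ∀ x y n → diagonal (expTerms x y) n ≡ expTerm n (x + y)
    binomial x y zero    = refl
    binomial x y (suc n) = fromℕ-cancel n (begin
      fromℕ (suc n) * diagonal t (suc n)
        ≡⟨ sym (diagonal-weight fromℕ t (suc n)) ⟩
      diagonal (λ i j → fromℕ (i ℕ.+ j) * t i j) (suc n)
        ≡⟨ diagonal-cong (λ i j → trans (cong (_* t i j) (fromℕ-+ i j)) (*-distribʳ-+ (t i j) (fromℕ i) (fromℕ j))) (suc n) ⟩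
      diagonal (λ i j → fromℕ i * t i j + fromℕ j * t i j) (suc n)
        ≡⟨ diagonal-+ (λ i j → fromℕ i * t i j) (λ i j → fromℕ j * t i j) (suc n) ⟩
      diagonal (λ i j → fromℕ i * t i j) (suc n) + diagonal (λ i j → fromℕ j * t i j) (suc n)
        ≡⟨ cong₂ _+_ left right ⟩
      x * diagonal t n + y * diagonal t n
        ≡⟨ sym (*-distribʳ-+ (diagonal t n) x y) ⟩
      (x + y) * diagonal t n
        ≡⟨ cong ((x + y) *_) (binomial x y n) ⟩
      (x + y) * expTerm n (x + y)
        ≡⟨ sym (expTerm-suc n (x + y)) ⟩
      fromℕ (suc n) * expTerm (suc n) (x + y) ∎)
      where
      open ≡-Reasoning
      t : ℕ → ℕ → ℚ
      t = expTerms x y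
      left : diagonal (λ i j → fromℕ i * t i j) (suc n) ≡ x * diagonal t n
      left = begin
        0ℚ * t 0 (suc n) + diagonal (λ i j → fromℕ (suc i) * t (suc i) j) n
          ≡⟨ trans (cong (_+ diagonal (λ i j → fromℕ (suc i) * t (suc i) j) n) (*-zeroˡ (t 0 (suc n)))) (+-identityˡ _) ⟩
        diagonal (λ i j → fromℕ (suc i) * t (suc i) j) n
          ≡⟨ diagonal-cong (λ i j → trans (sym (*-assoc (fromℕ (suc i)) (expTerm (suc i) x) (expTerm j y)))
               (trans (cong (_* expTerm j y) (expTerm-suc i x)) (*-assoc x (expTerm i x) (expTerm j y)))) n ⟩
        diagonal (λ i j → x * t i j) n
          ≡⟨ diagonal-weight (λ _ → x) t n ⟩
        x * diagonal t n ∎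
      right : diagonal (λ i j → fromℕ j * t i j) (suc n) ≡ y * diagonal t n
      right = begin
        diagonal (λ i j → fromℕ j * t i j) (suc n)
          ≡⟨ diagonal-last (λ i j → fromℕ j * t i j) n ⟩
        diagonal (λ i j → fromℕ (suc j) * t i (suc j)) n + 0ℚ * t (suc n) 0
          ≡⟨ trans (cong (λ z → diagonal (λ i j → fromℕ (suc j) * t i (suc j)) n + z) (*-zeroˡ (t (suc n) 0))) (+-identityʳ _) ⟩
        diagonal (λ i j → fromℕ (suc j) * t i (suc j)) n
          ≡⟨ diagonal-cong (λ i j → trans (exchange (fromℕ (suc j)) (expTerm i x) (expTerm (suc j) y))
               (trans (cong (expTerm i x *_) (expTerm-suc j y)) (sym (exchange y (expTerm i x) (expTerm j y))))) n ⟩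
        diagonal (λ i j → y * t i j) n
          ≡⟨ diagonal-weight (λ _ → y) t n ⟩
        y * diagonal t n ∎
        where
        exchange : ∀ a b c → a * (b * c) ≡ b * (a * c)
        exchange = solve 3 (λ a b c → a :* (b :* c) := b :* (a :* c)) refl

    triangle-partialSum : ∀ c x y n →
      triangle n (λ i j → c (i ℕ.+ j) * expTerms x y i j) ≡ partialSum c n (x + y)
    triangle-partialSum c x y zero    = refl
    triangle-partialSum c x y (suc n) = trans (triangle-suc (λ i j → c (i ℕ.+ j) * expTerms x y i j) n)
      (cong₂ _+_ (triangle-partialSum c x y n)
        (trans (diagonal-weight c (expTerms x y) n) (cong (c n *_) (binomial x y n))))

    sum-partialSum : ∀ c x n → sum (λ k → c k * expTerm k x) n ≡ partialSum c n x
    sum-partialSum c x zero    = refl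
    sum-partialSum c x (suc n) = cong (_+ c n * expTerm n x) (sum-partialSum c x n)

    module _ (c : ℕ → ℚ) (c≤1 : ∀ k → ∣ c k ∣ ≤ 1ℚ) (B : ℚ) (0≤B : 0ℚ ≤ B) where

      private
        module I  = OnInterval B 0≤B
        module I² = OnInterval (B + B) (0≤+0≤ 0≤B 0≤B)

      triangle-E : ∀ n → triangle n (expTerms B B) ≡ I².E n
      triangle-E zero    = refl
      triangle-E (suc n) = trans (triangle-suc (expTerms B B) n) (cong₂ _+_ (triangle-E n) (binomial B B n))

      -- The error of passing from the triangle to the square is dominated by the same error for exp
      -- `B` times exp `B`. There the square fits into the triangle of size `n + n`, so the error is
      -- at most a tail of the series for exp `(B + B)`, the one that `I²` describes.
      square-close : ∀ {x y} → ∣ x ∣ ≤ B → ∣ y ∣ ≤ B → ∀ {n} → I².K ℕ.≤ n →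
        ∣ rectangle n n (λ i j → c (i ℕ.+ j) * expTerms x y i j) - partialSum c n (x + y) ∣ ≤ I².e n + I².e n
      square-close {x} {y} x≤B y≤B {n} K≤n = begin
        ∣ rectangle n n g - partialSum c n (x + y) ∣
          ≡⟨ cong (λ z → ∣ rectangle n n g - z ∣) (sym (triangle-partialSum c x y n)) ⟩
        ∣ rectangle n n g - triangle n g ∣
          ≤⟨ rectangle-triangle g≤G {n} ℕ.≤-refl ⟩
        rectangle n n G - triangle n G
          ≤⟨ +-monoˡ-≤ (- triangle n G) (rectangle≤triangle 0≤G n n) ⟩
        triangle (n ℕ.+ n) G - triangle n G
          ≡⟨ cong₂ _-_ (triangle-E (n ℕ.+ n)) (triangle-E n) ⟩
        I².E (n ℕ.+ n) - I².E n
          ≤⟨ I².tail≤ K≤n (ℕ.m≤m+n n n) ⟩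
        I².e n + I².e n ∎
        where
        open ≤-Reasoning
        g G : ℕ → ℕ → ℚ
        g i j = c (i ℕ.+ j) * expTerms x y i j
        G = expTerms B B
        0≤G : ∀ i j → 0ℚ ≤ G i j
        0≤G i j = 0≤*0≤ (I.0≤e i) (I.0≤e j)
        g≤G : ∀ i j → ∣ g i j ∣ ≤ G i j
        g≤G i j = I.Sum.scaled≤ c c≤1 (i ℕ.+ j) (≤-trans (≤-reflexive (∣p*q∣≡∣p∣*∣q∣ (expTerm i x) (expTerm j y)))
          (*-mono-≤ (0≤∣p∣ (expTerm j y)) (I.0≤e i) (I.term≤ i x≤B) (I.term≤ j y≤B)))

    module Formula (c p q r s : ℕ → ℚ) (σ : ℚ) (c≤1 : ∀ k → ∣ c k ∣ ≤ 1ℚ)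
                   (c-+ : ∀ i j → c (i ℕ.+ j) ≡ p i * q j + σ * (r i * s j)) where

      rectangle-partialSums : ∀ x y n → rectangle n n (λ i j → c (i ℕ.+ j) * expTerms x y i j) ≡
        partialSum p n x * partialSum q n y + σ * (partialSum r n x * partialSum s n y)
      rectangle-partialSums x y n = begin
        rectangle n n (λ i j → c (i ℕ.+ j) * expTerms x y i j)
          ≡⟨ rectangle-cong (λ i j → trans (cong (_* expTerms x y i j) (c-+ i j))
               (distribute (p i) (q j) (r i) (s j) (expTerm i x) (expTerm j y))) n n ⟩
        rectangle n n (λ i j → (p i * expTerm i x) * (q j * expTerm j y) + σ * ((r i * expTerm i x) * (s j * expTerm j y)))
          ≡⟨ rectangle-product (λ i → p i * expTerm i x) (λ j → q j * expTerm j y)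
               (λ i → r i * expTerm i x) (λ j → s j * expTerm j y) σ n n ⟩
        sum (λ i → p i * expTerm i x) n * sum (λ j → q j * expTerm j y) n +
          σ * (sum (λ i → r i * expTerm i x) n * sum (λ j → s j * expTerm j y) n)
          ≡⟨ cong₂ (λ u v → u + σ * v) (cong₂ _*_ (sum-partialSum p x n) (sum-partialSum q y n))
                                       (cong₂ _*_ (sum-partialSum r x n) (sum-partialSum s y n)) ⟩
        partialSum p n x * partialSum q n y + σ * (partialSum r n x * partialSum s n y) ∎
        where
        open ≡-Reasoning
        distribute : ∀ p q r s a b → (p * q + σ * (r * s)) * (a * b) ≡ (p * a) * (q * b) + σ * ((r * a) * (s * b))
        distribute p q r s a b = solve 7 (λ p q r s a b σ →
          (p :* q :+ σ :* (r :* s)) :* (a :* b) :=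
          (p :* a) :* (q :* b) :+ σ :* ((r :* a) :* (s :* b))) refl p q r s a b σ

      -- Uniformity in `x` and `y` is essential: for real arguments the `n`-th partial sum is taken
      -- at the `n`-th approximations, which change with `n`.
      converges : ∀ B → 0ℚ ≤ B → ∀ ε → 0ℚ < ε → ∃ λ N → ∀ n → N ℕ.≤ n → ∀ {x y} → ∣ x ∣ ≤ B → ∣ y ∣ ≤ B →
        ∣ partialSum c n (x + y) - (partialSum p n x * partialSum q n y + σ * (partialSum r n x * partialSum s n y)) ∣ ≤ ε
      converges B 0≤B ε 0<ε = let (N , K≤N , eN≤) = e→0 (½ * ε) (0<*0< 0<½ 0<ε) in
        N , λ n N≤n {x} {y} x≤B y≤B → let eₙ≤ = ≤-trans (e-mono K≤N (ℕ.≤⇒≤′ N≤n)) eN≤ in begin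
          ∣ partialSum c n (x + y) - (partialSum p n x * partialSum q n y + σ * (partialSum r n x * partialSum s n y)) ∣
            ≡⟨ trans (∣p-q∣≡∣q-p∣ (partialSum c n (x + y)) _)
                 (cong (λ z → ∣ z - partialSum c n (x + y) ∣) (sym (rectangle-partialSums x y n))) ⟩
          ∣ rectangle n n (λ i j → c (i ℕ.+ j) * expTerms x y i j) - partialSum c n (x + y) ∣
            ≤⟨ square-close c c≤1 B 0≤B x≤B y≤B (ℕ.≤-trans K≤N N≤n) ⟩
          e n + e n
            ≤⟨ +-mono-≤ eₙ≤ eₙ≤ ⟩
          ½ * ε + ½ * ε
            ≡⟨ ½+½ ε ⟩
          ε ∎
        where
        open ≤-Reasoning
        open OnInterval (B + B) (0≤+0≤ 0≤B 0≤B) using (e→0; e-mono; e)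

  -- Cosine and sine

  module Trigonometry where

    open Reals
    open Addition

    cosCoeff-suc : ∀ j → cosCoeff (suc j) ≡ - sinCoeff j
    cosCoeff-suc zero          = refl
    cosCoeff-suc (suc zero)    = refl
    cosCoeff-suc (suc (suc j)) = cong -_ (cosCoeff-suc j)

    sinCoeff-suc : ∀ j → sinCoeff (suc j) ≡ cosCoeff j
    sinCoeff-suc zero          = refl
    sinCoeff-suc (suc zero)    = refl
    sinCoeff-suc (suc (suc j)) = cong -_ (sinCoeff-suc j)

    -- `cosCoeff k` and `sinCoeff k` are the real and imaginary parts of the `k`-th power of the
    -- imaginary unit; this and `sinCoeff-+` are the law of exponents.
    cosCoeff-+ : ∀ i j → cosCoeff (i ℕ.+ j) ≡ cosCoeff i * cosCoeff j + - 1ℚ * (sinCoeff i * sinCoeff j)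
    cosCoeff-+ zero          j = solve 2 (λ c s → c :=
      con 1ℚ :* c :+ con (- 1ℚ) :* (con 0ℚ :* s)) refl (cosCoeff j) (sinCoeff j)
    cosCoeff-+ (suc zero)    j = trans (cosCoeff-suc j) (solve 2 (λ c s → :- s :=
      con 0ℚ :* c :+ con (- 1ℚ) :* (con 1ℚ :* s)) refl (cosCoeff j) (sinCoeff j))
    cosCoeff-+ (suc (suc i)) j = trans (cong -_ (cosCoeff-+ i j)) (solve 4 (λ a b c d →
      :- (a :* b :+ con (- 1ℚ) :* (c :* d)) :=
      (:- a) :* b :+ con (- 1ℚ) :* ((:- c) :* d)) refl (cosCoeff i) (cosCoeff j) (sinCoeff i) (sinCoeff j))

    sinCoeff-+ : ∀ i j → sinCoeff (i ℕ.+ j) ≡ cosCoeff i * sinCoeff j + 1ℚ * (sinCoeff i * cosCoeff j)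
    sinCoeff-+ zero          j = solve 2 (λ c s → s :=
      con 1ℚ :* s :+ con 1ℚ :* (con 0ℚ :* c)) refl (cosCoeff j) (sinCoeff j)
    sinCoeff-+ (suc zero)    j = trans (sinCoeff-suc j) (solve 2 (λ c s → c :=
      con 0ℚ :* s :+ con 1ℚ :* (con 1ℚ :* c)) refl (cosCoeff j) (sinCoeff j))
    sinCoeff-+ (suc (suc i)) j = trans (cong -_ (sinCoeff-+ i j)) (solve 4 (λ a b c d →
      :- (a :* b :+ con 1ℚ :* (c :* d)) :=
      (:- a) :* b :+ con 1ℚ :* ((:- c) :* d)) refl (cosCoeff i) (sinCoeff j) (sinCoeff i) (cosCoeff j))

    module _ (c : ℕ → ℚ) (c≤1 : ∀ k → ∣ c k ∣ ≤ 1ℚ) where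

      -- On a bounded interval all partial sums share the Lipschitz constant `M`.
      powerSeries-cong : ∀ {x y} → x ≃ᵣ y → powerSeries c c≤1 x ≃ᵣ powerSeries c c≤1 y
      powerSeries-cong {x} {y} x≃y ε 0<ε =
        let (A , 0≤A , x≤A) = bounded x
            (B , 0≤B , y≤B) = bounded y
            open Series.OnInterval (A + B) (0≤+0≤ 0≤A 0≤B)
            open Sum c c≤1
            (δ , 0<δ , Mδ≤ε) = shrink M 0≤M ε 0<ε
            (N , near) = x≃y δ 0<δ
        in N , λ n N≤n → s-lip-M n (<⇒≤ 0<δ) Mδ≤ε
             (≤-trans (x≤A n) (p≤p+q 0≤B)) (≤-trans (y≤B n) (p≤q+p 0≤A)) (near n N≤n)

    cos-cong : ∀ {x y} → x ≃ᵣ y → cos x ≃ᵣ cos y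
    cos-cong {x} {y} = powerSeries-cong cosCoeff ∣cosCoeff∣≤1 {x} {y}

    sin-cong : ∀ {x y} → x ≃ᵣ y → sin x ≃ᵣ sin y
    sin-cong {x} {y} = powerSeries-cong sinCoeff ∣sinCoeff∣≤1 {x} {y}

    cos-+ : ∀ x y → cos (x +ᵣ y) ≃ᵣ cos x *ᵣ cos y -ᵣ sin x *ᵣ sin y
    cos-+ x y ε 0<ε =
      let (A , 0≤A , x≤A) = bounded x
          (B , 0≤B , y≤B) = bounded y
          (N , near) = Formula.converges cosCoeff cosCoeff cosCoeff sinCoeff sinCoeff (- 1ℚ) ∣cosCoeff∣≤1 cosCoeff-+
                         (A + B) (0≤+0≤ 0≤A 0≤B) ε 0<ε
      in N , λ n N≤n → ≤-trans (≤-reflexive (cong (λ z → ∣ seq (cos (x +ᵣ y)) n - z ∣)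
           (solve 4 (λ a b c d → a :* b :- c :* d := a :* b :+ con (- 1ℚ) :* (c :* d)) refl
             (seq (cos x) n) (seq (cos y) n) (seq (sin x) n) (seq (sin y) n))))
           (near n N≤n (≤-trans (x≤A n) (p≤p+q 0≤B)) (≤-trans (y≤B n) (p≤q+p 0≤A)))

    sin-+ : ∀ x y → sin (x +ᵣ y) ≃ᵣ cos x *ᵣ sin y +ᵣ sin x *ᵣ cos y
    sin-+ x y ε 0<ε =
      let (A , 0≤A , x≤A) = bounded x
          (B , 0≤B , y≤B) = bounded y
          (N , near) = Formula.converges sinCoeff cosCoeff sinCoeff sinCoeff cosCoeff 1ℚ ∣sinCoeff∣≤1 sinCoeff-+
                         (A + B) (0≤+0≤ 0≤A 0≤B) ε 0<ε
      in N , λ n N≤n → ≤-trans (≤-reflexive (cong (λ z → ∣ seq (sin (x +ᵣ y)) n - z ∣)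
           (solve 4 (λ a b c d → a :* b :+ c :* d := a :* b :+ con 1ℚ :* (c :* d)) refl
             (seq (cos x) n) (seq (sin y) n) (seq (sin x) n) (seq (cos y) n))))
           (near n N≤n (≤-trans (x≤A n) (p≤p+q 0≤B)) (≤-trans (y≤B n) (p≤q+p 0≤A)))

    sign : ℕ → ℚ
    sign zero    = 1ℚ
    sign (suc k) = - sign k

    expTerm-neg : ∀ k x → expTerm k (- x) ≡ sign k * expTerm k x
    expTerm-neg zero    x = refl
    expTerm-neg (suc k) x = fromℕ-cancel k (begin
      fromℕ (suc k) * expTerm (suc k) (- x)              ≡⟨ Series.expTerm-suc k (- x) ⟩
      - x * expTerm k (- x)                              ≡⟨ cong (- x *_) (expTerm-neg k x) ⟩
      - x * (sign k * expTerm k x)                       ≡⟨ solve 3 (λ x s e → (:- x) :* (s :* e) :=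
                                                              (:- s) :* (x :* e)) refl x (sign k) (expTerm k x) ⟩
      - sign k * (x * expTerm k x)                       ≡⟨ cong (- sign k *_) (sym (Series.expTerm-suc k x)) ⟩
      - sign k * (fromℕ (suc k) * expTerm (suc k) x)     ≡⟨ solve 3 (λ s f e → s :* (f :* e) := f :* (s :* e))
                                                              refl (- sign k) (fromℕ (suc k)) (expTerm (suc k) x) ⟩
      fromℕ (suc k) * (- sign k * expTerm (suc k) x)     ∎)
      where open ≡-Reasoning

    partialSum-neg : ∀ c σ → (∀ k → c k * sign k ≡ σ * c k) → ∀ n x → partialSum c n (- x) ≡ σ * partialSum c n x
    partialSum-neg c σ parity zero    x = sym (*-zeroʳ σ)
    partialSum-neg c σ parity (suc n) x = trans (cong₂ _+_ (partialSum-neg c σ parity n x) term)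
      (sym (*-distribˡ-+ σ (partialSum c n x) (c n * expTerm n x)))
      where
      open ≡-Reasoning
      term : c n * expTerm n (- x) ≡ σ * (c n * expTerm n x)
      term = begin
        c n * expTerm n (- x)            ≡⟨ cong (c n *_) (expTerm-neg n x) ⟩
        c n * (sign n * expTerm n x)     ≡⟨ sym (*-assoc (c n) (sign n) (expTerm n x)) ⟩
        c n * sign n * expTerm n x       ≡⟨ cong (_* expTerm n x) (parity n) ⟩
        σ * c n * expTerm n x            ≡⟨ *-assoc σ (c n) (expTerm n x) ⟩
        σ * (c n * expTerm n x)          ∎

    neg-neg : ∀ a b → - a * - - b ≡ - (a * b)
    neg-neg = solve 2 (λ a b → (:- a) :* (:- (:- b)) := :- (a :* b)) refl

    cosCoeff-even : ∀ k → cosCoeff k * sign k ≡ 1ℚ * cosCoeff k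
    cosCoeff-even zero          = refl
    cosCoeff-even (suc zero)    = refl
    cosCoeff-even (suc (suc k)) = trans (neg-neg (cosCoeff k) (sign k))
      (trans (cong -_ (cosCoeff-even k)) (neg-distribʳ-* 1ℚ (cosCoeff k)))

    sinCoeff-odd : ∀ k → sinCoeff k * sign k ≡ - 1ℚ * sinCoeff k
    sinCoeff-odd zero          = refl
    sinCoeff-odd (suc zero)    = refl
    sinCoeff-odd (suc (suc k)) = trans (neg-neg (sinCoeff k) (sign k))
      (trans (cong -_ (sinCoeff-odd k)) (neg-distribʳ-* (- 1ℚ) (sinCoeff k)))

    cos-neg : ∀ x → cos (-ᵣ x) ≃ᵣ cos x
    cos-neg x = ≡⇒≃ᵣ {cos (-ᵣ x)} {cos x} λ n →
      trans (partialSum-neg cosCoeff 1ℚ cosCoeff-even n (seq x n)) (*-identityˡ (seq (cos x) n))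

    sin-neg : ∀ x → sin (-ᵣ x) ≃ᵣ -ᵣ sin x
    sin-neg x = ≡⇒≃ᵣ {sin (-ᵣ x)} { -ᵣ sin x} λ n →
      trans (partialSum-neg sinCoeff (- 1ℚ) sinCoeff-odd n (seq x n))
        (trans (sym (neg-distribˡ-* 1ℚ (seq (sin x) n))) (cong -_ (*-identityˡ (seq (sin x) n))))

    expTerm-0 : ∀ k → expTerm (suc k) 0ℚ ≡ 0ℚ
    expTerm-0 k = fromℕ-cancel k (trans (Series.expTerm-suc k 0ℚ)
      (trans (*-zeroˡ (expTerm k 0ℚ)) (sym (*-zeroʳ (fromℕ (suc k))))))

    partialSum-0 : ∀ c n → partialSum c (suc n) 0ℚ ≡ c 0
    partialSum-0 c zero    = solve 1 (λ c → con 0ℚ :+ c :* con 1ℚ := c) refl (c 0)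
    partialSum-0 c (suc n) = trans
      (cong₂ _+_ (partialSum-0 c n) (trans (cong (c (suc n) *_) (expTerm-0 n)) (*-zeroʳ (c (suc n)))))
      (+-identityʳ (c 0))

    powerSeries-0 : ∀ c c≤1 → powerSeries c c≤1 (fromℚ 0ℚ) ≃ᵣ fromℚ (c 0)
    -- The index starts at 1 because the partial sum at 0 is empty.
    powerSeries-0 c c≤1 ε 0<ε = 1 , λ { (suc n) _ → ≤-trans
      (≤-reflexive (trans (cong (λ z → ∣ z - c 0 ∣) (partialSum-0 c n)) (cong ∣_∣ (+-inverseʳ (c 0))))) (<⇒≤ 0<ε) }

    cos-0 : cos (fromℚ 0ℚ) ≃ᵣ fromℚ 1ℚ
    cos-0 = powerSeries-0 cosCoeff ∣cosCoeff∣≤1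

    sin-0 : sin (fromℚ 0ℚ) ≃ᵣ fromℚ 0ℚ
    sin-0 = powerSeries-0 sinCoeff ∣sinCoeff∣≤1

    open Subfields realField using (_≈ᵍ_; _^_; powers; sum-of-squares≈1)
    private
      module R = StableField realField

    -- De Moivre's formula, by iterating the addition formulas.
    anglePoint-^ : ∀ x k → anglePoint x ^ k ≈ᵍ anglePoint (fromℚ (fromℕ k) *ᵣ x)
    anglePoint-^ x = powers (anglePoint x) (λ k → anglePoint (k× k))
      ( R.trans {cos (k× 0)} {cos (fromℚ 0ℚ)} {fromℚ 1ℚ} (cos-cong {k× 0} {fromℚ 0ℚ} 0×) cos-0
      , R.trans {sin (k× 0)} {sin (fromℚ 0ℚ)} {fromℚ 0ℚ} (sin-cong {k× 0} {fromℚ 0ℚ} 0×) sin-0)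
      (λ k → R.trans {cos (k× (suc k))} {cos (x +ᵣ k× k)} {cos x *ᵣ cos (k× k) -ᵣ sin x *ᵣ sin (k× k)}
               (cos-cong {k× (suc k)} {x +ᵣ k× k} (suc× k)) (cos-+ x (k× k))
           , R.trans {sin (k× (suc k))} {sin (x +ᵣ k× k)} {cos x *ᵣ sin (k× k) +ᵣ sin x *ᵣ cos (k× k)}
               (sin-cong {k× (suc k)} {x +ᵣ k× k} (suc× k)) (sin-+ x (k× k)))
      where
      k× : ℕ → ℝ
      k× k = fromℚ (fromℕ k) *ᵣ x
      0× : k× 0 ≃ᵣ fromℚ 0ℚ
      0× = ≡⇒≃ᵣ {k× 0} {fromℚ 0ℚ} λ n → *-zeroˡ (seq x n)
      suc× : ∀ k → k× (suc k) ≃ᵣ x +ᵣ k× k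
      suc× k = ≡⇒≃ᵣ {k× (suc k)} {x +ᵣ k× k} λ n → trans (cong (_* seq x n) (fromℕ-suc k))
        (solve 2 (λ f a → (con 1ℚ :+ f) :* a := a :+ f :* a) refl (fromℕ k) (seq x n))

    pythagoras : ∀ x → cos x *ᵣ cos x +ᵣ sin x *ᵣ sin x ≃ᵣ fromℚ 1ℚ
    pythagoras x = sum-of-squares≈1 {cos x} {sin x} {cos (-ᵣ x)} {sin (-ᵣ x)} (cos-neg x) (sin-neg x)
      (R.trans {cos x *ᵣ cos (-ᵣ x) -ᵣ sin x *ᵣ sin (-ᵣ x)} {cos (x -ᵣ x)} {fromℚ 1ℚ}
        (R.sym {cos (x -ᵣ x)} {cos x *ᵣ cos (-ᵣ x) -ᵣ sin x *ᵣ sin (-ᵣ x)} (cos-+ x (-ᵣ x)))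
        (R.trans {cos (x -ᵣ x)} {cos (fromℚ 0ℚ)} {fromℚ 1ℚ} (cos-cong {x -ᵣ x} {fromℚ 0ℚ} (R.-‿inverseʳ x)) cos-0))

    n×x/n : ∀ n .{{_ : ℕ.NonZero n}} x → fromℚ (fromℕ n) *ᵣ (x /ᵣ n) ≃ᵣ x
    n×x/n n x = ≡⇒≃ᵣ {fromℚ (fromℕ n) *ᵣ (x /ᵣ n)} {x} λ k → trans
      (solve 3 (λ f a i → f :* (a :* i) := (f :* i) :* a) refl (fromℕ n) (seq x k) (+ 1 / n))
      (trans (cong (_* seq x k) (Series.fromℕ-inverse n)) (*-identityˡ (seq x k)))

  open Subfields Reals.realField using (embed; _≈ᵍ_; _*ᵍ_)

  HasPoint[24+7i]/25 : ℝ → Set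
  HasPoint[24+7i]/25 α = embed (+ 25 , + 0) *ᵍ anglePoint α ≈ᵍ embed (+ 24 , + 7)

  -- An angle with sine 7/25

  module Arcsine where

    open Reals
    open Series using (cancel-suc)
    open Series.OnInterval ½ (<⇒≤ 0<½)
    open Sum sinCoeff ∣sinCoeff∣≤1 using (s; scaled≤; s-tail-2e)

    c : ℚ
    c = + 7 / 25

    -- For the bound ½ the index `K` evaluates to 1.
    1≤3 : 1 ℕ.≤ 3
    1≤3 = ℕ.s≤s ℕ.z≤n

    s-3 : ∀ x → s 3 x ≡ x
    s-3 x = solve 2 (λ x e → ((con 0ℚ :+ con 0ℚ :* con 1ℚ) :+ con 1ℚ :* (x :* con 1ℚ :* con 1ℚ))
      :+ con 0ℚ :* e := x) refl x (expTerm 2 x)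

    -- x ↦ x + (c - sin x) is a contraction of [-½ , ½] with fixed point arcsin c.
    -- The partial sum starts at index 3, the first one at which the terms of
    -- degree at most 2 are all present.
    v : ℕ → ℚ
    v zero    = c
    v (suc n) = v n + (c - s (3 ℕ.+ n) (v n))

    -- The terms of the sine from degree 3 on contribute at most `e 3 + e 3 = 1/24`, and
    -- `7/25 + 1/24 ≤ ½`.
    v≤½ : ∀ n → ∣ v n ∣ ≤ ½
    v≤½ zero    = from-yes (∣ c ∣ ≤? ½)
    v≤½ (suc n) = begin
      ∣ v n + (c - s (3 ℕ.+ n) (v n)) ∣           ≡⟨ cong ∣_∣ (solve 3 (λ v c t → v :+ (c :- t) := c :+ (v :- t))
                                                       refl (v n) c (s (3 ℕ.+ n) (v n))) ⟩
      ∣ c + (v n - s (3 ℕ.+ n) (v n)) ∣           ≤⟨ ∣p+q∣≤∣p∣+∣q∣ c (v n - s (3 ℕ.+ n) (v n)) ⟩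
      ∣ c ∣ + ∣ v n - s (3 ℕ.+ n) (v n) ∣         ≡⟨ cong (λ z → ∣ c ∣ + z) (trans (∣p-q∣≡∣q-p∣ (v n) (s (3 ℕ.+ n) (v n)))
                                                       (cong (λ z → ∣ s (3 ℕ.+ n) (v n) - z ∣) (sym (s-3 (v n))))) ⟩
      ∣ c ∣ + ∣ s (3 ℕ.+ n) (v n) - s 3 (v n) ∣   ≤⟨ +-monoʳ-≤ ∣ c ∣ (s-tail-2e 1≤3 (ℕ.m≤m+n 3 n) (v≤½ n)) ⟩
      ∣ c ∣ + (e 3 + e 3)                         ≤⟨ from-yes (∣ c ∣ + (e 3 + e 3) ≤? ½) ⟩
      ½                                           ∎
      where open ≤-Reasoning

    -- Without its linear term the sine series starts in degree 3, and its term of degree `k + 1`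
    -- has Lipschitz constant at most `e k`. The constants from `e 2` on add up to at most
    -- `e 2 + e 2 = ¼`.
    contraction : ∀ n {x y} → ∣ x ∣ ≤ ½ → ∣ y ∣ ≤ ½ →
      ∣ (s (3 ℕ.+ n) x - x) - (s (3 ℕ.+ n) y - y) ∣ ≤ ∣ x - y ∣ * (E (2 ℕ.+ n) - E 2)
    contraction zero {x} {y} _ _ = ≤-reflexive (trans
      (cong₂ (λ a b → ∣ (a - x) - (b - y) ∣) (s-3 x) (s-3 y)) (trans
      (cong ∣_∣ (solve 2 (λ x y → (x :- x) :- (y :- y) := con 0ℚ) refl x y))
      (sym (trans (cong (∣ x - y ∣ *_) (+-inverseʳ (E 2))) (*-zeroʳ ∣ x - y ∣)))))
    contraction (suc n) {x} {y} x≤ y≤ = begin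
      ∣ ((a + k * p) - x) - ((b + k * q) - y) ∣
        ≡⟨ cong ∣_∣ (solve 7 (λ a b k p q x y → ((a :+ k :* p) :- x) :- ((b :+ k :* q) :- y) :=
             ((a :- x) :- (b :- y)) :+ k :* (p :- q)) refl a b k p q x y) ⟩
      ∣ ((a - x) - (b - y)) + k * (p - q) ∣
        ≤⟨ ∣p+q∣≤∣p∣+∣q∣ ((a - x) - (b - y)) (k * (p - q)) ⟩
      ∣ (a - x) - (b - y) ∣ + ∣ k * (p - q) ∣
        ≤⟨ +-mono-≤ (contraction n x≤ y≤) (scaled≤ (3 ℕ.+ n) (term-lip (2 ℕ.+ n) x≤ y≤)) ⟩
      ∣ x - y ∣ * (E (2 ℕ.+ n) - E 2) + ∣ x - y ∣ * e (2 ℕ.+ n)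
        ≡⟨ solve 4 (λ d E₁ E₂ t → d :* (E₁ :- E₂) :+ d :* t := d :* (E₁ :+ t :- E₂)) refl
             ∣ x - y ∣ (E (2 ℕ.+ n)) (E 2) (e (2 ℕ.+ n)) ⟩
      ∣ x - y ∣ * (E (3 ℕ.+ n) - E 2) ∎
      where
      open ≤-Reasoning
      a b k p q : ℚ
      a = s (3 ℕ.+ n) x
      b = s (3 ℕ.+ n) y
      k = sinCoeff (3 ℕ.+ n)
      p = expTerm (3 ℕ.+ n) x
      q = expTerm (3 ℕ.+ n) y

    ρ : ℕ → ℚ
    ρ zero    = 1ℚ
    ρ (suc n) = ½ * ρ n

    0<ρ : ∀ n → 0ℚ < ρ n
    0<ρ zero    = positive⁻¹ 1ℚ
    0<ρ (suc n) = 0<*0< 0<½ (0<ρ n)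

    ρ-step : ∀ n → ρ (suc n) ≤ ρ n
    ρ-step n = ≤-trans (p≤p+q (<⇒≤ (0<ρ (suc n)))) (≤-reflexive (½+½ (ρ n)))

    ρ-mono : ∀ {m n} → m ℕ.≤′ n → ρ n ≤ ρ m
    ρ-mono ℕ.≤′-refl           = ≤-refl
    ρ-mono (ℕ.≤′-step {n} m≤n) = ≤-trans (ρ-step n) (ρ-mono m≤n)

    ¼ : ℚ
    ¼ = ½ * ½

    e≤¼ρ : ∀ n → e (3 ℕ.+ n) ≤ ¼ * ρ n
    e≤¼ρ zero    = from-yes (e 3 ≤? ¼ * 1ℚ)
    e≤¼ρ (suc n) = begin
      e′                  ≡⟨ sym (solve 1 (λ a → con ½ :* (a :+ a) := a) refl e′) ⟩
      ½ * (e′ + e′)       ≤⟨ *-monoˡ-≤-nonNeg ½ (≤-trans (halving (3 ℕ.+ n) (ℕ.s≤s ℕ.z≤n)) (e≤¼ρ n)) ⟩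
      ½ * (¼ * ρ n)       ≡⟨ solve 1 (λ r → con ½ :* (con ¼ :* r) := con ¼ :* (con ½ :* r)) refl (ρ n) ⟩
      ¼ * (½ * ρ n)       ∎
      where
      open ≤-Reasoning
      e′ = e (4 ℕ.+ n)

    -- The ratio ½ is made of two quarters: one from the contraction, one from the single new series
    -- term that enters when the index of the partial sum grows.
    v-step : ∀ n → ∣ v (suc n) - v n ∣ ≤ ρ n
    v-step zero = from-yes (∣ v 1 - v 0 ∣ ≤? 1ℚ)
    v-step (suc n) = begin
      ∣ (y + (c - (b + t))) - y ∣
        ≡⟨ cong ∣_∣ (solve 6 (λ x c a b t t′ → let y = x :+ (c :- a) in
             (y :+ (c :- (b :+ t))) :- y :=
             (:- (((b :+ t) :- y) :- ((a :+ t′) :- x))) :+ (:- t′)) refl x c a b t t′) ⟩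
      ∣ - (((b + t) - y) - ((a + t′) - x)) + - t′ ∣
        ≤⟨ ∣p+q∣≤∣p∣+∣q∣ (- (((b + t) - y) - ((a + t′) - x))) (- t′) ⟩
      ∣ - (((b + t) - y) - ((a + t′) - x)) ∣ + ∣ - t′ ∣
        ≡⟨ cong₂ _+_ (∣-p∣≡∣p∣ (((b + t) - y) - ((a + t′) - x))) (∣-p∣≡∣p∣ t′) ⟩
      ∣ ((b + t) - y) - ((a + t′) - x) ∣ + ∣ t′ ∣
        ≤⟨ +-mono-≤ (≤-trans (contraction (suc n) (v≤½ (suc n)) (v≤½ n))
                      (*-mono-≤ {r = E (3 ℕ.+ n) - E 2} (0≤E-E₂ n) (<⇒≤ (0<ρ n)) (v-step n)
                        (tail≤ {2} (ℕ.s≤s ℕ.z≤n) (ℕ.m≤m+n 2 (suc n)))))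
                    (≤-trans (scaled≤ (3 ℕ.+ n) (term≤ (3 ℕ.+ n) (v≤½ n))) (e≤¼ρ n)) ⟩
      ρ n * (e 2 + e 2) + ¼ * ρ n
        ≡⟨ solve 1 (λ r → r :* con ¼ :+ con ¼ :* r := con ½ :* r) refl (ρ n) ⟩
      ½ * ρ n ∎
      where
      open ≤-Reasoning
      x y a b t t′ : ℚ
      x = v n
      y = v (suc n)
      a = s (3 ℕ.+ n) x
      b = s (3 ℕ.+ n) y
      t = sinCoeff (3 ℕ.+ n) * expTerm (3 ℕ.+ n) y
      t′ = sinCoeff (3 ℕ.+ n) * expTerm (3 ℕ.+ n) x
      0≤E-E₂ : ∀ n → 0ℚ ≤ E (3 ℕ.+ n) - E 2
      0≤E-E₂ n = subst (_≤ E (3 ℕ.+ n) - E 2) (+-inverseʳ (E 2))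
        (+-monoˡ-≤ (- E 2) (Sum.E-mono sinCoeff ∣sinCoeff∣≤1 (ℕ.≤⇒≤′ (ℕ.m≤m+n 2 (suc n)))))

    -- The steps from `n` on add up to at most the geometric tail `ρ n + ρ n`; carrying this tail on
    -- the left lets the induction close.
    v-drift : ∀ {m n} → m ℕ.≤′ n → ∣ v n - v m ∣ + (ρ n + ρ n) ≤ ρ m + ρ m
    v-drift {m} ℕ.≤′-refl = ≤-reflexive (trans (cong (λ z → ∣ z ∣ + (ρ m + ρ m)) (+-inverseʳ (v m))) (+-identityˡ (ρ m + ρ m)))
    v-drift {m} (ℕ.≤′-step {n} m≤n) = begin
      ∣ v (suc n) - v m ∣ + (½ * ρ n + ½ * ρ n)             ≤⟨ +-mono-≤ (tri (v (suc n)) (v n) (v m)) (≤-reflexive (½+½ (ρ n))) ⟩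
      (∣ v (suc n) - v n ∣ + ∣ v n - v m ∣) + ρ n           ≤⟨ +-monoˡ-≤ (ρ n) (+-monoˡ-≤ ∣ v n - v m ∣ (v-step n)) ⟩
      (ρ n + ∣ v n - v m ∣) + ρ n                           ≡⟨ solve 2 (λ r d → (r :+ d) :+ r := d :+ (r :+ r)) refl
                                                                 (ρ n) ∣ v n - v m ∣ ⟩
      ∣ v n - v m ∣ + (ρ n + ρ n)                           ≤⟨ v-drift m≤n ⟩
      ρ m + ρ m                                             ∎
      where open ≤-Reasoning

    v-near : ∀ {m n} → m ℕ.≤ n → ∣ v n - v m ∣ ≤ ρ m + ρ m
    v-near {m} {n} m≤n = ≤-trans (p≤p+q (0≤+0≤ (<⇒≤ (0<ρ n)) (<⇒≤ (0<ρ n)))) (v-drift (ℕ.≤⇒≤′ m≤n))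

    nρ≤1 : ∀ n → fromℕ (suc n) * ρ n ≤ 1ℚ
    nρ≤1 zero    = ≤-refl
    nρ≤1 (suc n) = begin
      fromℕ (suc (suc n)) * (½ * ρ n)        ≡⟨ cong (_* (½ * ρ n)) (fromℕ-suc (suc n)) ⟩
      (1ℚ + fromℕ (suc n)) * (½ * ρ n)       ≡⟨ solve 2 (λ f r → (con 1ℚ :+ f) :* (con ½ :* r) :=
                                                  con ½ :* r :+ con ½ :* (f :* r)) refl (fromℕ (suc n)) (ρ n) ⟩
      ½ * ρ n + ½ * (fromℕ (suc n) * ρ n)    ≤⟨ +-mono-≤ (*-monoˡ-≤-nonNeg ½ (ρ-mono (ℕ.≤⇒≤′ (ℕ.z≤n {n}))))
                                                  (*-monoˡ-≤-nonNeg ½ (nρ≤1 n)) ⟩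
      ½ * 1ℚ + ½ * 1ℚ                        ≡⟨ ½+½ 1ℚ ⟩
      1ℚ                                     ∎
      where open ≤-Reasoning

    ρ→0 : ∀ ε → 0ℚ < ε → ∃ λ N → ρ N ≤ ε
    ρ→0 ε 0<ε = N , cancel-suc N (begin
      fromℕ (suc N) * ρ N       ≤⟨ nρ≤1 N ⟩
      1ℚ                        ≡⟨ sym (*-inverseˡ ε) ⟩
      1/ ε * ε                  ≤⟨ *-monoʳ-≤-nonNeg ε {{≥0 (<⇒≤ 0<ε)}}
                                     (≤-trans (proj₂ (archimedes (1/ ε))) (fromℕ-mono (ℕ.n≤1+n N))) ⟩
      fromℕ (suc N) * ε         ∎)
      where
      open ≤-Reasoning
      instance
        ε≢0 : NonZero ε
        ε≢0 = pos⇒nonZero ε {{positive 0<ε}}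
      N = proj₁ (archimedes (1/ ε))

    v-cauchy : IsCauchy v
    v-cauchy ε 0<ε = let (N , ρ≤) = ρ→0 (½ * (½ * ε)) (0<*0< 0<½ (0<*0< 0<½ 0<ε))
                         near : ∀ {n} → N ℕ.≤ n → ∣ v n - v N ∣ ≤ ½ * ε
                         near N≤n = ≤½+½ (v-near N≤n) ρ≤ ρ≤
      in N , λ m n N≤m N≤n → ≤½+½ (tri (v m) (v N) (v n)) (near N≤m)
           (≤-trans (≤-reflexive (∣p-q∣≡∣q-p∣ (v N) (v n))) (near N≤n))

    α : ℝ
    α = mkℝ v v-cauchy

    -- `c - s (3 + n) (v n)` is exactly the step `v (suc n) - v n`, bounded by `ρ n`. The `n`-th
    -- entry of `sin α` uses `s n` instead; the three terms in between belong to a tail that tends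
    -- to 0.
    sin-α : sin α ≃ᵣ fromℚ c
    sin-α ε 0<ε =
      let (L , K≤L , eL≤) = e→0 (½ * (½ * ε)) (0<*0< 0<½ (0<*0< 0<½ 0<ε))
          (M , ρ≤) = ρ→0 (½ * ε) (0<*0< 0<½ 0<ε)
      in L ℕ.⊔ M , λ n LM≤n →
        let L≤n = ℕ.m⊔n≤o⇒m≤o L M LM≤n ; e≤ = ≤-trans (e-mono K≤L (ℕ.≤⇒≤′ L≤n)) eL≤ in
        ≤½+½ (tri (s n (v n)) (s (3 ℕ.+ n) (v n)) c)
          (≤-trans (≤-reflexive (∣p-q∣≡∣q-p∣ (s n (v n)) (s (3 ℕ.+ n) (v n))))
            (≤½+½ (s-tail-2e (ℕ.≤-trans K≤L L≤n) (ℕ.m≤n+m n 3) (v≤½ n)) e≤ e≤))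
          (≤-trans (≤-reflexive (trans (∣p-q∣≡∣q-p∣ (s (3 ℕ.+ n) (v n)) c) (cong ∣_∣
             (solve 3 (λ c t x → c :- t := (x :+ (c :- t)) :- x) refl c (s (3 ℕ.+ n) (v n)) (v n)))))
            (≤-trans (v-step n) (≤-trans (ρ-mono (ℕ.≤⇒≤′ (ℕ.m⊔n≤o⇒n≤o L M LM≤n))) ρ≤)))

    -- The partial sum at index 2 equals 1, and the later terms amount to at most `e 2 + e 2 = ¼`.
    -- This settles the sign of the cosine.
    cos-α-near-1 : ∀ n → 2 ℕ.≤ n → ∣ seq (cos α) n - 1ℚ ∣ ≤ ¼
    cos-α-near-1 n 2≤n = subst (λ z → ∣ partialSum cosCoeff n (v n) - z ∣ ≤ ¼)
      (solve 1 (λ x → (con 0ℚ :+ con 1ℚ :* con 1ℚ) :+ con 0ℚ :* (x :* con 1ℚ :* con 1ℚ) := con 1ℚ) refl (v n))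
      (Sum.s-tail-2e cosCoeff ∣cosCoeff∣≤1 {2} (ℕ.s≤s ℕ.z≤n) 2≤n (v≤½ n))

    open Subfields realField using (leg-unique; embed-scaled)

    cos-α : cos α ≃ᵣ fromℚ (+ 24 / 25)
    cos-α = leg-unique {cos α} {sin α} {fromℚ (+ 24 / 25)} {fromℚ c}
      (Trigonometry.pythagoras α) sin-α
      (≡⇒≃ᵣ {fromℚ (+ 24 / 25) *ᵣ fromℚ (+ 24 / 25) +ᵣ fromℚ c *ᵣ fromℚ c} {fromℚ 1ℚ} λ _ → refl)
      positive-cos
      where
      -- With the opposite sign, `1 + 24/25` would be at most `¼ + ½`.
      positive-cos : ¬ (cos α +ᵣ fromℚ (+ 24 / 25) ≃ᵣ fromℚ 0ℚ)
      positive-cos eq =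
        let (N , near) = eq ½ 0<½
            C = seq (cos α) (N ℕ.⊔ 2)
        in from-no (∣ 1ℚ + + 24 / 25 ∣ ≤? ¼ + ½) (begin
          ∣ 1ℚ + + 24 / 25 ∣                               ≡⟨ cong ∣_∣ (solve 2 (λ C p → con 1ℚ :+ p :=
            (con 1ℚ :- C) :+ (C :+ p :- con 0ℚ)) refl C (+ 24 / 25)) ⟩
          ∣ (1ℚ - C) + (C + + 24 / 25 - 0ℚ) ∣              ≤⟨ ∣p+q∣≤∣p∣+∣q∣ (1ℚ - C) (C + + 24 / 25 - 0ℚ) ⟩
          ∣ 1ℚ - C ∣ + ∣ C + + 24 / 25 - 0ℚ ∣              ≤⟨ +-mono-≤
            (≤-trans (≤-reflexive (∣p-q∣≡∣q-p∣ 1ℚ C)) (cos-α-near-1 (N ℕ.⊔ 2) (ℕ.m≤n⊔m N 2)))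
            (near (N ℕ.⊔ 2) (ℕ.m≤m⊔n N 2)) ⟩
          ¼ + ½                                            ∎)
        where open ≤-Reasoning

    anglePoint-α : HasPoint[24+7i]/25 α
    anglePoint-α = embed-scaled {cos α} {sin α} {fromℚ (+ 24 / 25)} {fromℚ c} (+ 25) (+ 24) (+ 7) cos-α sin-α
      (≡⇒≃ᵣ {fromℚ (fromℤ (+ 25)) *ᵣ fromℚ (+ 24 / 25)} {fromℚ (fromℤ (+ 24))} λ _ → refl)
      (≡⇒≃ᵣ {fromℚ (fromℤ (+ 25)) *ᵣ fromℚ c} {fromℚ (fromℤ (+ 7))} λ _ → refl)

  -- Later steps use only the defining property of the angle; its sequence should not unfold.
  abstract
    angle[24+7i]/25 : ∃ HasPoint[24+7i]/25
    angle[24+7i]/25 = Arcsine.α , Arcsine.anglePoint-α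

open Analysis

-- Constructible points

module Reach (n : ℕ) (w : Point) (S : Pred Point 0ℓ) where

  open Subfields Reals.realField
  open Plane Reals.realField
  open Radicals n w

  SInAdmissible : Set₁
  SInAdmissible = ∀ {F} → Admissible F → ∀ {P} → P ∈ S → P ∈² F

  DefinedOver : Figure → Pred ℝ 0ℓ → Set
  DefinedOver (line   P Q) F = P ∈² F × Q ∈² F × ¬ (P ≃ₚ Q)
  DefinedOver (circle P Q) F = P ∈² F × Q ∈² F × ¬ (P ≃ₚ Q)

  DefinedOver-⊆ : ∀ f {F G} → F ⊆ G → DefinedOver f F → DefinedOver f G
  DefinedOver-⊆ (line   _ _) F⊆G ((a , b) , (c , d) , P≄Q) = (F⊆G a , F⊆G b) , (F⊆G c , F⊆G d) , P≄Q
  DefinedOver-⊆ (circle _ _) F⊆G ((a , b) , (c , d) , P≄Q) = (F⊆G a , F⊆G b) , (F⊆G c , F⊆G d) , P≄Q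

  intersection : ∀ {F} → IsSubfield F → ∀ f g {X} → DefinedOver f F → DefinedOver g F →
    ¬ (⟦ f ⟧ ≐ ⟦ g ⟧) → X ∈ ⟦ f ⟧ → X ∈ ⟦ g ⟧ → QuadraticOver F X
  intersection sub (line P Q) (line P′ Q′) {X} (P∈ , Q∈ , P≄Q) (P′∈ , Q′∈ , P′≄Q′) f≠g X∈f X∈g =
    line∩line sub {P} {Q} {P′} {Q′} {X} P∈ Q∈ P′∈ Q′∈ P≄Q P′≄Q′ f≠g X∈f X∈g
  intersection sub (line P Q) (circle P′ Q′) {X} (P∈ , Q∈ , P≄Q) (P′∈ , Q′∈ , _) _ X∈f X∈g =
    line∩circle sub {P} {Q} {P′} {Q′} {X} P∈ Q∈ P′∈ Q′∈ P≄Q X∈f X∈g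
  intersection sub (circle P Q) (line P′ Q′) {X} (P∈ , Q∈ , _) (P′∈ , Q′∈ , P′≄Q′) _ X∈f X∈g =
    line∩circle sub {P′} {Q′} {P} {Q} {X} P′∈ Q′∈ P∈ Q∈ P′≄Q′ X∈g X∈f
  intersection sub (circle P Q) (circle P′ Q′) {X} (P∈ , Q∈ , _) (P′∈ , Q′∈ , _) f≠g X∈f X∈g =
    circle∩circle sub {P} {Q} {P′} {Q′} {X} P∈ Q∈ P′∈ Q′∈ f≠g X∈f X∈g

  Extends : Pred ℝ 0ℓ → (Pred ℝ 0ℓ → Set) → Set₁
  Extends F P = ¬ ¬ ∃ λ G → F ⊆ G × Admissible G × P G

  module _ (S-admissible : SInAdmissible) where

    -- `F` is arbitrary so that the ingredients of a step can be treated in succession, each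
    -- starting from the field reached by the one before; no compositum of two towers is formed.
    constructible : ∀ {X} → Constructible S X → ∀ {F} → Admissible F → Extends F (X ∈²_)
    drawn : ∀ {f} → Drawn S f → ∀ {F} → Admissible F → Extends F (DefinedOver f)

    constructible {X} (given {P} P∈S X≃P) {F} adm ¬∃ = ¬∃
      (F , (λ Fx → Fx) , adm , resp (R.sym {proj₁ X} {proj₁ P} (proj₁ X≃P)) (proj₁ (S-admissible adm P∈S))
                             , resp (R.sym {proj₂ X} {proj₂ P} (proj₂ X≃P)) (proj₂ (S-admissible adm P∈S)))
      where
      open IsSubfield (Admissible.isSubfield adm)
      module R = StableField Reals.realField
    constructible {X} (intersect {f} {g} Df Dg f≠g X∈f X∈g) adm ¬∃ =
      drawn Df adm λ (G₁ , F⊆G₁ , adm₁ , f∈G₁) →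
      drawn Dg adm₁ λ (G₂ , G₁⊆G₂ , adm₂ , g∈G₂) →
      let open QuadraticOver (intersection (Admissible.isSubfield adm₂) f g {X}
                                (DefinedOver-⊆ f G₁⊆G₂ f∈G₁) g∈G₂ f≠g X∈f X∈g) in
      extend adm₂ root²∈F λ (G₃ , G₂⊆G₃ , adm₃ , s∈G₃) →
      ¬∃ (G₃ , (λ Fx → G₂⊆G₃ (G₁⊆G₂ (F⊆G₁ Fx))) , adm₃ , generate (Admissible.isSubfield adm₃) G₂⊆G₃ s∈G₃)

    drawn (line   DP DQ P≄Q) adm ¬∃ =
      constructible DP adm λ (G₁ , F⊆G₁ , adm₁ , P∈G₁) →
      constructible DQ adm₁ λ (G₂ , G₁⊆G₂ , adm₂ , Q∈G₂) →
      ¬∃ (G₂ , (λ Fx → G₁⊆G₂ (F⊆G₁ Fx)) , adm₂ , (G₁⊆G₂ (proj₁ P∈G₁) , G₁⊆G₂ (proj₂ P∈G₁)) , Q∈G₂ , P≄Q)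
    drawn (circle DP DQ P≄Q) adm ¬∃ =
      constructible DP adm λ (G₁ , F⊆G₁ , adm₁ , P∈G₁) →
      constructible DQ adm₁ λ (G₂ , G₁⊆G₂ , adm₂ , Q∈G₂) →
      ¬∃ (G₂ , (λ Fx → G₁⊆G₂ (F⊆G₁ Fx)) , adm₂ , (G₁⊆G₂ (proj₁ P∈G₁) , G₁⊆G₂ (proj₂ P∈G₁)) , Q∈G₂ , P≄Q)

O I : Point
O = fromℚ 0ℚ , fromℚ 0ℚ
I = fromℚ 1ℚ , fromℚ 0ℚ

module _ (α β : ℝ) (α-point : HasPoint[24+7i]/25 α) (n : ℕ) (nβ≃α : fromℚ (fromℕ n) *ᵣ β ≃ᵣ α)
         .{{_ : ℕ.NonZero n}} (not-2^ : ¬ (∃ λ k → n ≡ 2 ℕ.^ k)) where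

  open Subfields Reals.realField
  open Radicals n (anglePoint α)
  open Reach n (anglePoint α) (｛ O ｝ ∪ ｛ I ｝ ∪ ｛ anglePoint α ｝) using (constructible; SInAdmissible)

  given-points : SInAdmissible
  given-points adm (inj₁ ≡.refl)        = let open IsSubfield (Admissible.isSubfield adm) in 0-closed , 0-closed
  given-points adm (inj₂ (inj₁ ≡.refl)) = let open IsSubfield (Admissible.isSubfield adm) in 1-closed , 0-closed
  given-points adm (inj₂ (inj₂ ≡.refl)) = Admissible.contains-w adm

  -- By De Moivre the point at `β` is an `n`-th root of the point at `α`, which an admissible field
  -- excludes already for `j = 0`.
  not-constructible : ¬ Constructible (｛ O ｝ ∪ ｛ I ｝ ∪ ｛ anglePoint α ｝) (anglePoint β)
  not-constructible β-constructible =
    constructible given-points β-constructible (Ratio-admissible (anglePoint α) α-point n not-2^)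
      λ (G , _ , adm , β∈G) → no-nth-root {z = anglePoint β} {u = anglePoint (fromℚ (fromℕ n) *ᵣ β)} adm β∈G
        (Trigonometry.anglePoint-^ β n)
        (Trigonometry.cos-cong {fromℚ (fromℕ n) *ᵣ β} {α} nβ≃α , Trigonometry.sin-cong {fromℚ (fromℕ n) *ᵣ β} {α} nβ≃α)

n<2^n : ∀ n → n ℕ.< 2 ℕ.^ n
n<2^n zero    = ℕ.s≤s ℕ.z≤n
n<2^n (suc n) = ℕ.≤-trans (ℕ.s≤s (n<2^n n)) (ℕ.^-monoʳ-< 2 ℕ.≤-refl (ℕ.n<1+n n))

-- An exponent `k` with `n ≡ 2 ^ k` is smaller than `n`, so a bounded search decides.
power-of-2-stable : ∀ n → ¬ ¬ (∃ λ k → n ≡ 2 ℕ.^ k) → ∃ λ k → n ≡ 2 ℕ.^ k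
power-of-2-stable n ¬¬2^ with ℕ.anyUpTo? (λ k → n ℕ.≟ 2 ℕ.^ k) n
... | yes (k , _ , eq) = k , eq
... | no  ¬bounded     = contradiction
  (λ (k , eq) → ¬bounded (k , ≡.subst (k ℕ.<_) (≡.sym eq) (n<2^n k) , eq)) ¬¬2^

open import Data.Nat using (NonZero; _^_)

theoremA1 : (n : ℕ) → .{{_ : NonZero n}} → (∀ (α : ℝ) → Sectable n α) → ∃ λ (k : ℕ) → n ≡ 2 ^ k
theoremA1 n {{n≢0}} sectable = power-of-2-stable n λ not-2^ →
  not-constructible α ((α /ᵣ n) {{n≢0}}) (proj₂ angle[24+7i]/25) n
    (Trigonometry.n×x/n n {{n≢0}} α) {{n≢0}} not-2^ (sectable α)
  where
  α : ℝ
  α = proj₁ angle[24+7i]/25
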